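{- The following decision problem TRIPLE ROM-DOM is NP-complete when restricted to chordal graphs: given a graph $\Gamma=(V,E)$ and a positive integer $k\le |V|$, decide whether $\Gamma$ has a triple Roman dominating function of weight at most $k$.
   Context: For a graph $\Gamma=(V,E)$ and a function $h:V\to\{0,1,2,3,4\}$, the active neighbourhood of a vertex $v$ is $AN(v)=\{w\in N(v): h(w)\ge 1\}$, where $N(v)$ is the open neighbourhood of $v$, and $AN[v]=AN(v)\cup\{v\}$; for $S\subseteq V$ write $h(S)=\sum_{u\in S}h(u)$. The function $h$ is a triple Roman dominating function (3RDF) of $\Gamma$ if every vertex $v$ with $h(v)<3$ satisfies $h(AN[v])\ge |AN(v)|+3$. Its weight is $h(V)$. -}

module Defs where

open import Data.Bool.Base using (Bool; true; false; T; _∧_)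
open import Data.Fin.Base using (Fin; toℕ)
open import Data.Fin.Subset using (Subset; ∣_∣; _∪_; ⁅_⁆)
open import Data.Fin.Subset.Properties using (_∈?_)
open import Data.List.Base
  using (List; []; _∷_; [_]; _++_; length; map; concatMap; filter; foldr; replicate; allFin)
open import Data.Maybe.Base as Maybe using (Maybe; just; nothing)
open import Data.Nat.Base
  using (ℕ; suc; _+_; _*_; _≤_; _<_; _≤ᵇ_; NonZero)
open import Data.Nat.DivMod using (_%_)
open import Data.Nat.ListAction using (sum)
open import Data.Product using (Σ; Σ-syntax; ∃-syntax; _×_; _,_; proj₁)
open import Data.Vec.Base as Vec using (Vec; _∷_; tabulate)
open import Function.Base using (_∘_)
open import Function.Bundles using (_⇔_)
open import Function.Definitions using (Injective)
open import Level using (0ℓ)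
open import Relation.Binary.PropositionalEquality using (_≡_)
open import Relation.Nullary.Negation using (¬_)
open import Relation.Unary using (Pred)

Word : Set
Word = List Bool

data Symbol (m : ℕ) : Set where
  blank : Symbol m
  bit   : Bool → Symbol m
  work  : Fin m → Symbol m

data Move : Set where
  left stay right : Move

-- A two-way infinite tape, blank outside the two listed parts. Both
-- lists are ordered by distance from the head.
record Tape (m : ℕ) : Set where
  constructor tape
  field
    before : List (Symbol m)
    head   : Symbol m
    after  : List (Symbol m)

module _ {m : ℕ} where

  fromList : List (Symbol m) → Tape m
  fromList []       = tape [] blank []
  fromList (s ∷ ss) = tape [] s ss

  move : Move → Tape m → Tape m
  move stay  t                   = t
  move left  (tape []       s r) = tape [] blank (s ∷ r)
  move left  (tape (b ∷ bs) s r) = tape bs b (s ∷ r)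
  move right (tape l s [])       = tape (s ∷ l) blank []
  move right (tape l s (a ∷ as)) = tape (s ∷ l) a as

  act : Symbol m × Move → Tape m → Tape m
  act (s , d) (tape l _ r) = move d (tape l s r)

  bits : List (Symbol m) → Word
  bits (bit b ∷ ss) = b ∷ bits ss
  bits _            = []

  readOff : Tape m → Word
  readOff (tape _ s r) = bits (s ∷ r)

-- The first tape carries the input and, on halting, the output. The
-- machine halts when δ returns nothing; the output is then the maximal
-- run of bits from the head rightwards.
record TM : Set where
  field
    states workTapes workSymbols : ℕ

  tapes : ℕ
  tapes = suc workTapes

  State : Set
  State = Fin states

  Sym : Set
  Sym = Symbol workSymbols

  field
    start : State
    δ     : State → Vec Sym tapes → Maybe (State × Vec (Sym × Move) tapes)

  Config : Set
  Config = State × Vec (Tape workSymbols) tapes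

  initial : Word → Config
  initial w =
    start , fromList (map bit w) ∷ Vec.replicate workTapes (fromList [])

  step : Config → Maybe Config
  step (q , ts) =
    Maybe.map (λ (q′ , as) → q′ , Vec.zipWith act as ts)
              (δ q (Vec.map Tape.head ts))

  output : Config → Word
  output (_ , ts) = readOff (Vec.head ts)

  data HaltsIn : ℕ → Config → Config → Set where
    halt : ∀ {c} → step c ≡ nothing → HaltsIn 0 c c
    next : ∀ {t c c′ d} → step c ≡ just c′ → HaltsIn t c′ d → HaltsIn (suc t) c d

-- Coefficients in ascending order of degree.
Polynomial : Set
Polynomial = List ℕ

eval : Polynomial → ℕ → ℕ
eval p x = foldr (λ a r → a + x * r) 0 p

PolyTime : (Word → Word) → Set
PolyTime f =
  Σ[ M ∈ TM ] Σ[ p ∈ Polynomial ] let open TM M in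
    ∀ w → ∃[ t ] ∃[ c ]
      t ≤ eval p (length w) × HaltsIn t (initial w) c × output c ≡ f w

Language : Set₁
Language = Pred Word 0ℓ

InP : Language → Set
InP L = Σ[ f ∈ (Word → Bool) ]
  PolyTime (λ w → [ f w ]) × (∀ w → L w ⇔ f w ≡ true)

unary : ℕ → Word
unary n = replicate n true ++ [ false ]

pair : Word → Word → Word
pair x y = unary (length x) ++ x ++ y

InNP : Language → Set₁
InNP L = Σ[ R ∈ Language ] Σ[ p ∈ Polynomial ]
  InP R × (∀ x → L x ⇔ (∃[ y ] length y ≤ eval p (length x) × R (pair x y)))

_≤ₚ_ : Language → Language → Set
L ≤ₚ L′ = Σ[ f ∈ (Word → Word) ] PolyTime f × (∀ x → L x ⇔ L′ (f x))

record DecisionProblem : Set₁ where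
  field
    Instance : Set
    encode   : Instance → Word
    Yes      : Instance → Set

  language : Language
  language w = Σ[ i ∈ Instance ] encode i ≡ w × Yes i

_restrictedTo_ : (Π : DecisionProblem) → (DecisionProblem.Instance Π → Set) →
                 DecisionProblem
Π restrictedTo P = record
  { Instance = Σ Instance P
  ; encode   = encode ∘ proj₁
  ; Yes      = Yes ∘ proj₁
  } where open DecisionProblem Π

NPComplete : DecisionProblem → Set₁
NPComplete Π = InNP language × (∀ (L : Language) → InNP L → L ≤ₚ language)
  where open DecisionProblem Π

record Graph : Set where
  field
    order      : ℕ
    adj        : Fin order → Fin order → Bool
    adj-sym    : ∀ u v → adj u v ≡ adj v u
    adj-irrefl : ∀ v → adj v v ≡ false

  Vertex : Set
  Vertex = Fin order

  _~_ : Vertex → Vertex → Set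
  u ~ v = T (adj u v)

  matrix : Word
  matrix = concatMap (λ u → map (adj u) (allFin order)) (allFin order)

module _ (Γ : Graph) where
  open Graph Γ

  CyclicSuc : ∀ {ℓ} .{{_ : NonZero ℓ}} → Fin ℓ → Fin ℓ → Set
  CyclicSuc {ℓ} i j = toℕ j ≡ suc (toℕ i) % ℓ

  IsCycle : ∀ {ℓ} .{{_ : NonZero ℓ}} → (Fin ℓ → Vertex) → Set
  IsCycle c = Injective _≡_ _≡_ c × (∀ i j → CyclicSuc i j → c i ~ c j)

  HasChord : ∀ {ℓ} .{{_ : NonZero ℓ}} → (Fin ℓ → Vertex) → Set
  HasChord c = ∃[ i ] ∃[ j ] ¬ CyclicSuc i j × ¬ CyclicSuc j i × c i ~ c j

  Chordal : Set
  Chordal = ∀ ℓ .{{_ : NonZero ℓ}} → 4 ≤ ℓ →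
            ∀ (c : Fin ℓ → Vertex) → IsCycle c → HasChord c

  module _ (h : Vertex → Fin 5) where

    AN : Vertex → Subset order
    AN v = tabulate (λ w → adj v w ∧ (1 ≤ᵇ toℕ (h w)))

    AN[_] : Vertex → Subset order
    AN[ v ] = AN v ∪ ⁅ v ⁆

    total : Subset order → ℕ
    total S = sum (map (toℕ ∘ h) (filter (_∈? S) (allFin order)))

    Is3RDF : Set
    Is3RDF = ∀ v → toℕ (h v) < 3 → ∣ AN v ∣ + 3 ≤ total AN[ v ]

    weight : ℕ
    weight = sum (map (toℕ ∘ h) (allFin order))

record RomanInstance : Set where
  field
    graph   : Graph
    k       : ℕ
    k-pos   : 1 ≤ k
    k-bound : k ≤ Graph.order graph

-- Since k is at most the number of vertices, writing it in unary does
-- not change the size of an instance by more than a polynomial.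
TRIPLE-ROM-DOM : DecisionProblem
TRIPLE-ROM-DOM = record
  { Instance = RomanInstance
  ; encode   = λ i → let open RomanInstance i in
                 unary (Graph.order graph) ++ unary k ++ Graph.matrix graph
  ; Yes      = λ i → let open RomanInstance i in
                 ∃[ h ] Is3RDF graph h × weight graph h ≤ k
  }

{-# OPTIONS --safe #-}

-- Hardness. The run of a polynomial-time verifier is a table whose cells are indexed
-- relative to the head, so that moving a head shifts a row and every cell is
-- determined by three cells above it and the one under the heads. Hence the run is
-- described by clauses over literals "cell i has content o". Take a clique of all
-- literals and an independent set of all clauses, joined by membership, and join the
-- literals of each cell to five further vertices. The graph is split, hence chordal.
-- A vertex v with h(v) < 3 is dominated iff 3 ≤ h(v) + Σ (h(w) ∸ 1) over its
-- neighbours w; so with weight 4 per cell the five vertices force one literal of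
-- every cell to have label 4 and all else to have label 0, and a clause is dominated
-- iff it contains a chosen literal.
--
-- Membership. A graph is chordal iff for every edge vu there is a set S ∋ u that is
-- closed under steps avoiding N[v] and meets a neighbour w ≠ u of v only if w ~ u:
-- a violation closes to a chordless cycle through v. These sets and the labels form
-- the certificate.
--
-- Both algorithms are first-order formulas and bounded loops over polynomially
-- bounded counters. On a multi-tape machine a counter is a tape whose head position
-- is its value.
module Submission where

open import Defs

open import Data.Bool.Base using (Bool; true; false; T; not; _∧_; _∨_; if_then_else_)
open import Data.Bool.Properties as Bool using (T?; T-≡; ∨-zeroʳ)
open import Data.Empty using (⊥; ⊥-elim)
open import Data.Fin.Base using (Fin; zero; suc; toℕ; fromℕ; fromℕ<; _↑ˡ_; _↑ʳ_; splitAt; join; combine; remQuot; funToFin; finToFun)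
open import Data.Fin.Patterns
import Data.Fin.Properties as Fin
open import Data.Fin.Subset using (Subset; ∣_∣; ⁅_⁆)
open import Data.Fin.Subset.Properties using (_∈?_)
open import Data.List.Base using (List; []; _∷_; [_]; _++_; length; map; concatMap; filter; foldr; replicate; allFin; tabulate)
open import Data.List.Properties using (++-assoc; ++-identityʳ; length-++; length-map; length-replicate; length-tabulate; map-tabulate; ∷-injective)
open import Data.Maybe.Base as Maybe using (Maybe; just; nothing; fromMaybe; maybe′)
open import Data.Nat.Base
open import Data.Nat.DivMod using (_/_; _%_; _mod_; m<n⇒m%n≡m; m%n<n; n%n≡0; m≡m%n+[m/n]*n; [m+kn]%n≡m%n; m<n*o⇒m/o<n)
open import Data.Nat.Induction using (<-wellFounded)
open import Data.Nat.ListAction using (sum)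
open import Data.Nat.Properties
open import Algebra.Properties.CommutativeSemigroup +-commutativeSemigroup using (interchange)
open import Data.Nat.Tactic.RingSolver using (solve-∀)
open import Data.Product using (_×_; _,_; proj₁; proj₂; ∃-syntax; map₁)
open import Data.Sum.Base as Sum using (_⊎_; inj₁; inj₂)
open import Data.Unit.Base using (⊤; tt)
open import Data.Vec.Base as Vec using (Vec; []; _∷_; lookup; _[_]≔_)
import Data.Vec.Properties as Vec
open import Function.Base using (_∘_; _$_; _|>_; case_of_; id)
open import Function.Bundles using (_⇔_; mk⇔; Equivalence)
open import Induction.WellFounded using (Acc; acc)
open import Relation.Binary.Definitions using (tri<; tri≈; tri>)
open import Relation.Binary.PropositionalEquality hiding ([_]; J)
open import Relation.Nullary using (¬_; Dec; yes; no; does; _×-dec_; ¬?)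
open import Relation.Nullary.Decidable using (True; toWitness; dec-true; dec-false)
open import Relation.Unary using (Decidable)

-- Structured programs for Turing machines

-- A neighbour can help to dominate a vertex but never harm it, so domination expresses positive
-- clauses only. This suffices because one content is chosen per cell: "not o" is the disjunction of
-- all other contents, and their number depends on the machine alone. Label 4 is forced because a
-- single neighbour `w` must supply 3 = h(w) ∸ 1.
--
-- The machine model is concrete, so polynomial time has to be shown for actual transition
-- functions. Both algorithms are therefore written in a language whose programs always terminate
-- and whose running time is bounded by an expression read off the program; one correctness proof of
-- a compiler serves both.
--
-- The restricted language contains chordal instances only, so the verifier must check chordality
-- too. The usual certificate, a perfect elimination ordering, rests on the existence of simplicial
-- vertices and an induction over subgraphs. The separator condition is matched directly with the
-- definition by cycles, and it is local enough to be a first-order formula.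

module Machine (k m : ℕ) where

  Tapes Heads Action : Set
  Tapes  = Vec (Tape m) (suc k)
  Heads  = Vec (Symbol m) (suc k)
  Action = Vec (Symbol m × Move) (suc k)

  heads : Tapes → Heads
  heads = Vec.map Tape.head

  apply : Action → Tapes → Tapes
  apply = Vec.zipWith act

  data Cmd : Set where
    prim  : (Heads → Action) → Cmd
    _⨾_   : Cmd → Cmd → Cmd
    while : (Heads → Bool) → Cmd → Cmd

  infixr 4 _⨾_

  -- Step counts are exact: a primitive and each evaluation of a loop test cost one machine step,
  -- sequencing costs none.
  data Exec : Cmd → Tapes → ℕ → Tapes → Set where
    prim : ∀ {f ts} → Exec (prim f) ts 1 (apply (f (heads ts)) ts)
    seq  : ∀ {c d ts us vs a b} →
           Exec c ts a us → Exec d us b vs → Exec (c ⨾ d) ts (a + b) vs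
    done : ∀ {p c ts} → p (heads ts) ≡ false → Exec (while p c) ts 1 ts
    loop : ∀ {p c ts us vs a b} → p (heads ts) ≡ true →
           Exec c ts a us → Exec (while p c) us b vs →
           Exec (while p c) ts (suc (a + b)) vs

  -- Program points, which become the states of the machine. In a loop, `nothing` is the test
  -- itself.
  Loc : Cmd → Set
  Loc (prim _)    = ⊤
  Loc (c ⨾ d)     = Loc c ⊎ Loc d
  Loc (while _ c) = Maybe (Loc c)

  entry : ∀ c → Loc c
  entry (prim _)    = tt
  entry (c ⨾ d)     = inj₁ (entry c)
  entry (while _ c) = nothing

  idle : Heads → Action
  idle = Vec.map (_, stay)

  -- The target nothing leaves the command.
  trans-of : ∀ c → Loc c → Heads → Maybe (Loc c) × Action
  trans-of (prim f)    _        s = nothing , f s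
  trans-of (c ⨾ d)     (inj₁ l) s =
    map₁ (just ∘ maybe′ inj₁ (inj₂ (entry d))) (trans-of c l s)
  trans-of (c ⨾ d)     (inj₂ l) s = map₁ (Maybe.map inj₂) (trans-of d l s)
  trans-of (while p c) nothing  s =
    (if p s then just (just (entry c)) else nothing) , idle s
  trans-of (while p c) (just l) s = map₁ just (trans-of c l s)

  data Run (c : Cmd) : Maybe (Loc c) → Tapes → ℕ → Maybe (Loc c) → Tapes → Set where
    []  : ∀ {l ts} → Run c l ts 0 l ts
    _∷_ : ∀ {l l′ as ts a l″ us} → trans-of c l (heads ts) ≡ (l′ , as) →
          Run c l′ (apply as ts) a l″ us → Run c (just l) ts (suc a) l″ us

  _++ʳ_ : ∀ {c l l′ l″ ts us vs a b} →
          Run c l ts a l′ us → Run c l′ us b l″ vs → Run c l ts (a + b) l″ vs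
  []      ++ʳ s = s
  (e ∷ r) ++ʳ s = e ∷ (r ++ʳ s)

  -- The exit of `c` is identified with the entry of `d`, so control passes between them without a
  -- step of its own.
  run-fst : ∀ {c d l ts a l′ us} → Run c l ts a l′ us →
            Run (c ⨾ d) (just (maybe′ inj₁ (inj₂ (entry d)) l)) ts a
                        (just (maybe′ inj₁ (inj₂ (entry d)) l′)) us
  run-fst []      = []
  run-fst (e ∷ r) = cong (map₁ _) e ∷ run-fst r

  run-snd : ∀ {c d l ts a l′ us} → Run d l ts a l′ us →
            Run (c ⨾ d) (Maybe.map inj₂ l) ts a (Maybe.map inj₂ l′) us
  run-snd []      = []
  run-snd (e ∷ r) = cong (map₁ _) e ∷ run-snd r

  run-body : ∀ {p c l ts a l′ us} → Run c l ts a l′ us →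
             Run (while p c) (just l) ts a (just l′) us
  run-body []      = []
  run-body (e ∷ r) = cong (map₁ just) e ∷ run-body r

  -- A loop test is a machine step as well and has to act on every tape; rewriting each head symbol
  -- in place makes this harmless.
  apply-idle : ∀ {n} (ts : Vec (Tape m) n) →
               Vec.zipWith act (Vec.map (_, stay) (Vec.map Tape.head ts)) ts ≡ ts
  apply-idle []       = refl
  apply-idle (t ∷ ts) = cong (t ∷_) (apply-idle ts)

  exec⇒run : ∀ {c ts a us} → Exec c ts a us → Run c (just (entry c)) ts a nothing us
  exec⇒run prim      = refl ∷ []
  exec⇒run (seq e f) = run-fst (exec⇒run e) ++ʳ run-snd (exec⇒run f)
  exec⇒run {while p c} {ts} (done q) =
    cong (λ b → (if b then just (just (entry c)) else nothing) , idle (heads ts)) q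
    ∷ subst (λ us → Run _ nothing us 0 nothing ts) (sym (apply-idle ts)) []
  exec⇒run {while p c} {ts} (loop q e f) =
    cong (λ b → (if b then just (just (entry c)) else nothing) , idle (heads ts)) q
    ∷ (subst (λ us → Run _ (just (just (entry c))) us _ (just nothing) _)
             (sym (apply-idle ts)) (run-body (exec⇒run e)) ++ʳ exec⇒run f)

  size : Cmd → ℕ
  size (prim _)    = 1
  size (c ⨾ d)     = size c + size d
  size (while _ c) = suc (size c)

  toFin : ∀ c → Loc c → Fin (size c)
  toFin (prim _)    _        = zero
  toFin (c ⨾ d)     l        = join _ _ (Sum.map (toFin c) (toFin d) l)
  toFin (while _ c) nothing  = zero
  toFin (while _ c) (just l) = suc (toFin c l)

  fromFin : ∀ c → Fin (size c) → Loc c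
  fromFin (prim _)    _       = tt
  fromFin (c ⨾ d)     q       = Sum.map (fromFin c) (fromFin d) (splitAt (size c) q)
  fromFin (while _ c) zero    = nothing
  fromFin (while _ c) (suc q) = just (fromFin c q)

  from∘to : ∀ c l → fromFin c (toFin c l) ≡ l
  from∘to (prim _)    _        = refl
  from∘to (c ⨾ d)     (inj₁ l)
    rewrite Fin.splitAt-↑ˡ (size c) (toFin c l) (size d) = cong inj₁ (from∘to c l)
  from∘to (c ⨾ d)     (inj₂ l)
    rewrite Fin.splitAt-↑ʳ (size c) (size d) (toFin d l) = cong inj₂ (from∘to d l)
  from∘to (while _ c) nothing  = refl
  from∘to (while _ c) (just l) = cong just (from∘to c l)

  -- State zero is the halting state.
  machine : Cmd → TM
  machine c = record
    { states      = suc (size c)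
    ; workTapes   = k
    ; workSymbols = m
    ; start       = suc (toFin c (entry c))
    ; δ           = λ { zero    _ → nothing
                      ; (suc q) s → just (map₁ (maybe′ (suc ∘ toFin c) zero)
                                               (trans-of c (fromFin c q) s)) }
    }

  run⇒halts : ∀ {c l ts a us} → Run c l ts a nothing us →
              TM.HaltsIn (machine c) a (maybe′ (suc ∘ toFin c) zero l , ts) (zero , us)
  run⇒halts []      = TM.halt refl
  run⇒halts {c} {just l} {ts} (e ∷ r) = TM.next
    (trans (cong (λ l → just (next (trans-of c l (heads ts)))) (from∘to c l))
           (cong (just ∘ next) e))
    (run⇒halts r)
    where
    next : Maybe (Loc c) × Action → Fin (suc (size c)) × Tapes
    next (l , as) = maybe′ (suc ∘ toFin c) zero l , apply as ts

  exec⇒halts : ∀ {c ts a us} → Exec c ts a us →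
               TM.HaltsIn (machine c) a (TM.start (machine c) , ts) (zero , us)
  exec⇒halts e = run⇒halts (exec⇒run e)

-- Tapes used as counters, as input and as output

nth : Word → ℕ → Bool
nth []      _       = false
nth (b ∷ _) zero    = b
nth (_ ∷ w) (suc i) = nth w i

b2n : Bool → ℕ
b2n true  = 1
b2n false = 0

isPos : ℕ → Bool
isPos zero    = false
isPos (suc _) = true

mark : Symbol 1
mark = work zero

isMark isOne isBlank : Symbol 1 → Bool
isMark (work _) = true
isMark _        = false
isOne (bit b) = b
isOne _       = false
isBlank blank = true
isBlank _     = false

blanks : ℕ → List (Symbol 1)
blanks n = replicate n blank

-- A counter holds the distance of the head from a mark at the origin; the
-- second argument counts the blanks that the head has left behind on the right.
ctape : ℕ → ℕ → Tape 1
ctape zero    r = tape [] mark (blanks r)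
ctape (suc n) r = tape (blanks n ++ [ mark ]) blank (blanks r)

-- `l` collects the cells left of the head, nearest first, so that the recursion can follow the
-- word. Positions beyond the word are allowed and show blanks; `r` counts the blanks left behind
-- further right.
itape : List (Symbol 1) → Word → ℕ → ℕ → Tape 1
itape l []      zero    r = tape l blank (blanks r)
itape l (b ∷ w) zero    r = tape l (bit b) (map bit w ++ blanks r)
itape l []      (suc p) r = itape (blank ∷ l) [] p r
itape l (b ∷ w) (suc p) r = itape (bit b ∷ l) w p r

Counter : ℕ → Tape 1 → Set
Counter n t = ∃[ r ] t ≡ ctape n r

Input : Word → ℕ → Tape 1 → Set
Input w p t = ∃[ r ] t ≡ itape [] w p r

-- The head waits on the blank in front of the output, where the next bit is to be written; `e`
-- counts the blanks to its left, which remain from the erased input.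
Output : Word → Tape 1 → Set
Output o t = ∃[ e ] ∃[ r ] t ≡ tape (blanks e) blank (map bit o ++ blanks r)

counter-inc : ∀ {n t} → Counter n t → Counter (suc n) (act (Tape.head t , right) t)
counter-inc {zero}  (zero  , refl) = 0 , refl
counter-inc {zero}  (suc r , refl) = r , refl
counter-inc {suc n} (zero  , refl) = 0 , refl
counter-inc {suc n} (suc r , refl) = r , refl

-- The mark stops the head at the origin, which makes the decrement truncated.
decAct : Symbol 1 → Symbol 1 × Move
decAct s = s , (if isMark s then stay else left)

counter-dec : ∀ {n t} → Counter n t → Counter (pred n) (act (decAct (Tape.head t)) t)
counter-dec {zero}        (r , refl) = r , refl
counter-dec {suc zero}    (r , refl) = suc r , refl
counter-dec {suc (suc n)} (r , refl) = suc r , refl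

addAct : Bool → Symbol 1 → Symbol 1 × Move
addAct b s = s , (if b then right else stay)

counter-add : ∀ {n t} b → Counter n t → Counter (b2n b + n) (act (addAct b (Tape.head t)) t)
counter-add true  c = counter-inc c
counter-add false c = c

counter-zero? : ∀ {n t} → Counter n t → not (isMark (Tape.head t)) ≡ isPos n
counter-zero? {zero}  (r , refl) = refl
counter-zero? {suc n} (r , refl) = refl

input-right : ∀ {w p t} → Input w p t → Input w (suc p) (act (Tape.head t , right) t)
input-right {w} {p} (r , refl) = go [] w p r
  where
  go : ∀ l w p r → ∃[ r′ ] act (Tape.head (itape l w p r) , right) (itape l w p r) ≡ itape l w (suc p) r′
  go l []           zero    zero    = 0 , refl
  go l []           zero    (suc r) = r , refl
  go l (b ∷ [])     zero    zero    = 0 , refl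
  go l (b ∷ [])     zero    (suc r) = r , refl
  go l (b ∷ c ∷ w)  zero    r       = r , refl
  go l []           (suc p) r       = go (blank ∷ l) [] p r
  go l (b ∷ w)      (suc p) r       = go (bit b ∷ l) w p r

input-left : ∀ {w p t} → Input w (suc p) t → Input w p (act (Tape.head t , left) t)
input-left {w} {p} (r , refl) = go [] w p r
  where
  go : ∀ l w p r → ∃[ r′ ] act (Tape.head (itape l w (suc p) r) , left) (itape l w (suc p) r) ≡ itape l w p r′
  go l []           zero    r = suc r , refl
  go l (b ∷ [])     zero    r = suc r , refl
  go l (b ∷ c ∷ w)  zero    r = r , refl
  go l []           (suc p) r = go (blank ∷ l) [] p r
  go l (b ∷ w)      (suc p) r = go (bit b ∷ l) w p r

input-head : ∀ {w p t} → Input w p t → isOne (Tape.head t) ≡ nth w p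
input-head {w} {p} (r , refl) = go [] w p r
  where
  go : ∀ l w p r → isOne (Tape.head (itape l w p r)) ≡ nth w p
  go l []      zero    r = refl
  go l (b ∷ w) zero    r = refl
  go l []      (suc p) r = go (blank ∷ l) [] p r
  go l (b ∷ w) (suc p) r = go (bit b ∷ l) w p r

output-emit : ∀ {o t} b → Output o t → Output (b ∷ o) (act (bit b , left) t)
output-emit b (zero  , r , refl) = 0 , r , refl
output-emit b (suc e , r , refl) = e , r , refl

readOff-bits : ∀ o r → bits (map bit o ++ blanks r) ≡ o
readOff-bits []      zero    = refl
readOff-bits []      (suc r) = refl
readOff-bits (b ∷ o) r       = cong (b ∷_) (readOff-bits o r)

output-read : ∀ {o t} → Output o t → readOff (act (Tape.head t , right) t) ≡ o
output-read {[]}    (e , zero  , refl) = refl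
output-read {[]}    (e , suc r , refl) = refl
output-read {b ∷ o} (e , r     , refl) = cong (b ∷_) (readOff-bits o r)

-- Temporaries form a stack; the level of an entry is the number of entries below it.
level : List ℕ → ℕ → ℕ
level []       l = 0
level (x ∷ st) l = if does (l ≟ length st) then x else level st l

level-high : ∀ st {l} → length st ≤ l → level st l ≡ 0
level-high []       _ = refl
level-high (x ∷ st) {l} h rewrite dec-false (l ≟ length st) (>⇒≢ h) =
  level-high st (≤-trans (n≤1+n _) h)

level-at : ∀ pre x st → level (pre ++ x ∷ st) (length st) ≡ x
level-at []        x st rewrite dec-true (length st ≟ length st) refl = refl
level-at (y ∷ pre) x st
  rewrite length-++ pre {x ∷ st}
        | dec-false (length st ≟ length pre + suc (length st)) (<⇒≢ (m≤n+m _ (length pre))) =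
  level-at pre x st

level-other : ∀ pre x y st {l} → l ≢ length st → level (pre ++ x ∷ st) l ≡ level (pre ++ y ∷ st) l
level-other []        x y st {l} h rewrite dec-false (l ≟ length st) h = refl
level-other (z ∷ pre) x y st {l} h
  rewrite length-++ pre {x ∷ st} | length-++ pre {y ∷ st} | level-other pre x y st h = refl

-- Levels above the top of the stack read 0, so a zero is pushed or popped without any command.
level-0 : ∀ st l → level (0 ∷ st) l ≡ level st l
level-0 st l with l ≟ length st
... | yes e rewrite dec-true (l ≟ length st) e = sym (level-high st (≤-reflexive (sym e)))
... | no  n rewrite dec-false (l ≟ length st) n = refl

-- Timed specifications of commands on a store of counters

module Store (V N′ : ℕ) where

  N : ℕ
  N = suc N′

  open Machine (suc (V + N)) 1 public

  -- The input and output tapes are described by predicates because their role changes: exact tapes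
  -- while the input is being copied, `Input` and `Output` afterwards.
  record State : Set₁ where
    constructor ⟨_,_,_,_⟩
    field
      env   : Vec ℕ V
      stack : List ℕ
      inp   : Tape 1 → Set
      out   : Tape 1 → Set
  open State public

  data Reg : Set where
    var : Fin V → Reg
    tmp : ℕ → Reg

  Valid : Reg → Set
  Valid (var _) = ⊤
  Valid (tmp l) = l < N

  value : Vec ℕ V → List ℕ → Reg → ℕ
  value ρ st (var x) = lookup ρ x
  value ρ st (tmp l) = level st l

  val : State → Reg → ℕ
  val s = value (env s) (stack s)

  -- The two leading tapes are output and input. The remainder makes `idx` total; on levels below
  -- `N`, as `Valid` demands, it is the identity.
  idx : Reg → Fin (suc (suc (V + N)))
  idx (var x) = suc (suc (x ↑ˡ N))
  idx (tmp l) = suc (suc (V ↑ʳ (l mod N)))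

  idx-injective : ∀ {q r} → Valid q → Valid r → idx q ≡ idx r → q ≡ r
  idx-injective {var x} {var y} _ _ e =
    cong var (Fin.↑ˡ-injective N x y (Fin.suc-injective (Fin.suc-injective e)))
  idx-injective {tmp x} {tmp y} p q e = cong tmp (begin
    x               ≡⟨ m<n⇒m%n≡m p ⟨
    x % N           ≡⟨ Fin.toℕ-fromℕ< _ ⟨
    toℕ (x mod N)   ≡⟨ cong toℕ (Fin.↑ʳ-injective V _ _ (Fin.suc-injective (Fin.suc-injective e))) ⟩
    toℕ (y mod N)   ≡⟨ Fin.toℕ-fromℕ< _ ⟩
    y % N           ≡⟨ m<n⇒m%n≡m q ⟩
    y               ∎)
    where open ≡-Reasoning
          open import Data.Nat.DivMod using (_%_)
  idx-injective {var x} {tmp y} _ _ e =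
    case trans (sym (Fin.splitAt-↑ˡ V x N))
               (trans (cong (splitAt V) (Fin.suc-injective (Fin.suc-injective e))) (Fin.splitAt-↑ʳ V N (y mod N)))
    of λ ()
  idx-injective {tmp x} {var y} _ _ e =
    case trans (sym (Fin.splitAt-↑ʳ V N (x mod N)))
               (trans (cong (splitAt V) (Fin.suc-injective (Fin.suc-injective e))) (Fin.splitAt-↑ˡ V y N))
    of λ ()

  onTape : Fin (suc (suc (V + N))) → (Heads → Symbol 1 × Move) → Cmd
  onTape i g = prim (λ hs → idle hs [ i ]≔ g hs)

  inc dec : Reg → Cmd
  inc r = onTape (idx r) (λ hs → lookup hs (idx r) , right)
  dec r = onTape (idx r) (λ hs → decAct (lookup hs (idx r)))

  read : ℕ → Cmd
  read l = onTape (idx (tmp l)) λ hs → addAct (isOne (lookup hs (suc zero))) (lookup hs (idx (tmp l)))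

  moveInput : Move → Cmd
  moveInput d = onTape (suc zero) (λ hs → lookup hs (suc zero) , d)

  emit : ℕ → Cmd
  emit l = onTape zero (λ hs → bit (not (isMark (lookup hs (idx (tmp l))))) , left)

  skip : Cmd
  skip = prim idle

  -- The decrement precedes the body, so from an initial value `m` the body sees `m ∸ 1`, ..., 0.
  -- The folds and sums below run in the same order.
  loopOn : Reg → Cmd → Cmd
  loopOn r c = while (λ hs → not (isMark (lookup hs (idx r)))) (dec r ⨾ c)

  record St (s : State) (ts : Tapes) : Set where
    field
      output-ok : out s (lookup ts zero)
      input-ok  : inp s (lookup ts (suc zero))
      reg-ok    : ∀ r → Valid r → Counter (val s r) (lookup ts (idx r))
  open St public

  onTape-at : ∀ i a ts → lookup (apply (idle (heads ts) [ i ]≔ a) ts) i ≡ act a (lookup ts i)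
  onTape-at i a ts = trans (Vec.lookup-zipWith act i (idle (heads ts) [ i ]≔ a) ts)
    (cong (λ a → act a (lookup ts i)) (Vec.lookup∘update i (idle (heads ts)) a))

  onTape-other : ∀ i j a ts → j ≢ i → lookup (apply (idle (heads ts) [ i ]≔ a) ts) j ≡ lookup ts j
  onTape-other i j a ts h = trans (Vec.lookup-zipWith act j (idle (heads ts) [ i ]≔ a) ts)
    (trans (cong (λ a → act a (lookup ts j)) (Vec.lookup∘update′ h (idle (heads ts)) a))
    (trans (cong (λ a → act a (lookup ts j)) (Vec.lookup-map j _ (heads ts)))
           (cong (λ s → act (s , stay) (lookup ts j)) (Vec.lookup-map j Tape.head ts))))

  heads-at : ∀ i ts → lookup (heads ts) i ≡ Tape.head (lookup ts i)
  heads-at i ts = Vec.lookup-map i Tape.head ts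

  -- A Hoare triple for total correctness, with `n` bounding the running time.
  Spec : Cmd → State → State → ℕ → Set
  Spec c s s′ n = ∀ {ts} → St s ts → ∃[ us ] ∃[ a ] a ≤ n × Exec c ts a us × St s′ us

  weaken : ∀ {c s s′ m n} → m ≤ n → Spec c s s′ m → Spec c s s′ n
  weaken h f σ = let us , a , le , e , τ = f σ in us , a , ≤-trans le h , e , τ

  _⟫_ : ∀ {c d s t u m n} → Spec c s t m → Spec d t u n → Spec (c ⨾ d) s u (m + n)
  (f ⟫ g) σ =
    let _ , _ , le  , e  , τ = f σ
        _ , _ , le′ , e′ , υ = g τ
    in _ , _ , +-mono-≤ le le′ , seq e e′ , υ

  infixr 4 _⟫_

  resource : ∀ {c s t u n} → s ≡ t → Spec c s u n → Spec c t u n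
  resource refl f = f

  retarget : ∀ {c s t u n} → t ≡ u → Spec c s t n → Spec c s u n
  retarget refl f = f

  push-st : ∀ {ρ st p o ts} → St ⟨ ρ , st , p , o ⟩ ts → St ⟨ ρ , 0 ∷ st , p , o ⟩ ts
  push-st {st = st} σ = record
    { output-ok = output-ok σ ; input-ok = input-ok σ
    ; reg-ok = λ { (var x) v → reg-ok σ (var x) v
                 ; (tmp l) v → subst (λ n → Counter n _) (sym (level-0 st l)) (reg-ok σ (tmp l) v) } }

  pop-st : ∀ {ρ st p o ts} → St ⟨ ρ , 0 ∷ st , p , o ⟩ ts → St ⟨ ρ , st , p , o ⟩ ts
  pop-st {st = st} σ = record
    { output-ok = output-ok σ ; input-ok = input-ok σ
    ; reg-ok = λ { (var x) v → reg-ok σ (var x) v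
                 ; (tmp l) v → subst (λ n → Counter n _) (level-0 st l) (reg-ok σ (tmp l) v) } }

  push : ∀ {c ρ st p o s n} → Spec c ⟨ ρ , 0 ∷ st , p , o ⟩ s n → Spec c ⟨ ρ , st , p , o ⟩ s n
  push f σ = f (push-st σ)

  pop : ∀ {c ρ st p o s n} → Spec c s ⟨ ρ , 0 ∷ st , p , o ⟩ n → Spec c s ⟨ ρ , st , p , o ⟩ n
  pop f σ = let us , a , le , e , τ = f σ in us , a , le , e , pop-st τ

  zero≢idx : ∀ r → zero ≢ idx r
  zero≢idx (var _) ()
  zero≢idx (tmp _) ()

  one≢idx : ∀ r → suc zero ≢ idx r
  one≢idx (var _) ()
  one≢idx (tmp _) ()

  regs-kept : ∀ {s ts} i a → (∀ r → i ≢ idx r) → St s ts → ∀ r → Valid r →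
              Counter (val s r) (lookup (apply (idle (heads ts) [ i ]≔ a) ts) (idx r))
  regs-kept {ts = ts} i a h σ r v =
    subst (Counter _) (sym (onTape-other i (idx r) a ts (h r ∘ sym))) (reg-ok σ r v)

  -- The frame rule for one register: as `idx` is injective on valid registers and avoids the two
  -- leading tapes, every other tape is untouched.
  modify : ∀ r (g : Heads → Symbol 1 × Move) {s s′} → Valid r →
           (∀ {ts} → St s ts → Counter (val s r) (lookup ts (idx r)) →
              Counter (val s′ r) (act (g (heads ts)) (lookup ts (idx r)))) →
           (∀ q → q ≢ r → val s q ≡ val s′ q) → inp s ≡ inp s′ → out s ≡ out s′ →
           Spec (onTape (idx r) g) s s′ 1
  modify r g {s} {s′} v h k refl refl {ts} σ = _ , 1 , ≤-refl , prim , record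
    { output-ok = subst (out s) (sym (onTape-other (idx r) zero _ ts (zero≢idx r))) (output-ok σ)
    ; input-ok  = subst (inp s) (sym (onTape-other (idx r) (suc zero) _ ts (one≢idx r))) (input-ok σ)
    ; reg-ok    = reg }
    where
    reg : ∀ q → Valid q → Counter (val s′ q) (lookup (apply (idle (heads ts) [ idx r ]≔ g (heads ts)) ts) (idx q))
    reg q u with idx q Fin.≟ idx r
    ... | yes e with refl ← idx-injective u v e =
      subst (Counter _) (sym (onTape-at (idx r) _ ts)) (h σ (reg-ok σ r v))
    ... | no ne = subst₂ Counter (k q (ne ∘ cong idx)) (sym (onTape-other (idx r) (idx q) _ ts ne)) (reg-ok σ q u)

  inc-ok : ∀ {r s s′} → Valid r → val s′ r ≡ suc (val s r) → (∀ q → q ≢ r → val s q ≡ val s′ q) →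
           inp s ≡ inp s′ → out s ≡ out s′ → Spec (inc r) s s′ 1
  inc-ok {r} v e = modify r _ v
    λ {ts} _ c → subst₂ (λ n h → Counter n (act (h , right) (lookup ts (idx r)))) (sym e) (sym (heads-at (idx r) ts)) (counter-inc c)

  dec-ok : ∀ {r s s′} → Valid r → val s′ r ≡ pred (val s r) → (∀ q → q ≢ r → val s q ≡ val s′ q) →
           inp s ≡ inp s′ → out s ≡ out s′ → Spec (dec r) s s′ 1
  dec-ok {r} v e = modify r _ v
    λ {ts} _ c → subst₂ (λ n h → Counter n (act (decAct h) (lookup ts (idx r)))) (sym e) (sym (heads-at (idx r) ts)) (counter-dec c)

  module _ {ρ : Vec ℕ V} {p o : Tape 1 → Set} where

    stack-other : ∀ pre {x y st} q → q ≢ tmp (length st) →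
                  val ⟨ ρ , pre ++ x ∷ st , p , o ⟩ q ≡ val ⟨ ρ , pre ++ y ∷ st , p , o ⟩ q
    stack-other pre (var x) _ = refl
    stack-other pre {x} {y} {st} (tmp l) h = level-other pre x y st (h ∘ cong tmp)

    inc-tmp : ∀ pre {x st} → length st < N →
              Spec (inc (tmp (length st))) ⟨ ρ , pre ++ x ∷ st , p , o ⟩ ⟨ ρ , pre ++ suc x ∷ st , p , o ⟩ 1
    inc-tmp pre {x} {st} v = inc-ok v
      (trans (level-at pre (suc x) st) (cong suc (sym (level-at pre x st)))) (stack-other pre) refl refl

    dec-tmp : ∀ pre {x st} → length st < N →
              Spec (dec (tmp (length st))) ⟨ ρ , pre ++ x ∷ st , p , o ⟩ ⟨ ρ , pre ++ pred x ∷ st , p , o ⟩ 1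
    dec-tmp pre {x} {st} v = dec-ok v
      (trans (level-at pre (pred x) st) (cong pred (sym (level-at pre x st)))) (stack-other pre) refl refl

    env-other : ∀ {x n m st} q → q ≢ var x →
                val ⟨ ρ [ x ]≔ n , st , p , o ⟩ q ≡ val ⟨ ρ [ x ]≔ m , st , p , o ⟩ q
    env-other (tmp l) _ = refl
    env-other {x} (var y) h = trans (Vec.lookup∘update′ (h ∘ cong var) ρ _)
                                    (sym (Vec.lookup∘update′ (h ∘ cong var) ρ _))

    inc-var : ∀ {x n st} → Spec (inc (var x)) ⟨ ρ [ x ]≔ n , st , p , o ⟩ ⟨ ρ [ x ]≔ suc n , st , p , o ⟩ 1
    inc-var {x} {n} = inc-ok tt
      (trans (Vec.lookup∘update x ρ (suc n)) (cong suc (sym (Vec.lookup∘update x ρ n)))) env-other refl refl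

    dec-var : ∀ {x n st} → Spec (dec (var x)) ⟨ ρ [ x ]≔ suc n , st , p , o ⟩ ⟨ ρ [ x ]≔ n , st , p , o ⟩ 1
    dec-var {x} {n} = dec-ok tt
      (trans (Vec.lookup∘update x ρ n) (cong pred (sym (Vec.lookup∘update x ρ (suc n))))) env-other refl refl

  read-ok : ∀ pre {b ρ x st p o} → length st < N → (∀ {t} → p t → isOne (Tape.head t) ≡ b) →
            Spec (read (length st)) ⟨ ρ , pre ++ x ∷ st , p , o ⟩ ⟨ ρ , pre ++ (b2n b + x) ∷ st , p , o ⟩ 1
  read-ok pre {b} {ρ} {x} {st} {p} {o} v h = modify (tmp (length st)) _ v
    (λ {ts} σ c → subst₂ Counter
      (trans (cong (b2n b +_) (level-at pre x st)) (sym (level-at pre (b2n b + x) st)))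
      (cong (λ a → act a (lookup ts (idx (tmp (length st)))))
        (cong₂ addAct (trans (sym (h (input-ok σ))) (cong isOne (sym (heads-at (suc zero) ts))))
                      (sym (heads-at (idx (tmp (length st))) ts))))
      (counter-add b c))
    (stack-other {ρ} {p} {o} pre) refl refl

  input-step : ∀ {g ρ st p p′ o} →
               (∀ {ts} → o (lookup ts zero) → p (lookup ts (suc zero)) → p′ (act (g (heads ts)) (lookup ts (suc zero)))) →
               Spec (onTape (suc zero) g) ⟨ ρ , st , p , o ⟩ ⟨ ρ , st , p′ , o ⟩ 1
  input-step {p′ = p′} {o} h {ts} σ = _ , 1 , ≤-refl , prim , record
    { output-ok = subst o (sym (onTape-other (suc zero) zero _ ts λ ())) (output-ok σ)
    ; input-ok  = subst p′ (sym (onTape-at (suc zero) _ ts)) (h (output-ok σ) (input-ok σ))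
    ; reg-ok    = regs-kept (suc zero) _ one≢idx σ }

  move-ok : ∀ {d ρ st p p′ o} → (∀ {t} → p t → p′ (act (Tape.head t , d) t)) →
            Spec (moveInput d) ⟨ ρ , st , p , o ⟩ ⟨ ρ , st , p′ , o ⟩ 1
  move-ok {d} {p′ = p′} h = input-step
    (λ {ts} _ q → subst (λ s → p′ (act (s , d) (lookup ts (suc zero)))) (sym (heads-at (suc zero) ts)) (h q))

  output-step : ∀ {g ρ st p o o′} →
                (∀ {ts} → St ⟨ ρ , st , p , o ⟩ ts → o′ (act (g (heads ts)) (lookup ts zero))) →
                Spec (onTape zero g) ⟨ ρ , st , p , o ⟩ ⟨ ρ , st , p , o′ ⟩ 1
  output-step {p = p} {o′ = o′} h {ts} σ = _ , 1 , ≤-refl , prim , record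
    { output-ok = subst o′ (sym (onTape-at zero _ ts)) (h σ)
    ; input-ok  = subst p (sym (onTape-other zero (suc zero) _ ts λ ())) (input-ok σ)
    ; reg-ok    = regs-kept zero _ zero≢idx σ }

  emit-ok : ∀ {ρ x st p o} → length st < N →
            Spec (emit (length st)) ⟨ ρ , x ∷ st , p , Output o ⟩ ⟨ ρ , x ∷ st , p , Output (isPos x ∷ o) ⟩ 1
  emit-ok {x = x} {st} {o = o} v = output-step λ {ts} σ →
    subst (λ b → Output (isPos x ∷ o) (act (bit b , left) (lookup ts zero)))
      (sym (trans (cong (not ∘ isMark) (heads-at (idx (tmp (length st))) ts))
                  (trans (counter-zero? (reg-ok σ (tmp (length st)) v)) (cong isPos (level-at [] x st)))))
      (output-emit (isPos x) (output-ok σ))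

  skip-ok : ∀ {s} → Spec skip s s 1
  skip-ok {s} {ts} σ = _ , 1 , ≤-refl , prim , subst (St s) (sym (apply-idle ts)) σ

  foldDown : ∀ {C : Set} → (ℕ → C → C) → ℕ → C → C
  foldDown f zero    c = c
  foldDown f (suc m) c = foldDown f m (f m c)

  -- `S i c` is the invariant, with counter `i` and accumulated result `c`. Each round costs one
  -- test and at most `B` further steps; the failing last test is the remaining 1.
  loop-ok : ∀ {C : Set} {r body} (S : ℕ → C → State) (f : ℕ → C → C) {B} m → Valid r →
            (∀ i c → val (S i c) r ≡ i) →
            (∀ i c → i < m → Spec (dec r ⨾ body) (S (suc i) c) (S i (f i c)) B) →
            ∀ c → Spec (loopOn r body) (S m c) (S 0 (foldDown f m c)) (suc (m * suc B))
  loop-ok {r = r} S f m v h g c {ts} σ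
    with t ← trans (cong (not ∘ isMark) (heads-at (idx r) ts))
                   (trans (counter-zero? (reg-ok σ r v)) (cong isPos (h m c))) | m
  ... | zero = _ , 1 , ≤-refl , done t , σ
  ... | suc m =
    let _ , _ , le  , e  , τ = g m c ≤-refl σ
        _ , _ , le′ , e′ , υ = loop-ok S f m v h (λ i c i<m → g i c (m≤n⇒m≤1+n i<m)) (f m c) τ
    in _ , _ , s≤s (≤-trans (+-mono-≤ le le′) (≤-reflexive (+-suc _ _))) , loop t e e′ , υ

-- A language of polynomially bounded loops

-- Time bounds get nested by substitution, which is immediate for expressions; `toPoly` multiplies
-- them out at the end.
data MP : Set where
  arg     : MP
  cst     : ℕ → MP
  _⊞_ _⊠_ : MP → MP → MP

infixr 6 _⊞_
infixr 7 _⊠_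

⟪_⟫ : MP → ℕ → ℕ
⟪ arg ⟫     b = b
⟪ cst n ⟫ b = n
⟪ p ⊞ q ⟫ b = ⟪ p ⟫ b + ⟪ q ⟫ b
⟪ p ⊠ q ⟫ b = ⟪ p ⟫ b * ⟪ q ⟫ b

_⟨_⟩ : MP → MP → MP
arg       ⟨ r ⟩ = r
cst n   ⟨ r ⟩ = cst n
(p ⊞ q) ⟨ r ⟩ = (p ⟨ r ⟩) ⊞ (q ⟨ r ⟩)
(p ⊠ q) ⟨ r ⟩ = (p ⟨ r ⟩) ⊠ (q ⟨ r ⟩)

⟪⟫-subst : ∀ p r b → ⟪ p ⟨ r ⟩ ⟫ b ≡ ⟪ p ⟫ (⟪ r ⟫ b)
⟪⟫-subst arg       r b = refl
⟪⟫-subst (cst n) r b = refl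
⟪⟫-subst (p ⊞ q) r b = cong₂ _+_ (⟪⟫-subst p r b) (⟪⟫-subst q r b)
⟪⟫-subst (p ⊠ q) r b = cong₂ _*_ (⟪⟫-subst p r b) (⟪⟫-subst q r b)

addP mulP : Polynomial → Polynomial → Polynomial
addP []      q       = q
addP (a ∷ p) []      = a ∷ p
addP (a ∷ p) (b ∷ q) = a + b ∷ addP p q
mulP []      q = []
mulP (a ∷ p) q = addP (map (a *_) q) (0 ∷ mulP p q)

eval-add : ∀ p q x → eval (addP p q) x ≡ eval p x + eval q x
eval-add []      q       x = refl
eval-add (a ∷ p) []      x = sym (+-identityʳ _)
eval-add (a ∷ p) (b ∷ q) x rewrite eval-add p q x = lemma a b x (eval p x) (eval q x)
  where
  lemma : ∀ a b x p q → (a + b) + x * (p + q) ≡ (a + x * p) + (b + x * q)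
  lemma = solve-∀

eval-scale : ∀ a q x → eval (map (a *_) q) x ≡ a * eval q x
eval-scale a []      x = sym (*-zeroʳ a)
eval-scale a (b ∷ q) x rewrite eval-scale a q x = lemma a b x (eval q x)
  where
  lemma : ∀ a b x q → a * b + x * (a * q) ≡ a * (b + x * q)
  lemma = solve-∀

eval-mul : ∀ p q x → eval (mulP p q) x ≡ eval p x * eval q x
eval-mul []      q x = refl
eval-mul (a ∷ p) q x
  rewrite eval-add (map (a *_) q) (0 ∷ mulP p q) x | eval-scale a q x | eval-mul p q x =
  lemma a x (eval p x) (eval q x)
  where
  lemma : ∀ a x p q → a * q + x * (p * q) ≡ (a + x * p) * q
  lemma = solve-∀

toPoly : MP → Polynomial
toPoly arg       = 0 ∷ 1 ∷ []
toPoly (cst n) = [ n ]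
toPoly (p ⊞ q) = addP (toPoly p) (toPoly q)
toPoly (p ⊠ q) = mulP (toPoly p) (toPoly q)

eval-toPoly : ∀ p x → eval (toPoly p) x ≡ ⟪ p ⟫ x
eval-toPoly arg       x = lemma x
  where
  lemma : ∀ x → x * (1 + x * 0) ≡ x
  lemma = solve-∀
eval-toPoly (cst n) x = trans (cong (n +_) (*-zeroʳ x)) (+-identityʳ n)
eval-toPoly (p ⊞ q) x = trans (eval-add (toPoly p) _ x) (cong₂ _+_ (eval-toPoly p x) (eval-toPoly q x))
eval-toPoly (p ⊠ q) x = trans (eval-mul (toPoly p) _ x) (cong₂ _*_ (eval-toPoly p x) (eval-toPoly q x))

loopCost : MP → MP → MP
loopCost m c = cst 1 ⊞ (m ⊠ (cst 1 ⊞ c))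

loopCost-mono : ∀ {m n} c → m ≤ n → suc (m * suc c) ≤ suc (n * suc c)
loopCost-mono c h = s≤s (*-monoˡ-≤ (suc c) h)

Sum : ℕ → (ℕ → ℕ) → ℕ
Sum zero    f = 0
Sum (suc n) f = f n + Sum n f

Sum-bound : ∀ n f {b} → (∀ i → i < n → f i ≤ b) → Sum n f ≤ n * b
Sum-bound zero    f h = z≤n
Sum-bound (suc n) f h = +-mono-≤ (h n ≤-refl) (Sum-bound n f λ i i<n → h i (m≤n⇒m≤1+n i<n))

Cat : ℕ → (ℕ → Word) → Word
Cat zero    f = []
Cat (suc n) f = Cat n f ++ f n

module Lang (V′ : ℕ) where

  V : ℕ
  V = suc V′

  Env : Set
  Env = Vec ℕ V

  data Tm : Set where
    var            : Fin V → Tm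
    con            : ℕ → Tm
    _+ᵗ_ _*ᵗ_ _∸ᵗ_ : Tm → Tm → Tm
    bitᵗ           : Tm → Tm
    sumᵗ           : Fin V → Tm → Tm → Tm

  infixl 6 _+ᵗ_ _∸ᵗ_
  infixl 7 _*ᵗ_

  data Stmt : Set where
    emitˢ : Tm → Stmt
    _⨾ˢ_  : Stmt → Stmt → Stmt
    for   : Fin V → Tm → Stmt → Stmt
    letˢ  : Fin V → Tm → Stmt → Stmt

  infixr 4 _⨾ˢ_

  module _ (w : Word) where

    ⟦_⟧ : Tm → Env → ℕ
    ⟦ var x ⟧      ρ = lookup ρ x
    ⟦ con n ⟧      ρ = n
    ⟦ a +ᵗ b ⟧     ρ = ⟦ a ⟧ ρ + ⟦ b ⟧ ρ
    ⟦ a *ᵗ b ⟧     ρ = ⟦ a ⟧ ρ * ⟦ b ⟧ ρ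
    ⟦ a ∸ᵗ b ⟧     ρ = ⟦ a ⟧ ρ ∸ ⟦ b ⟧ ρ
    ⟦ bitᵗ a ⟧     ρ = b2n (nth w (⟦ a ⟧ ρ))
    ⟦ sumᵗ x a b ⟧ ρ = Sum (⟦ a ⟧ ρ) (λ i → ⟦ b ⟧ (ρ [ x ]≔ i))

    ⟦_⟧ˢ : Stmt → Env → Word
    ⟦ emitˢ t ⟧ˢ   ρ = [ isPos (⟦ t ⟧ ρ) ]
    ⟦ S ⨾ˢ T ⟧ˢ    ρ = ⟦ S ⟧ˢ ρ ++ ⟦ T ⟧ˢ ρ
    ⟦ for x t S ⟧ˢ ρ = Cat (⟦ t ⟧ ρ) (λ i → ⟦ S ⟧ˢ (ρ [ x ]≔ i))
    ⟦ letˢ x t S ⟧ˢ ρ = ⟦ S ⟧ˢ (ρ [ x ]≔ ⟦ t ⟧ ρ)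

  -- `arg` stands for a common bound on all variables. Under a binder the new value lies below the
  -- bound of its range, so the sum of both bounds takes the place of `arg`.
  bound : Tm → MP
  bound (var x)      = arg
  bound (con n)      = cst n
  bound (a +ᵗ b)     = bound a ⊞ bound b
  bound (a *ᵗ b)     = bound a ⊠ bound b
  bound (a ∸ᵗ b)     = bound a
  bound (bitᵗ a)     = cst 1
  bound (sumᵗ x a b) = bound a ⊠ bound b ⟨ arg ⊞ bound a ⟩

  record Bounded (ρ : Env) (b : ℕ) : Set where
    constructor bounded
    field at : ∀ x → lookup ρ x ≤ b
  open Bounded

  bounded-update : ∀ {ρ b c i} x → Bounded ρ b → i < c → Bounded (ρ [ x ]≔ i) (b + c)
  bounded-update {ρ} {b} {c} {i} x h lt = bounded λ y → case y Fin.≟ x of λ where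
    (yes refl) → ≤-trans (≤-reflexive (Vec.lookup∘update x ρ i)) (≤-trans (<⇒≤ lt) (m≤n+m c b))
    (no y≢x)   → ≤-trans (≤-reflexive (Vec.lookup∘update′ y≢x ρ i)) (≤-trans (at h y) (m≤m+n b c))

  ⟦⟧-bound : ∀ w t {ρ b} → Bounded ρ b → ⟦ w ⟧ t ρ ≤ ⟪ bound t ⟫ b
  ⟦⟧-bound w (var x)  h = at h x
  ⟦⟧-bound w (con n)  h = ≤-refl
  ⟦⟧-bound w (a +ᵗ b) h = +-mono-≤ (⟦⟧-bound w a h) (⟦⟧-bound w b h)
  ⟦⟧-bound w (a *ᵗ b) h = *-mono-≤ (⟦⟧-bound w a h) (⟦⟧-bound w b h)
  ⟦⟧-bound w (a ∸ᵗ b) {ρ} h = ≤-trans (m∸n≤m (⟦ w ⟧ a ρ) (⟦ w ⟧ b ρ)) (⟦⟧-bound w a h)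
  ⟦⟧-bound w (bitᵗ a) {ρ} h with nth w (⟦ w ⟧ a ρ)
  ... | true  = s≤s z≤n
  ... | false = z≤n
  ⟦⟧-bound w (sumᵗ x a t) {ρ} {b} h = ≤-trans
    (Sum-bound (⟦ w ⟧ a ρ) _ λ i i<n →
      ≤-trans (⟦⟧-bound w t (bounded-update x h (<-≤-trans i<n (⟦⟧-bound w a h))))
              (≤-reflexive (sym (⟪⟫-subst (bound t) (arg ⊞ bound a) b))))
    (*-monoˡ-≤ _ (⟦⟧-bound w a h))

  cost : Tm → MP
  cost (var x)      = loopCost arg (cst 3) ⊞ loopCost arg (cst 2)
  cost (con n)      = cst (suc n)
  cost (a +ᵗ b)     = cost b ⊞ cost a ⊞ loopCost (bound a) (cst 2)
  cost (a *ᵗ b)     = cost a ⊞ loopCost (bound a) (cst 1 ⊞ cost b ⊞ loopCost (bound b) (cst 2))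
  cost (a ∸ᵗ b)     = cost a ⊞ cost b ⊞ loopCost (bound b) (cst 2)
  cost (bitᵗ a)     = cost a ⊞ loopCost (bound a) (cst 3) ⊞ cst 1 ⊞ loopCost (bound a) (cst 2)
  cost (sumᵗ x a b) =
    cost a ⊞ loopCost arg (cst 2) ⊞ loopCost (bound a) (cst 2)
    ⊞ loopCost (bound a) (cst 1 ⊞ cost b ⟨ arg ⊞ bound a ⟩ ⊞ loopCost (bound b ⟨ arg ⊞ bound a ⟩) (cst 2))
    ⊞ loopCost arg (cst 2)

  costˢ : Stmt → MP
  costˢ (emitˢ t)   = cost t ⊞ cst 1 ⊞ loopCost (bound t) (cst 2)
  costˢ (S ⨾ˢ T)    = costˢ T ⊞ costˢ S
  costˢ (for x t S) =
    cost t ⊞ loopCost arg (cst 2) ⊞ loopCost (bound t) (cst 2)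
    ⊞ loopCost (bound t) (cst 1 ⊞ costˢ S ⟨ arg ⊞ bound t ⟩) ⊞ loopCost arg (cst 2)
  -- A loop index stays strictly below the bound of `t`, whereas a let-bound value may attain it;
  -- hence the `cst 1` in the substitution.
  costˢ (letˢ x t S) =
    cost t ⊞ loopCost arg (cst 2) ⊞ loopCost (bound t) (cst 2)
    ⊞ (costˢ S ⟨ arg ⊞ cst 1 ⊞ bound t ⟩ ⊞ loopCost (bound t) (cst 2)) ⊞ loopCost arg (cst 2)

  -- Stack levels required above the current height. Each construct uses at most four of its own,
  -- `d` to `d + 3`, and the common shape `4 + n` lets `slot` and `fit` settle every level bound.
  need : Tm → ℕ
  need (var x)      = 4
  need (con n)      = 4
  need (a +ᵗ b)     = 4 + (need a + need b)
  need (a *ᵗ b)     = 4 + (need a + need b)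
  need (a ∸ᵗ b)     = 4 + (need a + need b)
  need (bitᵗ a)     = 4 + (need a + 0)
  need (sumᵗ x a b) = 4 + (need a + need b)

  needˢ : Stmt → ℕ
  needˢ (emitˢ t)   = 4 + (need t + 0)
  needˢ (S ⨾ˢ T)    = 4 + (needˢ S + needˢ T)
  needˢ (for x t S) = 4 + (need t + needˢ S)
  needˢ (letˢ x t S) = 4 + (need t + needˢ S)

  -- The compiler and its correctness

  module Compile (N′ : ℕ) where
    open Store V N′

    -- A block with local variable `x`: its old value is parked on the stack. Since restoring adds
    -- the parked value, `c₂` has to leave `x` at 0.
    scope : Fin V → Cmd → ℕ → Cmd → Cmd
    scope x c₁ d c₂ = c₁
                    ⨾ loopOn (var x) (inc (tmp (1 + d)))
                    ⨾ loopOn (tmp d) (inc (var x))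
                    ⨾ c₂
                    ⨾ loopOn (tmp (1 + d)) (inc (var x))

    -- comp t d leaves the value of t at level d of the stack, d being its height.
    comp : Tm → ℕ → Cmd
    comp (var x)       d = loopOn (var x) (inc (tmp d) ⨾ inc (tmp (1 + d)))
                         ⨾ loopOn (tmp (1 + d)) (inc (var x))
    comp (con zero)    d = skip
    comp (con (suc n)) d = comp (con n) d ⨾ inc (tmp d)
    comp (a +ᵗ b)      d = comp b d ⨾ comp a (1 + d) ⨾ loopOn (tmp (1 + d)) (inc (tmp d))
    comp (a *ᵗ b)      d = comp a (1 + d)
                         ⨾ loopOn (tmp (1 + d)) (comp b (2 + d) ⨾ loopOn (tmp (2 + d)) (inc (tmp d)))
    comp (a ∸ᵗ b)      d = comp a d ⨾ comp b (1 + d) ⨾ loopOn (tmp (1 + d)) (dec (tmp d))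
    comp (bitᵗ a)      d = comp a (1 + d)
                         ⨾ loopOn (tmp (1 + d)) (moveInput right ⨾ inc (tmp (2 + d)))
                         ⨾ read d
                         ⨾ loopOn (tmp (2 + d)) (moveInput left)
    comp (sumᵗ x a b)  d = scope x (comp a (1 + d)) (1 + d)
                             (loopOn (var x) (comp b (3 + d) ⨾ loopOn (tmp (3 + d)) (inc (tmp d))))

    -- Statements run from last to first, because the output is written leftwards:
    -- the head then ends just left of the first bit of the output.
    compˢ : Stmt → ℕ → Cmd
    compˢ (emitˢ t)   d = comp t d ⨾ emit d ⨾ loopOn (tmp d) skip
    compˢ (S ⨾ˢ T)    d = compˢ T d ⨾ compˢ S d
    compˢ (for x t S)  d = scope x (comp t d) d (loopOn (var x) (compˢ S (2 + d)))
    compˢ (letˢ x t S) d = scope x (comp t d) d (compˢ S (2 + d) ⨾ loopOn (var x) skip)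

    fit : ∀ j {d k n} {_ : True (j ≤? 4)} → k ≤ n → d + (4 + n) ≤ N → (j + d) + k ≤ N
    fit j {d} {k} {n} {j≤4} le h = ≤-trans (begin
      (j + d) + k   ≡⟨ cong (_+ k) (+-comm j d) ⟩
      (d + j) + k   ≡⟨ +-assoc d j k ⟩
      d + (j + k)   ≤⟨ +-monoʳ-≤ d (+-mono-≤ (toWitness j≤4) le) ⟩
      d + (4 + n)   ∎) h
      where open ≤-Reasoning

    slot : ∀ j {d n} {_ : True (suc j ≤? 4)} → d + (4 + n) ≤ N → j + d < N
    slot j {d} {n} {lt} h = ≤-trans (begin
      suc j + d       ≡⟨ +-comm (suc j) d ⟩
      d + suc j       ≤⟨ +-monoʳ-≤ d (toWitness lt) ⟩
      d + 4           ≤⟨ +-monoʳ-≤ d (m≤m+n 4 n) ⟩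
      d + (4 + n)     ∎) h
      where open ≤-Reasoning

    foldDown-suc : ∀ m c → foldDown (λ _ → suc) m c ≡ m + c
    foldDown-suc zero    c = refl
    foldDown-suc (suc m) c = trans (foldDown-suc m (suc c)) (+-suc m c)

    foldDown-pred : ∀ m c → foldDown (λ _ → pred) m c ≡ c ∸ m
    foldDown-pred zero    c       = refl
    foldDown-pred (suc m) zero    = trans (foldDown-pred m 0) (0∸n≡0 m)
    foldDown-pred (suc m) (suc c) = foldDown-pred m c

    foldDown-+ : ∀ f m c → foldDown (λ i c → f i + c) m c ≡ Sum m f + c
    foldDown-+ f zero    c = refl
    foldDown-+ f (suc m) c = trans (foldDown-+ f m (f m + c)) (lemma (Sum m f) (f m) c)
      where
      lemma : ∀ s a c → s + (a + c) ≡ (a + s) + c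
      lemma = solve-∀

    foldDown-const : ∀ b m c → foldDown (λ _ c → b + c) m c ≡ m * b + c
    foldDown-const b zero    c = refl
    foldDown-const b (suc m) c = trans (foldDown-const b m (b + c)) (lemma (m * b) b c)
      where
      lemma : ∀ s a c → s + (a + c) ≡ (a + s) + c
      lemma = solve-∀

    foldDown-++ : ∀ f m (o : Word) → foldDown (λ i o → f i ++ o) m o ≡ Cat m f ++ o
    foldDown-++ f zero    o = refl
    foldDown-++ f (suc m) o = trans (foldDown-++ f m (f m ++ o)) (sym (++-assoc (Cat m f) (f m) o))

    module _ {ρ : Env} {p o : Tape 1 → Set} where

      add-down : ∀ pre {i c st} → length (pre ++ c ∷ st) < N → length st < N →
        Spec (loopOn (tmp (length (pre ++ c ∷ st))) (inc (tmp (length st))))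
             ⟨ ρ , i ∷ pre ++ c ∷ st , p , o ⟩ ⟨ ρ , 0 ∷ pre ++ (i + c) ∷ st , p , o ⟩ (suc (i * 3))
      add-down pre {i} {c} {st} v u = retarget (cong (λ x → ⟨ ρ , 0 ∷ pre ++ x ∷ st , p , o ⟩) (foldDown-suc i c))
        (loop-ok (λ i c → ⟨ ρ , i ∷ pre ++ c ∷ st , p , o ⟩) (λ _ → suc) i v
          (λ i c′ → trans (cong (level (i ∷ pre ++ c′ ∷ st)) (len c c′)) (level-at [] i (pre ++ c′ ∷ st)))
          (λ i c′ _ → subst (λ l → Spec (dec (tmp l)) ⟨ ρ , suc i ∷ pre ++ c′ ∷ st , p , o ⟩ _ 1) (len c′ c)
                        (dec-tmp [] (subst (_< N) (len c c′) v))
                      ⟫ inc-tmp (i ∷ pre) u) c)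
        where
        len : ∀ x y → length (pre ++ x ∷ st) ≡ length (pre ++ y ∷ st)
        len x y = trans (length-++ pre) (sym (length-++ pre))

      sub-down : ∀ {i c st} → 1 + length st < N → length st < N →
        Spec (loopOn (tmp (1 + length st)) (dec (tmp (length st))))
             ⟨ ρ , i ∷ c ∷ st , p , o ⟩ ⟨ ρ , 0 ∷ (c ∸ i) ∷ st , p , o ⟩ (suc (i * 3))
      sub-down {i} {c} {st} v u = retarget (cong (λ x → ⟨ ρ , 0 ∷ x ∷ st , p , o ⟩) (foldDown-pred i c))
        (loop-ok (λ i c → ⟨ ρ , i ∷ c ∷ st , p , o ⟩) (λ _ → pred) i v
          (λ i c → level-at [] i (c ∷ st))
          (λ i c _ → dec-tmp [] v ⟫ dec-tmp (i ∷ []) u) c)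

      tmp-to-var : ∀ pre {i c st x} → length st < N →
        Spec (loopOn (tmp (length st)) (inc (var x)))
             ⟨ ρ [ x ]≔ c , pre ++ i ∷ st , p , o ⟩ ⟨ ρ [ x ]≔ (i + c) , pre ++ 0 ∷ st , p , o ⟩ (suc (i * 3))
      tmp-to-var pre {i} {c} {st} {x} v = retarget (cong (λ n → ⟨ ρ [ x ]≔ n , pre ++ 0 ∷ st , p , o ⟩) (foldDown-suc i c))
        (loop-ok (λ i c → ⟨ ρ [ x ]≔ c , pre ++ i ∷ st , p , o ⟩) (λ _ → suc) i v
          (λ i c → level-at pre i st)
          (λ i c _ → dec-tmp pre v ⟫ inc-var) c)

      var-to-tmp : ∀ {i c st x} → length st < N →
        Spec (loopOn (var x) (inc (tmp (length st))))
             ⟨ ρ [ x ]≔ i , c ∷ st , p , o ⟩ ⟨ ρ [ x ]≔ 0 , (i + c) ∷ st , p , o ⟩ (suc (i * 3))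
      var-to-tmp {i} {c} {st} {x} v = retarget (cong (λ n → ⟨ ρ [ x ]≔ 0 , n ∷ st , p , o ⟩) (foldDown-suc i c))
        (loop-ok (λ i c → ⟨ ρ [ x ]≔ i , c ∷ st , p , o ⟩) (λ _ → suc) i tt
          (λ i c → Vec.lookup∘update x ρ i)
          (λ i c _ → dec-var ⟫ inc-tmp [] v) c)

    -- `st′` may differ from `st` because the body of a sum adds to an accumulator further down the
    -- stack.
    scope-ok : ∀ x {ρ b st st′ p o o′ A a c₁ c₂ m n} → Bounded ρ b → A ≤ a → length st′ ≡ length st →
      length st < N → 1 + length st < N →
      Spec c₁ ⟨ ρ , st , p , o ⟩ ⟨ ρ , A ∷ st , p , o ⟩ m →
      Spec c₂ ⟨ ρ [ x ]≔ A , lookup ρ x ∷ 0 ∷ st , p , o ⟩ ⟨ ρ [ x ]≔ 0 , lookup ρ x ∷ 0 ∷ st′ , p , o′ ⟩ n →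
      Spec (scope x c₁ (length st) c₂) ⟨ ρ , st , p , o ⟩ ⟨ ρ , st′ , p , o′ ⟩
           (m + (suc (b * 3) + (suc (a * 3) + (n + suc (b * 3)))))
    scope-ok x {ρ} {st = st} {st′} {p} {o} {o′} {A} h A≤a e v u f g = pop (pop
      (f
      ⟫ (push (weaken (loopCost-mono 2 (at h x))
           (resource (cong (λ ρ′ → ⟨ ρ′ , 0 ∷ A ∷ st , p , o ⟩) (Vec.[]≔-lookup ρ x))
           (retarget (cong (λ n → ⟨ ρ [ x ]≔ 0 , n ∷ A ∷ st , p , o ⟩) (+-identityʳ old)) (var-to-tmp {i = old} u))))
      ⟫ (weaken (loopCost-mono 2 A≤a)
           (retarget (cong (λ i → ⟨ ρ [ x ]≔ i , old ∷ 0 ∷ st , p , o ⟩) (+-identityʳ A)) (tmp-to-var (old ∷ []) v))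
      ⟫ (g
      ⟫ weaken (loopCost-mono 2 (at h x))
          (retarget (cong (λ ρ′ → ⟨ ρ′ , 0 ∷ 0 ∷ st′ , p , o′ ⟩) (trans (cong (ρ [ x ]≔_) (+-identityʳ old)) (Vec.[]≔-lookup ρ x)))
            (subst (λ l → Spec (loopOn (tmp (1 + l)) (inc (var x))) ⟨ ρ [ x ]≔ 0 , old ∷ 0 ∷ st′ , p , o′ ⟩
                               ⟨ ρ [ x ]≔ (old + 0) , 0 ∷ 0 ∷ st′ , p , o′ ⟩ (suc (old * 3))) e
              (tmp-to-var [] (subst (λ l → 1 + l < N) (sym e) u)))))))))
      where
      old : ℕ
      old = lookup ρ x

    module _ (w : Word) where

      -- Reading a counter empties it, so two copies are made and one of them is moved back.
      spec-var : ∀ x {ρ b st o} → Bounded ρ b → 1 + length st < N → length st < N →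
        Spec (comp (var x) (length st)) ⟨ ρ , st , Input w 0 , o ⟩
             ⟨ ρ , lookup ρ x ∷ st , Input w 0 , o ⟩ (⟪ cost (var x) ⟫ b)
      spec-var x {ρ} {b} {st} {o} h v u = push (push (pop (
        resource (cong (λ ρ′ → ⟨ ρ′ , 0 ∷ 0 ∷ st , Input w 0 , o ⟩) (Vec.[]≔-lookup ρ x))
          (weaken (loopCost-mono 3 (at h x)) copy ⟫ weaken (loopCost-mono 2 (at h x)) restore))))
        where
        n = lookup ρ x
        copy : Spec _ ⟨ ρ [ x ]≔ n , 0 ∷ 0 ∷ st , Input w 0 , o ⟩ ⟨ ρ [ x ]≔ 0 , n ∷ n ∷ st , Input w 0 , o ⟩ (suc (n * 4))
        copy = retarget (cong (λ k → ⟨ ρ [ x ]≔ 0 , k ∷ k ∷ st , Input w 0 , o ⟩) (trans (foldDown-suc n 0) (+-identityʳ n)))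
          (loop-ok (λ i c → ⟨ ρ [ x ]≔ i , c ∷ c ∷ st , Input w 0 , o ⟩) (λ _ → suc) n tt
            (λ i c → Vec.lookup∘update x ρ i)
            (λ i c _ → dec-var ⟫ (inc-tmp (c ∷ []) u ⟫ inc-tmp [] v)) 0)
        restore : Spec _ ⟨ ρ [ x ]≔ 0 , n ∷ n ∷ st , Input w 0 , o ⟩ ⟨ ρ , 0 ∷ n ∷ st , Input w 0 , o ⟩ (suc (n * 3))
        restore = retarget (cong (λ ρ′ → ⟨ ρ′ , 0 ∷ n ∷ st , Input w 0 , o ⟩) (trans (cong (ρ [ x ]≔_) (+-identityʳ n)) (Vec.[]≔-lookup ρ x)))
          (tmp-to-var [] v)

      comp-ok : ∀ t {ρ b st o} → Bounded ρ b → length st + need t ≤ N →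
        Spec (comp t (length st)) ⟨ ρ , st , Input w 0 , o ⟩
             ⟨ ρ , ⟦ w ⟧ t ρ ∷ st , Input w 0 , o ⟩ (⟪ cost t ⟫ b)
      comp-ok (var x) h r = spec-var x h (slot 1 {n = 0} r) (slot 0 {n = 0} r)
      comp-ok (con zero) h r = push skip-ok
      comp-ok (con (suc n)) {b = b} h r =
        weaken (≤-reflexive (+-comm (suc n) 1)) (comp-ok (con n) {b = b} h r ⟫ inc-tmp [] (slot 0 {n = 0} r))
      comp-ok (a +ᵗ t) h r =
        comp-ok t h (fit 0 (m≤n+m _ (need a)) r)
        ⟫ (comp-ok a h (fit 1 (m≤m+n _ (need t)) r)
        ⟫ pop (weaken (loopCost-mono 2 (⟦⟧-bound w a h)) (add-down [] (slot 1 r) (slot 0 r))))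
      comp-ok (a *ᵗ t) {ρ} {b} {st} {o} h r = push (pop
        (comp-ok a h (fit 1 (m≤m+n _ (need t)) r)
        ⟫ weaken (loopCost-mono _ (⟦⟧-bound w a h))
          (retarget (cong (λ x → ⟨ ρ , 0 ∷ x ∷ st , Input w 0 , o ⟩) (trans (foldDown-const (⟦ w ⟧ t ρ) A 0) (+-identityʳ _)))
               (loop-ok (λ i c → ⟨ ρ , i ∷ c ∷ st , Input w 0 , o ⟩) (λ _ c → ⟦ w ⟧ t ρ + c) A (slot 1 r)
                 (λ i c → level-at [] i (c ∷ st))
                 (λ i c _ → dec-tmp [] (slot 1 r)
                   ⟫ (comp-ok t h (fit 2 (m≤n+m _ (need a)) r)
                   ⟫ pop (weaken (loopCost-mono 2 (⟦⟧-bound w t h)) (add-down (i ∷ []) (slot 2 r) (slot 0 r)))))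
                 0))))
        where A = ⟦ w ⟧ a ρ
      comp-ok (a ∸ᵗ t) h r =
        comp-ok a h (fit 0 (m≤m+n _ (need t)) r)
        ⟫ (comp-ok t h (fit 1 (m≤n+m _ (need a)) r)
        ⟫ pop (weaken (loopCost-mono 2 (⟦⟧-bound w t h)) (sub-down (slot 1 r) (slot 0 r))))
      -- Walking to the addressed bit uses up the address, so the steps are counted again two levels
      -- above the result, for the way back.
      comp-ok (bitᵗ a) {ρ} {b} {st} {o} h r = push (pop
        (comp-ok a h (fit 1 (m≤m+n _ 0) r)
        ⟫ (push (weaken (loopCost-mono 3 (⟦⟧-bound w a h))
             (retarget (cong (λ x → ⟨ ρ , x ∷ 0 ∷ 0 ∷ st , Input w x , o ⟩) (trans (foldDown-suc A 0) (+-identityʳ A)))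
                (loop-ok (λ i c → ⟨ ρ , c ∷ i ∷ 0 ∷ st , Input w c , o ⟩) (λ _ → suc) A (slot 1 r)
                  (λ i c → level-at (c ∷ []) i (0 ∷ st))
                  (λ i c _ → dec-tmp (c ∷ []) (slot 1 r)
                    ⟫ (move-ok (input-right {w} {c}) ⟫ inc-tmp [] (slot 2 r)))
                  0)))
        ⟫ (retarget (cong (λ x → ⟨ ρ , A ∷ 0 ∷ x ∷ st , Input w A , o ⟩) (+-identityʳ (b2n (nth w A))))
             (read-ok (A ∷ 0 ∷ []) (slot 0 r) (input-head {w} {A}))
        ⟫ pop (weaken (loopCost-mono 2 (⟦⟧-bound w a h))
               (loop-ok (λ i _ → ⟨ ρ , i ∷ 0 ∷ b2n (nth w A) ∷ st , Input w i , o ⟩) (λ _ c → c) A (slot 2 r)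
                  (λ i _ → level-at [] i (0 ∷ b2n (nth w A) ∷ st))
                  (λ i _ _ → dec-tmp [] (slot 2 r) ⟫ move-ok (input-left {w} {i})) tt))))))
        where A = ⟦ w ⟧ a ρ
      comp-ok (sumᵗ x a t) {ρ} {b} {st} {o} h r = push (scope-ok x h (⟦⟧-bound w a h) refl (slot 1 r) (slot 2 r)
        (comp-ok a h (fit 1 (m≤m+n _ (need t)) r))
        (weaken (loopCost-mono _ (⟦⟧-bound w a h))
          (retarget (cong (λ s → ⟨ ρ [ x ]≔ 0 , old ∷ 0 ∷ s ∷ st , Input w 0 , o ⟩) (trans (foldDown-+ f A 0) (+-identityʳ _)))
            (loop-ok (λ i c → ⟨ ρ [ x ]≔ i , old ∷ 0 ∷ c ∷ st , Input w 0 , o ⟩) (λ i c → f i + c)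
              {⟪ cst 1 ⊞ cost t ⟨ arg ⊞ bound a ⟩ ⊞ loopCost (bound t ⟨ arg ⊞ bound a ⟩) (cst 2) ⟫ b} A tt
              (λ i c → Vec.lookup∘update x ρ i)
              (λ i c i<A → dec-var
                ⟫ (weaken (≤-reflexive (sym (⟪⟫-subst (cost t) (arg ⊞ bound a) b)))
                     (comp-ok t (hb i i<A) (fit 3 (m≤n+m _ (need a)) r))
                ⟫ pop (weaken (loopCost-mono 2 (≤-trans (⟦⟧-bound w t (hb i i<A))
                                 (≤-reflexive (sym (⟪⟫-subst (bound t) (arg ⊞ bound a) b)))))
                         (add-down (old ∷ 0 ∷ []) (slot 3 r) (slot 0 r)))))
              0))))
        where
        A   = ⟦ w ⟧ a ρ
        old = lookup ρ x
        f : ℕ → ℕ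
        f i = ⟦ w ⟧ t (ρ [ x ]≔ i)
        hb : ∀ i → i < A → Bounded (ρ [ x ]≔ i) (b + ⟪ bound a ⟫ b)
        hb i i<A = bounded-update x h (<-≤-trans i<A (⟦⟧-bound w a h))

      compˢ-ok : ∀ S {ρ b st o} → Bounded ρ b → length st + needˢ S ≤ N →
        Spec (compˢ S (length st)) ⟨ ρ , st , Input w 0 , Output o ⟩
             ⟨ ρ , st , Input w 0 , Output (⟦ w ⟧ˢ S ρ ++ o) ⟩ (⟪ costˢ S ⟫ b)
      compˢ-ok (emitˢ t) {ρ} {b} {st} {o} h r =
        comp-ok t h (fit 0 (m≤m+n _ 0) r)
        ⟫ (emit-ok (slot 0 r)
        ⟫ pop (weaken (loopCost-mono 2 (⟦⟧-bound w t h))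
            (loop-ok (λ i _ → ⟨ ρ , i ∷ st , Input w 0 , Output (isPos (⟦ w ⟧ t ρ) ∷ o) ⟩) (λ _ c → c) (⟦ w ⟧ t ρ) (slot 0 r)
              (λ i _ → level-at [] i st) (λ i _ _ → dec-tmp [] (slot 0 r) ⟫ skip-ok) tt)))
      compˢ-ok (S ⨾ˢ T) {ρ} {b} {st} {o} h r =
        retarget (cong (λ o′ → ⟨ ρ , st , Input w 0 , Output o′ ⟩) (sym (++-assoc (⟦ w ⟧ˢ S ρ) (⟦ w ⟧ˢ T ρ) o)))
          (compˢ-ok T h (fit 0 (m≤n+m _ (needˢ S)) r) ⟫ compˢ-ok S h (fit 0 (m≤m+n _ (needˢ T)) r))
      compˢ-ok (for x t S) {ρ} {b} {st} {o} h r = scope-ok x h (⟦⟧-bound w t h) refl (slot 0 r) (slot 1 r)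
        (comp-ok t h (fit 0 (m≤m+n _ (needˢ S)) r))
        (weaken (loopCost-mono _ (⟦⟧-bound w t h))
          (retarget (cong (λ o′ → ⟨ ρ [ x ]≔ 0 , old ∷ 0 ∷ st , Input w 0 , Output o′ ⟩) (foldDown-++ f A o))
            (loop-ok (λ i o → ⟨ ρ [ x ]≔ i , old ∷ 0 ∷ st , Input w 0 , Output o ⟩) (λ i o → f i ++ o)
              {⟪ cst 1 ⊞ costˢ S ⟨ arg ⊞ bound t ⟩ ⟫ b} A tt
              (λ i c → Vec.lookup∘update x ρ i)
              (λ i c i<A → dec-var
                ⟫ weaken (≤-reflexive (sym (⟪⟫-subst (costˢ S) (arg ⊞ bound t) b)))
                     (compˢ-ok S (bounded-update x h (<-≤-trans i<A (⟦⟧-bound w t h)))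
                                 (fit 2 (m≤n+m _ (need t)) r)))
              o)))
        where
        A   = ⟦ w ⟧ t ρ
        old = lookup ρ x
        f : ℕ → Word
        f i = ⟦ w ⟧ˢ S (ρ [ x ]≔ i)
      compˢ-ok (letˢ x t S) {ρ} {b} {st} {o} h r = scope-ok x h (⟦⟧-bound w t h) refl (slot 0 r) (slot 1 r)
        (comp-ok t h (fit 0 (m≤m+n _ (needˢ S)) r))
        (weaken (≤-reflexive (sym (⟪⟫-subst (costˢ S) (arg ⊞ cst 1 ⊞ bound t) b)))
           (compˢ-ok S (bounded-update x h (s≤s (⟦⟧-bound w t h))) (fit 2 (m≤n+m _ (need t)) r))
        -- The let-bound value is counted down to 0, as `scope` demands.
        ⟫ weaken (loopCost-mono 2 (⟦⟧-bound w t h))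
           (loop-ok (λ i _ → ⟨ ρ [ x ]≔ i , lookup ρ x ∷ 0 ∷ st , Input w 0 , Output o′ ⟩) (λ _ c → c) (⟦ w ⟧ t ρ) tt
              (λ i _ → Vec.lookup∘update x ρ i) (λ i _ _ → dec-var ⟫ skip-ok) tt))
        where
        o′ : Word
        o′ = ⟦ w ⟧ˢ S (ρ [ x ]≔ ⟦ w ⟧ t ρ) ++ o

-- Statements compute polynomial-time functions

module LangTM (V′ : ℕ) where
  open Lang V′

  input-env : Word → Env
  input-env w = length w ∷ Vec.replicate V′ 0

  source : ℕ → Word → Tape 1
  source i []      = tape (blanks i) blank []
  source i (b ∷ w) = tape (blanks i) (bit b) (map bit w)

  source-zero : ∀ w → fromList (map bit w) ≡ source 0 w
  source-zero []      = refl
  source-zero (_ ∷ _) = refl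

  source-step : ∀ i b w → act (blank , right) (source i (b ∷ w)) ≡ source (suc i) w
  source-step i b []      = refl
  source-step i b (_ ∷ _) = refl

  revOnto : List (Symbol 1) → Word → List (Symbol 1)
  revOnto l []      = l
  revOnto l (b ∷ w) = revOnto (bit b ∷ l) w

  itape-end : ∀ l w → itape l w (length w) 0 ≡ tape (revOnto l w) blank []
  itape-end l []      = refl
  itape-end l (b ∷ w) = itape-end (bit b ∷ l) w

  module _ (S : Stmt) where
    open Store V (needˢ S)
    open Compile (needˢ S)

    -- The input moves to the second tape because the first has to receive the output. Its length is
    -- counted twice: once as the value of variable 0, once for rewinding.
    marks copyStep copy rewind finish program : Cmd
    marks    = prim λ { (a ∷ b ∷ _) → (a , stay) ∷ (b , stay) ∷ Vec.replicate _ (mark , stay) }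
    copyStep = onTape (suc zero) (λ hs → lookup hs zero , right)
             ⨾ onTape zero (λ _ → blank , right)
             ⨾ inc (var zero) ⨾ inc (tmp 0)
    copy     = while (λ hs → not (isBlank (lookup hs zero))) copyStep
    rewind   = loopOn (tmp 0) (moveInput left)
    finish   = onTape zero (λ hs → lookup hs zero , right)
    program  = marks ⨾ copy ⨾ rewind ⨾ compˢ S 0 ⨾ finish

    0<N : 0 < N
    0<N = s≤s z≤n

    copying : ℕ → List (Symbol 1) → Word → State
    copying i l w = ⟨ i ∷ Vec.replicate V′ 0 , i ∷ [] , _≡ tape l blank [] , _≡ source i w ⟩

    initial-tapes : Word → Tapes
    initial-tapes w = fromList (map bit w) ∷ Vec.replicate _ (fromList [])

    marks-ok : ∀ w → ∃[ us ] Exec marks (initial-tapes w) 1 us × St (copying 0 [] w) us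
    marks-ok w = _ , prim , record
      { output-ok = source-zero w
      ; input-ok  = refl
      ; reg-ok    = λ { (var x) _ → 0 , trans (marked (x ↑ˡ N)) (cong (λ n → ctape n 0) (sym (zero-val x)))
                      ; (tmp l) _ → 0 , trans (marked (V ↑ʳ (l mod N))) (cong (λ n → ctape n 0) (sym (level-0 [] l))) } }
      where
      zero-val : ∀ x → lookup (0 ∷ Vec.replicate V′ 0) x ≡ 0
      zero-val zero    = refl
      zero-val (suc x) = Vec.lookup-replicate x 0
      marked : ∀ {n} (i : Fin n) → lookup (Vec.zipWith act (Vec.replicate n (mark , stay)) (Vec.replicate n (fromList []))) i
               ≡ ctape 0 0
      marked zero    = refl
      marked (suc i) = marked i

    copyStep-ok : ∀ i l b w → Spec copyStep (copying i l (b ∷ w)) (copying (suc i) (bit b ∷ l) w) 4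
    copyStep-ok i l b w =
      input-step (λ {ts} e e′ → cong₂ (λ s t → act (s , right) t) (trans (heads-at zero ts) (cong Tape.head e)) e′)
      ⟫ (output-step (λ σ → trans (cong (act (blank , right)) (output-ok σ)) (source-step i b w))
      ⟫ (inc-var {ρ = 0 ∷ Vec.replicate V′ 0} {x = zero}
      ⟫ inc-tmp [] 0<N))

    copy-ok : ∀ w i l → Spec copy (copying i l w) (copying (length w + i) (revOnto l w) []) (suc (length w * 5))
    copy-ok [] i l {ts} σ =
      _ , 1 , ≤-refl , done (cong (not ∘ isBlank) (trans (heads-at zero ts) (cong Tape.head (output-ok σ)))) , σ
    copy-ok (b ∷ w) i l {ts} σ =
      let _ , _ , le  , e  , τ = copyStep-ok i l b w σ
          us , _ , le′ , e′ , υ = copy-ok w (suc i) (bit b ∷ l) τ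
      in _ , _ , s≤s (≤-trans (+-mono-≤ le le′) (≤-reflexive (+-suc 4 _)))
         , loop (cong (not ∘ isBlank) (trans (heads-at zero ts) (cong Tape.head (output-ok σ)))) e e′
         , subst (λ n → St (copying n (revOnto (bit b ∷ l) w) []) us) (+-suc (length w) i) υ

    copied : ∀ w {ts} → St (copying (length w + 0) (revOnto [] w) []) ts →
             St ⟨ input-env w , length w ∷ [] , Input w (length w) , Output [] ⟩ ts
    copied w σ rewrite +-identityʳ (length w) = record
      { output-ok = length w , 0 , output-ok σ
      ; input-ok  = 0 , trans (input-ok σ) (sym (itape-end [] w))
      ; reg-ok    = reg-ok σ }

    rewind-ok : ∀ w → Spec rewind ⟨ input-env w , length w ∷ [] , Input w (length w) , Output [] ⟩
                                  ⟨ input-env w , [] , Input w 0 , Output [] ⟩ (suc (length w * 3))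
    rewind-ok w = pop (loop-ok (λ i _ → ⟨ input-env w , i ∷ [] , Input w i , Output [] ⟩) (λ _ c → c) (length w) 0<N
      (λ i _ → level-at [] i []) (λ i _ _ → dec-tmp [] 0<N ⟫ move-ok (input-left {w} {i})) tt)

    finish-ok : ∀ {ρ st p o} → Spec finish ⟨ ρ , st , p , Output o ⟩ ⟨ ρ , st , p , (λ t → readOff t ≡ o) ⟩ 1
    finish-ok {o = o} = output-step λ {ts} σ →
      subst (λ s → readOff (act (s , right) (lookup ts zero)) ≡ o) (sym (heads-at zero ts)) (output-read (output-ok σ))

    time : MP
    time = cst 1 ⊞ loopCost arg (cst 4) ⊞ loopCost arg (cst 2) ⊞ costˢ S ⊞ cst 1

    input-bounded : ∀ w → Bounded (input-env w) (length w)
    input-bounded w = bounded λ where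
      zero    → ≤-refl
      (suc x) → ≤-trans (≤-reflexive (Vec.lookup-replicate x 0)) z≤n

    run-ok : ∀ w → ∃[ us ] ∃[ a ] a ≤ ⟪ time ⟫ (length w) × Exec program (initial-tapes w) a us
                   × readOff (lookup us zero) ≡ ⟦ w ⟧ˢ S (input-env w)
    run-ok w =
      let _ , e₁ , σ₁           = marks-ok w
          _ , _ , le₂ , e₂ , σ₂ = copy-ok w 0 [] σ₁
          _ , _ , le₃ , e₃ , σ₃ = rewind-ok w (copied w σ₂)
          _ , _ , le₄ , e₄ , σ₄ = compˢ-ok w S (input-bounded w) (n≤1+n (needˢ S)) σ₃
          _ , _ , le₅ , e₅ , σ₅ = finish-ok σ₄
      in _ , _ , s≤s (+-mono-≤ le₂ (+-mono-≤ le₃ (+-mono-≤ le₄ le₅)))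
         , seq e₁ (seq e₂ (seq e₃ (seq e₄ e₅))) , trans (output-ok σ₅) (++-identityʳ _)

    stmt-polytime : PolyTime (λ w → ⟦ w ⟧ˢ S (input-env w))
    stmt-polytime = machine program , toPoly time , λ w →
      let us , a , le , e , r = run-ok w
      in a , (zero , us) , ≤-trans le (≤-reflexive (sym (eval-toPoly time (length w))))
         , exec⇒halts e , trans (cong readOff (head≡ us)) r
      where
      head≡ : (ts : Tapes) → Vec.head ts ≡ lookup ts zero
      head≡ (t ∷ ts) = refl

-- First-order formulas

-- A decision of `P` tied to its characteristic value, so that arithmetic terms can play the part of
-- formulas.
data Ind (P : Set) : ℕ → Set where
  pos : P → Ind P 1
  neg : ¬ P → Ind P 0

Sum-zero : ∀ n f → (∀ i → i < n → f i ≡ 0) → Sum n f ≡ 0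
Sum-zero zero    f h = refl
Sum-zero (suc n) f h rewrite h n ≤-refl = Sum-zero n f (λ i i<n → h i (m≤n⇒m≤1+n i<n))

Sum-term : ∀ n f {i} → i < n → f i ≤ Sum n f
Sum-term (suc n) f i<1+n with m≤n⇒m<n∨m≡n (≤-pred i<1+n)
... | inj₁ i<n  = ≤-trans (Sum-term n f i<n) (m≤n+m _ (f n))
... | inj₂ refl = m≤m+n (f n) _

Sum-any : ∀ n f → Sum n f ≢ 0 → ∃[ i ] i < n × f i ≢ 0
Sum-any zero    f h = ⊥-elim (h refl)
Sum-any (suc n) f h with f n in eq
... | suc _ = n , ≤-refl , λ z → case trans (sym eq) z of λ ()
... | zero  = let i , i<n , p = Sum-any n f h in i , m≤n⇒m≤1+n i<n , p

ind-¬ : ∀ {P n} → Ind P n → Ind (¬ P) (1 ∸ n)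
ind-¬ (pos p) = neg (λ ¬p → ¬p p)
ind-¬ (neg ¬p) = pos ¬p

ind-× : ∀ {P Q m n} → Ind P m → Ind Q n → Ind (P × Q) (m * n)
ind-× (pos p) (pos q) = pos (p , q)
ind-× (pos p) (neg ¬q) = neg (¬q ∘ proj₂)
ind-× (neg ¬p) _       = neg (¬p ∘ proj₁)

ind-⊎ : ∀ {P Q m n} → Ind P m → Ind Q n → Ind (P ⊎ Q) (1 ∸ (1 ∸ m) * (1 ∸ n))
ind-⊎ (pos p) _       = pos (inj₁ p)
ind-⊎ (neg ¬p) (pos q) = pos (inj₂ q)
ind-⊎ (neg ¬p) (neg ¬q) = neg λ { (inj₁ p) → ¬p p ; (inj₂ q) → ¬q q }

ind-map : ∀ {P Q n} → (P → Q) → (Q → P) → Ind P n → Ind Q n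
ind-map f g (pos p) = pos (f p)
ind-map f g (neg ¬p) = neg (¬p ∘ g)

ind-≢0 : ∀ {P n} → Ind P n → n ≢ 0 → P
ind-≢0 (pos p) _ = p
ind-≢0 (neg ¬p) h = ⊥-elim (h refl)

ind-1 : ∀ {P n} → Ind P n → P → n ≡ 1
ind-1 (pos p) _ = refl
ind-1 (neg ¬p) p = ⊥-elim (¬p p)

-- The sum counts witnesses; subtracting from 1 twice caps it at 1.
ind-∃ : ∀ n {P : ℕ → Set} {f} → (∀ i → Ind (P i) (f i)) →
        Ind (∃[ i ] i < n × P i) (1 ∸ (1 ∸ Sum n f))
ind-∃ n {P} {f} h with Sum n f in eq
... | suc k = subst (Ind _) (cong (1 ∸_) (sym (0∸n≡0 k)))
                (pos (let i , i<n , p = Sum-any n f (λ z → case trans (sym eq) z of λ ()) in i , i<n , ind-≢0 (h i) p))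
... | zero  = neg λ (i , i<n , p) → case subst₂ _≤_ (ind-1 (h i) p) eq (Sum-term n f i<n) of λ ()

-- The sum counts counterexamples.
ind-∀ : ∀ n {P : ℕ → Set} {f : ℕ → ℕ} → (∀ i → Ind (P i) (f i)) →
        Ind (∀ i → i < n → P i) (1 ∸ Sum n (λ i → 1 ∸ f i))
ind-∀ n {P} {f} h = go (Sum n g) refl
  where
  g : ℕ → ℕ
  g i = 1 ∸ f i
  go : ∀ s → Sum n g ≡ s → Ind (∀ i → i < n → P i) (1 ∸ s)
  go zero    eq = pos λ i i<n → ind-≢0 (h i) λ z → case subst₂ _≤_ (cong (1 ∸_) z) eq (Sum-term n g i<n) of λ ()
  go (suc k) eq = subst (Ind _) (sym (0∸n≡0 k))
    (neg λ all → let i , i<n , p = Sum-any n g (λ z → case trans (sym eq) z of λ ())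
                in ind-≢0 (ind-¬ (h i)) p (all i i<n))

ind-≤ : ∀ m n → Ind (m ≤ n) (1 ∸ (m ∸ n))
ind-≤ m n with m ∸ n in eq
... | zero  = pos (m∸n≡0⇒m≤n eq)
... | suc k = subst (Ind _) (sym (0∸n≡0 k)) (neg λ le → case trans (sym eq) (m≤n⇒m∸n≡0 le) of λ ())

ind-≡ : ∀ m n → Ind (m ≡ n) ((1 ∸ (m ∸ n)) * (1 ∸ (n ∸ m)))
ind-≡ m n with 1 ∸ (m ∸ n) | ind-≤ m n | 1 ∸ (n ∸ m) | ind-≤ n m
... | _ | pos p | _ | pos q = pos (≤-antisym p q)
... | _ | pos p | _ | neg ¬q = neg λ e → ¬q (≤-reflexive (sym e))
... | _ | neg ¬p | _ | _     = neg λ e → ¬p (≤-reflexive e)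

ind-bool : ∀ b → Ind (b ≡ true) (b2n b)
ind-bool true  = pos refl
ind-bool false = neg λ ()

module Logic (V′ : ℕ) where
  open Lang V′ public
  open LangTM V′ public using (input-env; stmt-polytime)

  data Fm : Set where
    _≤ᶠ_ _≡ᶠ_ : Tm → Tm → Fm
    bitᶠ      : Tm → Fm
    boolᶠ     : Bool → Fm
    ¬ᶠ_       : Fm → Fm
    _∧ᶠ_ _∨ᶠ_ : Fm → Fm → Fm
    allᶠ exᶠ  : Fin V → Tm → Fm → Fm
    -- A disjunction over a family fixed in advance, such as the tags belonging to a machine; its
    -- members are different formulas, unlike the rounds of a bounded quantifier.
    ⋁ᶠ        : ∀ {m} → (Fin m → Fm) → Fm

  infix  5 _≤ᶠ_ _≡ᶠ_
  infix  4 ¬ᶠ_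
  infixr 3 _∧ᶠ_
  infixr 2 _∨ᶠ_

  ⟦_⟧ᶠ : Fm → Word → Env → Set
  ⟦ a ≤ᶠ b ⟧ᶠ     w ρ = ⟦ w ⟧ a ρ ≤ ⟦ w ⟧ b ρ
  ⟦ a ≡ᶠ b ⟧ᶠ     w ρ = ⟦ w ⟧ a ρ ≡ ⟦ w ⟧ b ρ
  ⟦ bitᶠ a ⟧ᶠ     w ρ = nth w (⟦ w ⟧ a ρ) ≡ true
  ⟦ boolᶠ b ⟧ᶠ    w ρ = b ≡ true
  ⟦ ¬ᶠ φ ⟧ᶠ       w ρ = ¬ ⟦ φ ⟧ᶠ w ρ
  ⟦ φ ∧ᶠ ψ ⟧ᶠ     w ρ = ⟦ φ ⟧ᶠ w ρ × ⟦ ψ ⟧ᶠ w ρ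
  ⟦ φ ∨ᶠ ψ ⟧ᶠ     w ρ = ⟦ φ ⟧ᶠ w ρ ⊎ ⟦ ψ ⟧ᶠ w ρ
  ⟦ allᶠ x a φ ⟧ᶠ w ρ = ∀ i → i < ⟦ w ⟧ a ρ → ⟦ φ ⟧ᶠ w (ρ [ x ]≔ i)
  ⟦ exᶠ x a φ ⟧ᶠ  w ρ = ∃[ i ] i < ⟦ w ⟧ a ρ × ⟦ φ ⟧ᶠ w (ρ [ x ]≔ i)
  ⟦ ⋁ᶠ φ ⟧ᶠ       w ρ = ∃[ j ] ⟦ φ j ⟧ᶠ w ρ

  any-Tm : ∀ {m} → (Fin m → Tm) → Tm
  any-Tm {zero}  t = con 0
  any-Tm {suc m} t = con 1 ∸ᵗ (con 1 ∸ᵗ t zero) *ᵗ (con 1 ∸ᵗ any-Tm (t ∘ suc))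

  ind : Fm → Tm
  ind (a ≤ᶠ b)     = con 1 ∸ᵗ (a ∸ᵗ b)
  ind (a ≡ᶠ b)     = (con 1 ∸ᵗ (a ∸ᵗ b)) *ᵗ (con 1 ∸ᵗ (b ∸ᵗ a))
  ind (bitᶠ a)     = bitᵗ a
  ind (boolᶠ b)    = con (b2n b)
  ind (¬ᶠ φ)       = con 1 ∸ᵗ ind φ
  ind (φ ∧ᶠ ψ)     = ind φ *ᵗ ind ψ
  ind (φ ∨ᶠ ψ)     = con 1 ∸ᵗ (con 1 ∸ᵗ ind φ) *ᵗ (con 1 ∸ᵗ ind ψ)
  ind (allᶠ x a φ) = con 1 ∸ᵗ sumᵗ x a (con 1 ∸ᵗ ind φ)
  ind (exᶠ x a φ)  = con 1 ∸ᵗ (con 1 ∸ᵗ sumᵗ x a (ind φ))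
  ind (⋁ᶠ φ)       = any-Tm (λ j → ind (φ j))

  ind-any : ∀ w {m} (t : Fin m → Tm) (P : Fin m → Set) ρ → (∀ j → Ind (P j) (⟦ w ⟧ (t j) ρ)) →
            Ind (∃[ j ] P j) (⟦ w ⟧ (any-Tm t) ρ)
  ind-any w {zero}  t P ρ h = neg λ ()
  ind-any w {suc m} t P ρ h = ind-map
    (λ { (inj₁ p) → zero , p ; (inj₂ (j , p)) → suc j , p })
    (λ { (zero , p) → inj₁ p ; (suc j , p) → inj₂ (j , p) })
    (ind-⊎ (h zero) (ind-any w (t ∘ suc) (P ∘ suc) ρ (h ∘ suc)))

  ind-ok : ∀ w φ ρ → Ind (⟦ φ ⟧ᶠ w ρ) (⟦ w ⟧ (ind φ) ρ)
  ind-ok w (a ≤ᶠ b)     ρ = ind-≤ (⟦ w ⟧ a ρ) (⟦ w ⟧ b ρ)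
  ind-ok w (a ≡ᶠ b)     ρ = ind-≡ (⟦ w ⟧ a ρ) (⟦ w ⟧ b ρ)
  ind-ok w (bitᶠ a)     ρ = ind-bool (nth w (⟦ w ⟧ a ρ))
  ind-ok w (boolᶠ b)    ρ = ind-bool b
  ind-ok w (¬ᶠ φ)       ρ = ind-¬ (ind-ok w φ ρ)
  ind-ok w (φ ∧ᶠ ψ)     ρ = ind-× (ind-ok w φ ρ) (ind-ok w ψ ρ)
  ind-ok w (φ ∨ᶠ ψ)     ρ = ind-⊎ (ind-ok w φ ρ) (ind-ok w ψ ρ)
  ind-ok w (allᶠ x a φ) ρ = ind-∀ (⟦ w ⟧ a ρ) λ i → ind-ok w φ (ρ [ x ]≔ i)
  ind-ok w (exᶠ x a φ)  ρ = ind-∃ (⟦ w ⟧ a ρ) λ i → ind-ok w φ (ρ [ x ]≔ i)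
  ind-ok w (⋁ᶠ φ)       ρ = ind-any w (λ j → ind (φ j)) (λ j → ⟦ φ j ⟧ᶠ w ρ) ρ (λ j → ind-ok w (φ j) ρ)

  holds : Word → Fm → Env → Bool
  holds w φ ρ = isPos (⟦ w ⟧ (ind φ) ρ)

  ind-isPos : ∀ {P n} → Ind P n → P ⇔ isPos n ≡ true
  ind-isPos (pos p) = mk⇔ (λ _ → refl) (λ _ → p)
  ind-isPos (neg ¬p) = mk⇔ (⊥-elim ∘ ¬p) λ ()

  holds-⇔ : ∀ w φ ρ → ⟦ φ ⟧ᶠ w ρ ⇔ holds w φ ρ ≡ true
  holds-⇔ w φ ρ = ind-isPos (ind-ok w φ ρ)

  formula-InP : ∀ φ → InP (λ w → ⟦ φ ⟧ᶠ w (input-env w))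
  formula-InP φ = (λ w → holds w φ (input-env w)) , stmt-polytime (emitˢ (ind φ)) , λ w → holds-⇔ w φ (input-env w)

-- Triple Roman domination

FSum : ∀ {n} → (Fin n → ℕ) → ℕ
FSum {zero}  f = 0
FSum {suc n} f = f zero + FSum (f ∘ suc)

FSum-cong : ∀ {n} {f g : Fin n → ℕ} → (∀ i → f i ≡ g i) → FSum f ≡ FSum g
FSum-cong {zero}  h = refl
FSum-cong {suc n} h = cong₂ _+_ (h zero) (FSum-cong (h ∘ suc))

FSum-const : ∀ n c → FSum {n} (λ _ → c) ≡ n * c
FSum-const zero    c = refl
FSum-const (suc n) c = cong (c +_) (FSum-const n c)

FSum-zero : ∀ {n} {f : Fin n → ℕ} → (∀ i → f i ≡ 0) → FSum f ≡ 0
FSum-zero {n} h = trans (FSum-cong h) (trans (FSum-const n 0) (*-zeroʳ n))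

FSum-+ : ∀ {n} (f g : Fin n → ℕ) → FSum (λ i → f i + g i) ≡ FSum f + FSum g
FSum-+ {zero}  f g = refl
FSum-+ {suc n} f g = trans (cong (f zero + g zero +_) (FSum-+ (f ∘ suc) (g ∘ suc)))
                           (interchange (f zero) (g zero) _ _)

FSum-mono : ∀ {n} {f g : Fin n → ℕ} → (∀ i → f i ≤ g i) → FSum f ≤ FSum g
FSum-mono {zero}  h = z≤n
FSum-mono {suc n} h = +-mono-≤ (h zero) (FSum-mono (h ∘ suc))

FSum-term : ∀ {n} (f : Fin n → ℕ) i → f i ≤ FSum f
FSum-term f zero    = m≤m+n _ _
FSum-term f (suc i) = ≤-trans (FSum-term (f ∘ suc) i) (m≤n+m _ _)

FSum-any : ∀ {n} (f : Fin n → ℕ) → 0 < FSum f → ∃[ i ] 0 < f i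
FSum-any {suc n} f h with f zero in eq
... | suc _ = zero , subst (0 <_) (sym eq) (s≤s z≤n)
... | zero  = let i , p = FSum-any (f ∘ suc) h in suc i , p

FSum-point : ∀ {n} (f g : Fin n → ℕ) i → (∀ j → j ≢ i → f j ≡ g j) → g i ≡ 0 → FSum f ≡ f i + FSum g
FSum-point f g zero    h z =
  cong₂ _+_ refl (trans (FSum-cong (λ j → h (suc j) λ ())) (cong (_+ FSum (g ∘ suc)) (sym z)))
FSum-point f g (suc i) h z = begin
  f zero + FSum (f ∘ suc)               ≡⟨ cong₂ _+_ (h zero λ ()) (FSum-point (f ∘ suc) (g ∘ suc) i (λ j ne → h (suc j) (ne ∘ Fin.suc-injective)) z) ⟩
  g zero + (f (suc i) + FSum (g ∘ suc)) ≡⟨ +-assoc (g zero) _ _ ⟨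
  (g zero + f (suc i)) + FSum (g ∘ suc) ≡⟨ cong (_+ FSum (g ∘ suc)) (+-comm (g zero) _) ⟩
  (f (suc i) + g zero) + FSum (g ∘ suc) ≡⟨ +-assoc (f (suc i)) _ _ ⟩
  f (suc i) + (g zero + FSum (g ∘ suc)) ∎
  where open ≡-Reasoning

FSum-single : ∀ {n} (f : Fin n → ℕ) i → (∀ j → j ≢ i → f j ≡ 0) → FSum f ≡ f i
FSum-single {n} f i h = trans (FSum-point f (λ _ → 0) i h refl)
                          (trans (cong (f i +_) (FSum-zero {n} λ _ → refl)) (+-identityʳ _))

-- No term has room to exceed `c`, as the others already use up their share of the total.
FSum-tight : ∀ {n} (f : Fin n → ℕ) c → (∀ i → c ≤ f i) → FSum f ≤ n * c → ∀ i → f i ≡ c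
FSum-tight {suc n} f c lo hi zero =
  ≤-antisym (+-cancelʳ-≤ (n * c) _ _ (≤-trans (+-monoʳ-≤ (f zero)
    (≤-trans (≤-reflexive (sym (FSum-const n c))) (FSum-mono (lo ∘ suc)))) hi)) (lo zero)
FSum-tight {suc n} f c lo hi (suc i) =
  FSum-tight (f ∘ suc) c (lo ∘ suc) (+-cancelˡ-≤ c _ _ (≤-trans (+-monoˡ-≤ _ (lo zero)) hi)) i

FSum-split : ∀ m {n} (f : Fin (m + n) → ℕ) → FSum f ≡ FSum (λ i → f (i ↑ˡ n)) + FSum (λ j → f (m ↑ʳ j))
FSum-split zero    f = refl
FSum-split (suc m) f = trans (cong (f zero +_) (FSum-split m (f ∘ suc))) (sym (+-assoc (f zero) _ _))

FSum-combine : ∀ n {k} (f : Fin (n * k) → ℕ) → FSum f ≡ FSum (λ i → FSum (λ j → f (combine {n} i j)))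
FSum-combine zero        f = refl
FSum-combine (suc n) {k} f = trans (FSum-split k f) (cong (FSum (λ j → f (j ↑ˡ (n * k))) +_) (FSum-combine n (λ i → f (k ↑ʳ i))))

sum-tabulate : ∀ {n} (f : Fin n → ℕ) → sum (tabulate f) ≡ FSum f
sum-tabulate {zero}  f = refl
sum-tabulate {suc n} f = cong (f zero +_) (sum-tabulate (f ∘ suc))

sum-allFin : ∀ {n} (f : Fin n → ℕ) → sum (map f (allFin n)) ≡ FSum f
sum-allFin f = trans (cong sum (map-tabulate id f)) (sum-tabulate f)

sum-filter : ∀ {A : Set} {P : A → Set} (P? : Decidable P) (f : A → ℕ) xs →
             sum (map f (filter P? xs)) ≡ sum (map (λ x → b2n (does (P? x)) * f x) xs)
sum-filter P? f []       = refl
sum-filter P? f (x ∷ xs) with does (P? x)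
... | true  = cong₂ _+_ (sym (+-identityʳ (f x))) (sum-filter P? f xs)
... | false = sum-filter P? f xs

∈?-lookup : ∀ {n} (x : Fin n) (S : Subset n) → does (x ∈? S) ≡ lookup S x
∈?-lookup zero    (true  ∷ S) = refl
∈?-lookup zero    (false ∷ S) = refl
∈?-lookup (suc x) (_     ∷ S) = ∈?-lookup x S

card-tabulate : ∀ {n} (b : Fin n → Bool) → ∣ Vec.tabulate b ∣ ≡ FSum (b2n ∘ b)
card-tabulate {zero}  b = refl
card-tabulate {suc n} b with b zero
... | true  = cong suc (card-tabulate (b ∘ suc))
... | false = card-tabulate (b ∘ suc)

lookup-⁅⁆ : ∀ {n} (v w : Fin n) → lookup ⁅ v ⁆ w ≡ does (w Fin.≟ v)
lookup-⁅⁆ {suc n} zero    zero    = refl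
lookup-⁅⁆ {suc n} zero    (suc w) = Vec.lookup-replicate w false
lookup-⁅⁆ {suc n} (suc v) zero    = refl
lookup-⁅⁆ {suc n} (suc v) (suc w) = lookup-⁅⁆ v w

module _ (Γ : Graph) (h : Graph.Vertex Γ → Fin 5) where
  open Graph Γ

  excess : Vertex → ℕ
  excess v = FSum (λ w → b2n (adj v w) * (toℕ (h w) ∸ 1))

  -- Moving the active neighbours of v to the other side: each of them
  -- contributes 1 to |AN(v)| and h(w) to h(AN[v]).
  Dominates : Set
  Dominates = ∀ v → toℕ (h v) < 3 → 3 ≤ toℕ (h v) + excess v

  weight-FSum : weight Γ h ≡ FSum (toℕ ∘ h)
  weight-FSum = sum-allFin (toℕ ∘ h)

  private
    active : Vertex → Vertex → Bool
    active v w = adj v w ∧ (1 ≤ᵇ toℕ (h w))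

    in-AN[] : ∀ v w → does (w ∈? AN[_] Γ h v) ≡ active v w ∨ does (w Fin.≟ v)
    in-AN[] v w = trans (∈?-lookup w (AN[_] Γ h v))
      (trans (Vec.lookup-zipWith _∨_ w (AN Γ h v) ⁅ v ⁆) (cong₂ _∨_ (Vec.lookup∘tabulate (active v) w) (lookup-⁅⁆ v w)))

    active-weight : ∀ b n → b2n b * n ≡ b2n (b ∧ (1 ≤ᵇ n)) + b2n b * (n ∸ 1)
    active-weight false n       = refl
    active-weight true  zero    = refl
    active-weight true  (suc n) = refl

    active-weight′ : ∀ b n → b2n ((b ∧ (1 ≤ᵇ n)) ∨ false) * n ≡ b2n b * n
    active-weight′ false n       = refl
    active-weight′ true  zero    = refl
    active-weight′ true  (suc n) = refl

  total-AN[] : ∀ v → total Γ h (AN[_] Γ h v) ≡ ∣ AN Γ h v ∣ + (toℕ (h v) + excess v)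
  total-AN[] v = begin
    total Γ h (AN[_] Γ h v)
      ≡⟨ sum-filter (_∈? AN[_] Γ h v) (toℕ ∘ h) (allFin order) ⟩
    sum (map (λ w → b2n (does (w ∈? AN[_] Γ h v)) * toℕ (h w)) (allFin order))
      ≡⟨ sum-allFin {order} _ ⟩
    FSum (λ w → b2n (does (w ∈? AN[_] Γ h v)) * toℕ (h w))
      ≡⟨ FSum-cong (λ w → cong (λ b → b2n b * toℕ (h w)) (in-AN[] v w)) ⟩
    FSum (λ w → b2n (active v w ∨ does (w Fin.≟ v)) * toℕ (h w))
      -- `v` is a member of `AN[ v ]` but not its own neighbour, so its term is split off; every
      -- other term agrees with the sum over neighbours.
      ≡⟨ FSum-point _ (λ w → b2n (adj v w) * toℕ (h w)) v other (cong (λ b → b2n b * toℕ (h v)) (adj-irrefl v)) ⟩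
    b2n (active v v ∨ does (v Fin.≟ v)) * toℕ (h v) + FSum (λ w → b2n (adj v w) * toℕ (h w))
      ≡⟨ cong₂ _+_ self (FSum-cong (λ w → active-weight (adj v w) (toℕ (h w)))) ⟩
    toℕ (h v) + FSum (λ w → b2n (active v w) + b2n (adj v w) * (toℕ (h w) ∸ 1))
      ≡⟨ cong (toℕ (h v) +_) (FSum-+ (b2n ∘ active v) _) ⟩
    toℕ (h v) + (FSum (b2n ∘ active v) + excess v)
      ≡⟨ cong (λ n → toℕ (h v) + (n + excess v)) (sym (card-tabulate (active v))) ⟩
    toℕ (h v) + (∣ AN Γ h v ∣ + excess v)
      ≡⟨ +-assoc (toℕ (h v)) _ _ ⟨
    toℕ (h v) + ∣ AN Γ h v ∣ + excess v
      ≡⟨ cong (_+ excess v) (+-comm (toℕ (h v)) _) ⟩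
    ∣ AN Γ h v ∣ + toℕ (h v) + excess v
      ≡⟨ +-assoc ∣ AN Γ h v ∣ _ _ ⟩
    ∣ AN Γ h v ∣ + (toℕ (h v) + excess v) ∎
    where
    open ≡-Reasoning
    other : ∀ w → w ≢ v → b2n (active v w ∨ does (w Fin.≟ v)) * toℕ (h w) ≡ b2n (adj v w) * toℕ (h w)
    other w ne rewrite dec-false (w Fin.≟ v) ne = active-weight′ (adj v w) (toℕ (h w))
    self : b2n (active v v ∨ does (v Fin.≟ v)) * toℕ (h v) ≡ toℕ (h v)
    self rewrite dec-true (v Fin.≟ v) refl | ∨-zeroʳ (active v v) = +-identityʳ _

  3rdf⇔dominates : Is3RDF Γ h ⇔ Dominates
  3rdf⇔dominates = mk⇔
    (λ r v lt → +-cancelˡ-≤ ∣ AN Γ h v ∣ _ _ (subst (∣ AN Γ h v ∣ + 3 ≤_) (total-AN[] v) (r v lt)))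
    (λ d v lt → subst (∣ AN Γ h v ∣ + 3 ≤_) (sym (total-AN[] v)) (+-monoʳ-≤ ∣ AN Γ h v ∣ (d v lt)))

-- Split graphs from positive clauses

module _ (Γ : Graph) (Q : Graph.Vertex Γ → Bool)
         (clique : ∀ {u v} → Q u ≡ true → Q v ≡ true → u ≢ v → Graph._~_ Γ u v)
         (indep  : ∀ {u v} → Q u ≡ false → Q v ≡ false → ¬ Graph._~_ Γ u v) where

  -- If the first vertex is outside the clique, its two neighbours are inside;
  -- otherwise the third vertex or both of its neighbours are inside.
  split⇒chordal : Chordal Γ
  split⇒chordal ℓ@(suc (suc (suc (suc m)))) (s≤s (s≤s (s≤s (s≤s _)))) c (inj , cyc) = go (Q (c i0)) refl (Q (c i2)) refl
    where
    i0 i1 i2 i3 last : Fin ℓ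
    i0   = zero
    i1   = suc zero
    i2   = suc (suc zero)
    i3   = suc (suc (suc zero))
    last = fromℕ (3 + m)

    small : ∀ k → k < 4 → k % ℓ ≡ k
    small k k<4 = m<n⇒m%n≡m (≤-trans k<4 (m≤m+n 4 m))

    wrap : suc (toℕ last) % ℓ ≡ 0
    wrap = trans (cong (λ k → suc k % ℓ) (Fin.toℕ-fromℕ (3 + m))) (n%n≡0 ℓ)

    chord : ∀ i j → Q (c i) ≡ true → Q (c j) ≡ true → i ≢ j → ¬ CyclicSuc Γ i j → ¬ CyclicSuc Γ j i → HasChord Γ c
    chord i j p q ne a b = i , j , a , b , clique p q (ne ∘ inj)

    succ : ∀ i j → CyclicSuc Γ i j → Q (c i) ≡ false → Q (c j) ≡ true
    succ i j s p with Q (c j) in eq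
    ... | true  = refl
    ... | false = ⊥-elim (indep p eq (cyc i j s))

    prec : ∀ i j → CyclicSuc Γ i j → Q (c j) ≡ false → Q (c i) ≡ true
    prec i j s p with Q (c i) in eq
    ... | true  = refl
    ... | false = ⊥-elim (indep eq p (cyc i j s))

    -- This keeps `i1` from following `i3` on the cycle: the remainder is 4, or 0 when ℓ = 4.
    4%ℓ≢1 : 1 ≢ 4 % ℓ
    4%ℓ≢1 e = case m≤n⇒m<n∨m≡n (m≤m+n 4 m) of λ where
      (inj₁ 4<ℓ) → case trans e (m<n⇒m%n≡m 4<ℓ) of λ ()
      (inj₂ 4≡ℓ) → case trans e (trans (cong (_% ℓ) 4≡ℓ) (n%n≡0 ℓ)) of λ ()

    go : ∀ a → Q (c i0) ≡ a → ∀ b → Q (c i2) ≡ b → HasChord Γ c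
    go false p _     q = chord i1 last (succ i0 i1 (sym (small 1 (s≤s (s≤s z≤n)))) p) (prec last i0 (sym wrap) p)
      (λ e → case trans (cong toℕ e) (Fin.toℕ-fromℕ (3 + m)) of λ ())
      (λ e → case trans (sym (Fin.toℕ-fromℕ (3 + m))) (trans e (small 2 (s≤s (s≤s (s≤s z≤n))))) of λ ())
      (λ e → case trans e wrap of λ ())
    go true  p true  q = chord i0 i2 p q (λ ())
      (λ e → case trans e (small 1 (s≤s (s≤s z≤n))) of λ ())
      (λ e → case trans e (small 3 ≤-refl) of λ ())
    go true  p false q = chord i1 i3 (prec i1 i2 (sym (small 2 (s≤s (s≤s (s≤s z≤n))))) q) (succ i2 i3 (sym (small 3 ≤-refl)) q) (λ ())
      (λ e → case trans e (small 2 (s≤s (s≤s (s≤s z≤n)))) of λ ())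
      4%ℓ≢1

module Tags (D E : ℕ) where

  data Tag : Set where
    opt    : Fin D → Tag
    copy   : Fin 5 → Tag
    clause : Fin E → Tag

  K : ℕ
  K = D + (5 + E)

  tag : Fin K → Tag
  tag t with splitAt D t
  ... | inj₁ o = opt o
  ... | inj₂ s with splitAt 5 s
  ...   | inj₁ c = copy c
  ...   | inj₂ e = clause e

  untag : Tag → Fin K
  untag (opt o)    = o ↑ˡ _
  untag (copy c)   = D ↑ʳ (c ↑ˡ E)
  untag (clause e) = D ↑ʳ (5 ↑ʳ e)

  tag-untag : ∀ x → tag (untag x) ≡ x
  tag-untag (opt o)    rewrite Fin.splitAt-↑ˡ D o (5 + E) = refl
  tag-untag (copy c)   rewrite Fin.splitAt-↑ʳ D (5 + E) (c ↑ˡ E) | Fin.splitAt-↑ˡ 5 c E = refl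
  tag-untag (clause e) rewrite Fin.splitAt-↑ʳ D (5 + E) (5 ↑ʳ e) | Fin.splitAt-↑ʳ 5 E e = refl

-- Vertices (i , opt o) form a clique and the others an independent set; the
-- five copies force weight at least 4 on the options of every group i.
module Gadget (N D E : ℕ) (mem : Fin N → Fin E → Fin N → Fin D → Bool) where
  open Tags D E public

  Vert : Set
  Vert = Fin N × Tag

  dec : Fin (N * K) → Vert
  dec u = let i , t = remQuot K u in i , tag t

  enc : Vert → Fin (N * K)
  enc (i , x) = combine i (untag x)

  dec-enc : ∀ v → dec (enc v) ≡ v
  dec-enc (i , x) = trans (cong (λ (i , t) → i , tag t) (Fin.remQuot-combine i (untag x)))
                          (cong (i ,_) (tag-untag x))

  A : Vert → Vert → Bool
  A (i , opt o)    (j , opt p)    = not (does (i Fin.≟ j) ∧ does (o Fin.≟ p))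
  A (i , opt o)    (j , copy _)   = does (i Fin.≟ j)
  A (i , copy _)   (j , opt _)    = does (j Fin.≟ i)
  A (i , opt o)    (j , clause e) = mem j e i o
  A (i , clause e) (j , opt o)    = mem i e j o
  A _              _              = false

  does-≟-sym : ∀ {n} (i j : Fin n) → does (i Fin.≟ j) ≡ does (j Fin.≟ i)
  does-≟-sym i j with i Fin.≟ j
  ... | yes e = sym (dec-true (j Fin.≟ i) (sym e))
  ... | no ne = sym (dec-false (j Fin.≟ i) (ne ∘ sym))

  A-sym : ∀ u v → A u v ≡ A v u
  A-sym (i , opt o)    (j , opt p)    = cong not (cong₂ _∧_ (does-≟-sym i j) (does-≟-sym o p))
  A-sym (i , opt o)    (j , copy _)   = refl
  A-sym (i , opt o)    (j , clause e) = refl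
  A-sym (i , copy _)   (j , opt _)    = refl
  A-sym (i , copy _)   (j , copy _)   = refl
  A-sym (i , copy _)   (j , clause _) = refl
  A-sym (i , clause _) (j , opt _)    = refl
  A-sym (i , clause _) (j , copy _)   = refl
  A-sym (i , clause _) (j , clause _) = refl

  A-irrefl : ∀ v → A v v ≡ false
  A-irrefl (i , opt o) rewrite dec-true (i Fin.≟ i) refl | dec-true (o Fin.≟ o) refl = refl
  A-irrefl (i , copy _)   = refl
  A-irrefl (i , clause _) = refl

  graph : Graph
  graph = record
    { order      = N * K
    ; adj        = λ u v → A (dec u) (dec v)
    ; adj-sym    = λ u v → A-sym (dec u) (dec v)
    ; adj-irrefl = λ v → A-irrefl (dec v)
    }

  open Graph graph using (Vertex; adj; order)

  isOpt : Vert → Bool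
  isOpt (_ , opt _) = true
  isOpt _           = false

  enc-dec : ∀ u → enc (dec u) ≡ u
  enc-dec u = trans (cong (combine (proj₁ (remQuot {N} K u))) (untag-tag _)) (Fin.combine-remQuot {N} K u)
    where
    untag-tag : ∀ t → untag (tag t) ≡ t
    untag-tag t with splitAt D t in p
    ... | inj₁ o = Fin.splitAt⁻¹-↑ˡ p
    ... | inj₂ s with splitAt 5 s in q
    ...   | inj₁ c = trans (cong (D ↑ʳ_) (Fin.splitAt⁻¹-↑ˡ q)) (Fin.splitAt⁻¹-↑ʳ p)
    ...   | inj₂ c = trans (cong (D ↑ʳ_) (Fin.splitAt⁻¹-↑ʳ q)) (Fin.splitAt⁻¹-↑ʳ p)

  dec-injective : ∀ {u v} → dec u ≡ dec v → u ≡ v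
  dec-injective {u} {v} e = trans (sym (enc-dec u)) (trans (cong enc e) (enc-dec v))

  graph-chordal : Chordal graph
  graph-chordal = split⇒chordal graph (isOpt ∘ dec)
    (λ {u} {v} p q ne → clique (dec u) (dec v) p q (ne ∘ dec-injective))
    (λ {u} {v} p q → indep (dec u) (dec v) p q)
    where
    clique : ∀ u v → isOpt u ≡ true → isOpt v ≡ true → u ≢ v → T (A u v)
    clique (i , opt o) (j , opt p) _ _ ne with i Fin.≟ j | o Fin.≟ p
    ... | yes refl | yes refl = ⊥-elim (ne refl)
    ... | yes _    | no _     = _
    ... | no _     | _        = _
    indep : ∀ u v → isOpt u ≡ false → isOpt v ≡ false → ¬ T (A u v)
    indep (_ , copy _)   (_ , copy _)   _ _ ()
    indep (_ , copy _)   (_ , clause _) _ _ ()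
    indep (_ , clause _) (_ , copy _)   _ _ ()
    indep (_ , clause _) (_ , clause _) _ _ ()

  FSum-vert : (f : Vertex → ℕ) → FSum f ≡ FSum (λ i → FSum (λ o → f (enc (i , opt o)))
    + (FSum (λ c → f (enc (i , copy c))) + FSum (λ e → f (enc (i , clause e)))))
  FSum-vert f = trans (FSum-combine N f) (FSum-cong λ i →
    trans (FSum-split D (λ t → f (combine i t)))
          (cong (FSum (λ o → f (enc (i , opt o))) +_) (FSum-split 5 (λ t → f (combine i (D ↑ʳ t))))))

  Satisfies : (Fin N → Fin D) → Set
  Satisfies σ = ∀ i e → ∃[ j ] mem i e j (σ j) ≡ true

  module _ (σ : Fin N → Fin D) (sat : Satisfies σ) where

    value : Vert → Fin 5
    value (i , opt o) = if does (σ i Fin.≟ o) then suc (suc (suc (suc zero))) else zero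
    value _           = zero

    value-σ : ∀ i → value (i , opt (σ i)) ≡ suc (suc (suc (suc zero)))
    value-σ i rewrite dec-true (σ i Fin.≟ σ i) refl = refl

    h : Vertex → Fin 5
    h = value ∘ dec

    -- One neighbour of label 4 supplies the whole required excess of 3.
    selected : ∀ v j → A v (j , opt (σ j)) ≡ true → 3 ≤ FSum (λ w → b2n (A v (dec w)) * (toℕ (h w) ∸ 1))
    selected v j p = ≤-trans (≤-reflexive (sym q))
      (FSum-term (λ w → b2n (A v (dec w)) * (toℕ (h w) ∸ 1)) (enc (j , opt (σ j))))
      where
      q : b2n (A v (dec (enc (j , opt (σ j))))) * (toℕ (h (enc (j , opt (σ j)))) ∸ 1) ≡ 3
      q rewrite dec-enc (j , opt (σ j)) | p | value-σ j = refl

    dominated : ∀ v → toℕ (value v) < 3 → ∃[ j ] A v (j , opt (σ j)) ≡ true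
    dominated (i , opt o) lt with σ i Fin.≟ o
    ... | yes _ = case lt of λ { (s≤s (s≤s (s≤s ()))) }
    ... | no ne = i , p
      where
      p : A (i , opt o) (i , opt (σ i)) ≡ true
      p rewrite dec-true (i Fin.≟ i) refl | dec-false (o Fin.≟ σ i) (ne ∘ sym) = refl
    dominated (i , copy _)   _ = i , dec-true (i Fin.≟ i) refl
    dominated (i , clause e) _ = sat i e

    h-3rdf : Is3RDF graph h
    h-3rdf = Equivalence.from (3rdf⇔dominates graph h) λ v lt →
      let j , p = dominated (dec v) lt in ≤-trans (selected (dec v) j p) (m≤n+m _ _)

    h-weight : weight graph h ≡ N * 4
    h-weight = trans (weight-FSum graph h) (trans (FSum-vert (toℕ ∘ h)) (trans (FSum-cong block) (FSum-const N 4)))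
      where
      block : ∀ i → _ ≡ 4
      block i = trans (cong₂ _+_
        (trans (FSum-single _ (σ i) λ o ne → trans (cong (toℕ ∘ value) (dec-enc (i , opt o)))
                  (cong (λ b → toℕ (if b then suc (suc (suc (suc zero))) else zero)) (dec-false (σ i Fin.≟ o) (ne ∘ sym))))
               (trans (cong (toℕ ∘ value) (dec-enc (i , opt (σ i)))) (cong toℕ (value-σ i))))
        (cong₂ _+_ (FSum-zero λ c → cong (toℕ ∘ value) (dec-enc (i , copy c)))
                   (FSum-zero λ e → cong (toℕ ∘ value) (dec-enc (i , clause e))))) refl

  -- Every positive term loses 1, so the sum drops unless all terms vanish.
  FSum-pred : ∀ {n} (a : Fin n → ℕ) → suc (FSum (λ o → a o ∸ 1)) ≤ FSum a ⊎ (∀ o → a o ≡ 0)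
  FSum-pred {zero}  a = inj₂ λ ()
  FSum-pred {suc n} a with a zero in eq | FSum-pred (a ∘ suc)
  ... | zero  | inj₁ p = inj₁ p
  ... | zero  | inj₂ z = inj₂ λ { zero → eq ; (suc o) → z o }
  ... | suc m | inj₁ p = inj₁ (s≤s (+-monoʳ-≤ m (<⇒≤ p)))
  ... | suc m | inj₂ z = inj₁ (s≤s (+-monoʳ-≤ m (≤-reflexive
    (trans (FSum-zero λ o → cong (_∸ 1) (z o)) (sym (FSum-zero z))))))

  -- Two positive terms would each lose 1, leaving at most 2 of the total 4; so a sum of 3 after the
  -- loss admits a single positive term.
  FSum-unique : ∀ {n} (a : Fin n → ℕ) → 3 ≤ FSum (λ o → a o ∸ 1) → FSum a ≤ 4 →
                ∃[ o ] ∀ p → p ≢ o → a p ≡ 0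
  FSum-unique {suc n} a lo hi with a zero in eq
  ... | zero = let o , h = FSum-unique (a ∘ suc) lo hi
               in suc o , λ { zero _ → eq ; (suc p) ne → h p (ne ∘ cong suc) }
  ... | suc m with FSum-pred (a ∘ suc)
  ...   | inj₂ z = zero , λ { zero ne → ⊥-elim (ne refl) ; (suc p) _ → z p }
  ...   | inj₁ p = ⊥-elim (<-irrefl refl (≤-trans (s≤s (s≤s lo)) (≤-trans (≤-reflexive (cong suc (sym (+-suc m _))))
                     (≤-trans (s≤s (+-monoʳ-≤ m p)) hi))))

  module _ (h : Vertex → Fin 5) (rdf : Is3RDF graph h) (light : weight graph h ≤ N * 4) where

    private
      g : Vert → ℕ
      g v = toℕ (h (enc v))

      options copies clauses block : Fin N → ℕ
      options i = FSum (λ o → g (i , opt o))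
      copies  i = FSum (λ c → g (i , copy c))
      clauses i = FSum (λ e → g (i , clause e))
      block   i = options i + (copies i + clauses i)

      excess-vert : ∀ v → excess graph h (enc v) ≡
        FSum (λ i → FSum (λ o → b2n (A v (i , opt o)) * (g (i , opt o) ∸ 1))
          + (FSum (λ c → b2n (A v (i , copy c)) * (g (i , copy c) ∸ 1))
             + FSum (λ e → b2n (A v (i , clause e)) * (g (i , clause e) ∸ 1))))
      excess-vert v = trans (FSum-vert (λ w → b2n (A (dec (enc v)) (dec w)) * (toℕ (h w) ∸ 1)))
        (FSum-cong λ i → cong₂ _+_ (FSum-cong λ o → A≡ (i , opt o))
          (cong₂ _+_ (FSum-cong λ c → A≡ (i , copy c)) (FSum-cong λ e → A≡ (i , clause e))))
        where
        A≡ : ∀ w → b2n (A (dec (enc v)) (dec (enc w))) * (g w ∸ 1) ≡ b2n (A v w) * (g w ∸ 1)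
        A≡ w = cong₂ (λ v w′ → b2n (A v w′) * (g w ∸ 1)) (dec-enc v) (dec-enc w)

      dominates : ∀ v → g v ≡ 0 → 3 ≤ excess graph h (enc v)
      dominates v z = subst (λ n → 3 ≤ n + excess graph h (enc v)) z
        (Equivalence.to (3rdf⇔dominates graph h) rdf (enc v) (subst (_< 3) (sym z) (s≤s z≤n)))

      copy-excess : ∀ i c → excess graph h (enc (i , copy c)) ≡ FSum (λ o → g (i , opt o) ∸ 1)
      copy-excess i c = trans (excess-vert (i , copy c)) (trans (FSum-single _ i other)
        (trans (cong₂ _+_ (FSum-cong λ o → trans (cong (λ b → b2n b * (g (i , opt o) ∸ 1)) (dec-true (i Fin.≟ i) refl)) (+-identityʳ _))
                          (cong₂ _+_ (FSum-zero {5} λ _ → refl) (FSum-zero {E} λ _ → refl)))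
               (+-identityʳ _)))
        where
        other : ∀ j → j ≢ i → _ ≡ 0
        other j ne = cong₂ _+_ (FSum-zero λ o → cong (λ b → b2n b * (g (j , opt o) ∸ 1)) (dec-false (j Fin.≟ i) ne))
                               (cong₂ _+_ (FSum-zero {5} λ _ → refl) (FSum-zero {E} λ _ → refl))

      -- The reason for five copies: if none had label 0, they alone would outweigh the 4 available
      -- to a group.
      free-copy : ∀ i → (∃[ c ] g (i , copy c) ≡ 0) ⊎ 5 ≤ copies i
      free-copy i with Fin.any? (λ c → g (i , copy c) ≟ 0)
      ... | yes p = inj₁ p
      ... | no ¬p = inj₂ (FSum-mono {5} {λ _ → 1} λ c → n≢0⇒n>0 (λ z → ¬p (c , z)))

      options-excess : ∀ i → (∃[ c ] g (i , copy c) ≡ 0) → 3 ≤ FSum (λ o → g (i , opt o) ∸ 1)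
      options-excess i (c , z) = subst (3 ≤_) (copy-excess i c) (dominates (i , copy c) z)

      options-heavy : ∀ i → 3 ≤ FSum (λ o → g (i , opt o) ∸ 1) → 4 ≤ options i
      options-heavy i lo with FSum-pred (λ o → g (i , opt o))
      ... | inj₁ p = ≤-trans (s≤s lo) p
      ... | inj₂ z = case subst (3 ≤_) (FSum-zero λ o → cong (_∸ 1) (z o)) lo of λ ()

      copies≤block : ∀ i → copies i ≤ block i
      copies≤block i = ≤-trans (m≤m+n (copies i) (clauses i)) (m≤n+m _ (options i))

      block≥4 : ∀ i → 4 ≤ block i
      block≥4 i with free-copy i
      ... | inj₁ c = ≤-trans (options-heavy i (options-excess i c)) (m≤m+n _ _)
      ... | inj₂ p = ≤-trans (n≤1+n 4) (≤-trans p (copies≤block i))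

      block≡4 : ∀ i → block i ≡ 4
      block≡4 = FSum-tight block 4 block≥4
        (subst (_≤ N * 4) (trans (weight-FSum graph h) (FSum-vert (toℕ ∘ h))) light)

      heavy-options : ∀ i → 3 ≤ FSum (λ o → g (i , opt o) ∸ 1)
      heavy-options i with free-copy i
      ... | inj₁ c = options-excess i c
      ... | inj₂ p = ⊥-elim (<-irrefl refl (≤-trans p (≤-trans (copies≤block i) (≤-reflexive (block≡4 i)))))

      chosen : ∀ i → ∃[ o ] ∀ p → p ≢ o → g (i , opt p) ≡ 0
      chosen i = FSum-unique (λ o → g (i , opt o)) (heavy-options i)
                   (≤-trans (m≤m+n _ _) (≤-reflexive (block≡4 i)))

      -- The options already take the whole weight 4 of their group.
      clause-zero : ∀ i e → g (i , clause e) ≡ 0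
      clause-zero i e = n≤0⇒n≡0 (≤-trans (FSum-term (λ e → g (i , clause e)) e) (≤-trans (m≤n+m _ (copies i))
        (+-cancelˡ-≤ 4 _ _ (≤-trans (+-monoˡ-≤ _ (options-heavy i (heavy-options i))) (≤-reflexive (block≡4 i))))))

    assignment : Fin N → Fin D
    assignment i = proj₁ (chosen i)

    assignment-satisfies : Satisfies assignment
    assignment-satisfies i e =
      let w , p = FSum-any _ (≤-trans (s≤s z≤n) (dominates (i , clause e) (clause-zero i e)))
      in literal (dec w) (subst (λ v → 0 < b2n (A v (dec w)) * (toℕ (h w) ∸ 1)) (dec-enc (i , clause e)) p
                          |> subst (λ u → 0 < b2n (A (i , clause e) (dec w)) * (toℕ (h u) ∸ 1)) (sym (enc-dec w)))
      where
      literal : ∀ v → 0 < b2n (A (i , clause e) v) * (g v ∸ 1) → ∃[ j ] mem i e j (assignment j) ≡ true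
      literal (j , opt o) p with mem i e j o in m | o Fin.≟ assignment j
      ... | true | yes refl = j , m
      ... | true | no ne    = case subst (λ n → 0 < (n ∸ 1) + 0) (proj₂ (chosen j) o ne) p of λ ()

-- The tableau of a computation

≡ᵇ-refl : ∀ n → (n ≡ᵇ n) ≡ true
≡ᵇ-refl zero    = refl
≡ᵇ-refl (suc n) = ≡ᵇ-refl n

module _ {m : ℕ} where

  nthS : List (Symbol m) → ℕ → Symbol m
  nthS []       _       = blank
  nthS (s ∷ ss) zero    = s
  nthS (s ∷ ss) (suc i) = nthS ss i

  -- The tape read from left to right, with the head at index W.
  cellAt : ℕ → Tape m → ℕ → Symbol m
  cellAt zero    (tape l s r) j       = nthS (s ∷ r) j
  cellAt (suc W) t            zero    = nthS (Tape.before t) W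
  cellAt (suc W) t            (suc j) = cellAt W t j

  cellAt-right : ∀ W t j → cellAt W (move right t) j ≡ cellAt W t (suc j)
  cellAt-right zero          (tape l s [])      zero    = refl
  cellAt-right zero          (tape l s [])      (suc j) = refl
  cellAt-right zero          (tape l s (_ ∷ _)) j       = refl
  cellAt-right (suc zero)    (tape l s [])      zero    = refl
  cellAt-right (suc zero)    (tape l s (_ ∷ _)) zero    = refl
  cellAt-right (suc (suc W)) (tape l s [])      zero    = refl
  cellAt-right (suc (suc W)) (tape l s (_ ∷ _)) zero    = refl
  cellAt-right (suc W)       t                  (suc j) = cellAt-right W t j

  cellAt-left : ∀ W t j → cellAt W (move left t) (suc j) ≡ cellAt W t j
  cellAt-left zero          (tape []      s r) j       = refl
  cellAt-left zero          (tape (_ ∷ _) s r) j       = refl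
  cellAt-left (suc zero)    (tape []      s r) zero    = refl
  cellAt-left (suc zero)    (tape (_ ∷ _) s r) zero    = refl
  cellAt-left (suc (suc W)) (tape []      s r) zero    = refl
  cellAt-left (suc (suc W)) (tape (_ ∷ _) s r) zero    = refl
  cellAt-left (suc W)       t                  (suc j) = cellAt-left W t j

  cellAt-write : ∀ W l s s′ r j → cellAt W (tape l s r) j ≡ (if j ≡ᵇ W then s else cellAt W (tape l s′ r) j)
  cellAt-write zero    l s s′ r zero    = refl
  cellAt-write zero    l s s′ r (suc j) = refl
  cellAt-write (suc W) l s s′ r zero    = refl
  cellAt-write (suc W) l s s′ r (suc j) = cellAt-write W l s s′ r j

  cellAt-head : ∀ W t → cellAt W t W ≡ Tape.head t
  cellAt-head zero    t = refl
  cellAt-head (suc W) t = cellAt-head W t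

  cellAt-before : ∀ W ss {j} → j < W → cellAt W (fromList ss) j ≡ blank
  cellAt-before (suc W) []       {zero}  _         = refl
  cellAt-before (suc W) (_ ∷ _)  {zero}  _         = refl
  cellAt-before (suc W) ss       {suc j} (s≤s j<W) = cellAt-before W ss j<W

  cellAt-from : ∀ W ss i → cellAt W (fromList ss) (W + i) ≡ nthS ss i
  cellAt-from zero    []       zero    = refl
  cellAt-from zero    []       (suc i) = refl
  cellAt-from zero    (_ ∷ _)  i       = refl
  cellAt-from (suc W) ss       i       = cellAt-from W ss i

  -- The cell at position p of {elsewhere, left, under, right of the head} is
  -- overwritten when the head makes move d.
  hit : Fin 4 → Move → Bool
  hit (suc zero)             left  = true
  hit (suc (suc zero))       stay  = true
  hit (suc (suc (suc zero))) right = true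
  hit _                      _     = false

  -- The cell just written ends up at `suc W` after a left move, at `W` after none, and one column
  -- before `W` after a right move.
  place : ℕ → ℕ → Fin 4
  place W j = if j ≡ᵇ suc W then suc zero else
              if j ≡ᵇ W     then suc (suc zero) else
              if suc j ≡ᵇ W then suc (suc (suc zero)) else zero

  -- The head stays in its column and the contents shift against the move: `a`, `b`, `d` are the old
  -- symbols one column to the left, in the column itself and one to the right.
  nextSym : Fin 4 → Symbol m × Move → Symbol m → Symbol m → Symbol m → Symbol m
  nextSym p (s , left)  a b d = if hit p left  then s else a
  nextSym p (s , stay)  a b d = if hit p stay  then s else b
  nextSym p (s , right) a b d = if hit p right then s else d

  -- The three tests exclude one another, so the order in which `place` tries them does not matter.
  hit-place : ∀ W j → hit (place W j) left ≡ (j ≡ᵇ suc W)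
                    × hit (place W j) stay ≡ (j ≡ᵇ W)
                    × hit (place W j) right ≡ (suc j ≡ᵇ W)
  hit-place W j with j ≡ᵇ suc W in p | j ≡ᵇ W in q | suc j ≡ᵇ W in r
  ... | false | false | false = refl , refl , refl
  ... | false | false | true  = refl , refl , refl
  ... | false | true  | false = refl , refl , refl
  ... | true  | false | false = refl , refl , refl
  ... | true  | true  | _     = ⊥-elim (1+n≢n {W} (trans (sym (≡ᵇ⇒≡ j _ (subst T (sym p) _))) (≡ᵇ⇒≡ j _ (subst T (sym q) _))))
  ... | true  | false | true  = ⊥-elim (m+1+n≢m W (trans (+-suc W 1) (trans (cong suc (+-comm W 1)) (trans (cong suc (sym (≡ᵇ⇒≡ j _ (subst T (sym p) _)))) (≡ᵇ⇒≡ (suc j) _ (subst T (sym r) _))))))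
  ... | false | true  | true  = ⊥-elim (1+n≢n {j} (trans (≡ᵇ⇒≡ (suc j) W (subst T (sym r) _)) (sym (≡ᵇ⇒≡ j _ (subst T (sym q) _)))))

  cellAt-act : ∀ W a t j → cellAt W (act a t) (suc j) ≡
               nextSym (place W (suc j)) a (cellAt W t j) (cellAt W t (suc j)) (cellAt W t (suc (suc j)))
  cellAt-act W (s , left)  (tape l s′ r) j rewrite proj₁ (hit-place W (suc j)) =
    trans (cellAt-left W (tape l s r) j) (cellAt-write W l s s′ r j)
  cellAt-act W (s , stay)  (tape l s′ r) j rewrite proj₁ (proj₂ (hit-place W (suc j))) =
    cellAt-write W l s s′ r (suc j)
  cellAt-act W (s , right) (tape l s′ r) j rewrite proj₂ (proj₂ (hit-place W (suc j))) =
    trans (cellAt-right W (tape l s r) (suc j)) (cellAt-write W l s s′ r (suc (suc j)))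

  symEnc : Symbol m → Fin (3 + m)
  symEnc blank       = zero
  symEnc (bit false) = suc zero
  symEnc (bit true)  = suc (suc zero)
  symEnc (work i)    = suc (suc (suc i))

  symDec : Fin (3 + m) → Symbol m
  symDec zero                = blank
  symDec (suc zero)          = bit false
  symDec (suc (suc zero))    = bit true
  symDec (suc (suc (suc i))) = work i

  symDec-enc : ∀ s → symDec (symEnc s) ≡ s
  symDec-enc blank       = refl
  symDec-enc (bit false) = refl
  symDec-enc (bit true)  = refl
  symDec-enc (work i)    = refl

  nthS-++ˡ : ∀ (u v : Word) {i} → i < length u → nthS (map bit (u ++ v)) i ≡ bit (nth u i)
  nthS-++ˡ (b ∷ u) v {zero}  _         = refl
  nthS-++ˡ (b ∷ u) v {suc i} (s≤s i<n) = nthS-++ˡ u v i<n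

  nthS-++ʳ : ∀ (u v : Word) i → nthS (map bit (u ++ v)) (length u + i) ≡ nthS (map bit v) i
  nthS-++ʳ []      v i = refl
  nthS-++ʳ (b ∷ u) v i = nthS-++ʳ u v i

  nthS-end : ∀ (u : Word) {i} → length u ≤ i → nthS (map bit u) i ≡ blank
  nthS-end []      _         = refl
  nthS-end (b ∷ u) (s≤s n≤i) = nthS-end u n≤i

  nthS-in : ∀ (u : Word) {i} → i < length u → nthS (map bit u) i ≡ bit (nth u i)
  nthS-in (b ∷ u) {zero}  _         = refl
  nthS-in (b ∷ u) {suc i} (s≤s i<n) = nthS-in u i<n

nth-replicate : ∀ n {i} → i < n → nth (replicate n true) i ≡ true
nth-replicate (suc n) {zero}  _         = refl
nth-replicate (suc n) {suc i} (s≤s i<n) = nth-replicate n i<n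

length-unary : ∀ n → length (unary n) ≡ suc n
length-unary n = trans (length-++ (replicate n true)) (trans (cong (_+ 1) (length-replicate n)) (+-comm n 1))

length-pair : ∀ x y → length (pair x y) ≡ suc (length x) + (length x + length y)
length-pair x y = trans (length-++ (unary (length x))) (cong₂ _+_ (length-unary (length x)) (length-++ x))

module _ {m : ℕ} (x y : Word) where
  private
    ℓ = length x
    S : ℕ → Symbol m
    S = nthS (map bit (pair x y))

  pair-header : ∀ {i} → i < ℓ → S i ≡ bit true
  pair-header {i} i<ℓ = trans (cong (λ w → nthS (map bit w) i) (++-assoc (replicate ℓ true) [ false ] (x ++ y)))
    (trans (nthS-++ˡ (replicate ℓ true) _ (subst (i <_) (sym (length-replicate ℓ)) i<ℓ)) (cong bit (nth-replicate ℓ i<ℓ)))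

  pair-separator : S ℓ ≡ bit false
  pair-separator = trans (cong₂ (λ w i → nthS (map bit w) i) (++-assoc (replicate ℓ true) [ false ] (x ++ y))
                            (sym (trans (+-identityʳ _) (length-replicate ℓ))))
                         (nthS-++ʳ (replicate ℓ true) (false ∷ x ++ y) 0)

  pair-first : ∀ {i} → i < ℓ → S (suc ℓ + i) ≡ bit (nth x i)
  pair-first {i} i<ℓ = trans (cong (λ n → S (n + i)) (sym (length-unary ℓ)))
    (trans (nthS-++ʳ (unary ℓ) (x ++ y) i) (nthS-++ˡ x y i<ℓ))

  pair-second : ∀ i → S (suc ℓ + (ℓ + i)) ≡ nthS (map bit y) i
  pair-second i = trans (cong (λ n → S (n + (ℓ + i))) (sym (length-unary ℓ)))
    (trans (nthS-++ʳ (unary ℓ) (x ++ y) (ℓ + i)) (nthS-++ʳ x y i))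

module Tableau (M : TM) where
  open TM M

  Cell : Set
  Cell = State × Vec Sym tapes

  -- Every cell of a row carries the state, so one local rule updates state and symbols together.
  cell : ℕ → Config → ℕ → Cell
  cell W (q , ts) j = q , Vec.map (λ t → cellAt W t j) ts

  nextCell : Fin 4 → Cell → Cell → Cell → Cell → Cell
  nextCell p (q , hs) a b d = maybe′
    (λ (q′ , as) → q′ , Vec.tabulate λ τ → nextSym p (lookup as τ) (lookup (proj₂ a) τ) (lookup (proj₂ b) τ) (lookup (proj₂ d) τ))
    b (δ q hs)

  nextCell-cong : ∀ p {c c′ a a′ b b′ d d′} → c ≡ c′ → a ≡ a′ → b ≡ b′ → d ≡ d′ →
                  nextCell p c a b d ≡ nextCell p c′ a′ b′ d′
  nextCell-cong p refl refl refl refl = refl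

  -- A halted configuration repeats itself, so that a table with a fixed number of rows fits runs of
  -- any shorter length.
  advance : Config → Config
  advance c = fromMaybe c (step c)

  cell-advance : ∀ W c j → cell W (advance c) (suc j) ≡
                 nextCell (place {workSymbols} W (suc j)) (cell W c W) (cell W c j) (cell W c (suc j)) (cell W c (suc (suc j)))
  cell-advance W (q , ts) j
    rewrite Vec.map-cong (cellAt-head W) ts
    with δ q (Vec.map Tape.head ts)
  ... | nothing        = refl
  ... | just (q′ , as) = cong (q′ ,_) (trans (sym (Vec.tabulate∘lookup _)) (Vec.tabulate-cong λ τ → begin
    lookup (Vec.map (λ t → cellAt W t (suc j)) (Vec.zipWith act as ts)) τ
      ≡⟨ Vec.lookup-map τ _ (Vec.zipWith act as ts) ⟩
    cellAt W (lookup (Vec.zipWith act as ts) τ) (suc j)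
      ≡⟨ cong (λ t → cellAt W t (suc j)) (Vec.lookup-zipWith act τ as ts) ⟩
    cellAt W (act (lookup as τ) (lookup ts τ)) (suc j)
      ≡⟨ cellAt-act W (lookup as τ) (lookup ts τ) j ⟩
    nextSym p (lookup as τ) (cellAt W (lookup ts τ) j) (cellAt W (lookup ts τ) (suc j)) (cellAt W (lookup ts τ) (suc (suc j)))
      ≡⟨ cong₂ (λ a b → nextSym p (lookup as τ) a b (cellAt W (lookup ts τ) (suc (suc j)))) (at τ j) (at τ (suc j)) ⟩
    nextSym p (lookup as τ) _ _ (cellAt W (lookup ts τ) (suc (suc j)))
      ≡⟨ cong (nextSym p (lookup as τ) _ _) (at τ (suc (suc j))) ⟩
    nextSym p (lookup as τ) _ _ _ ∎))
    where
    open ≡-Reasoning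
    p = place {workSymbols} W (suc j)
    at : ∀ τ j → cellAt W (lookup ts τ) j ≡ lookup (Vec.map (λ t → cellAt W t j) ts) τ
    at τ j = sym (Vec.lookup-map τ _ ts)

  conf : Word → ℕ → Config
  conf w zero    = initial w
  conf w (suc t) = advance (conf w t)

  iterate : ℕ → Config → Config
  iterate zero    c = c
  iterate (suc t) c = iterate t (advance c)

  iterate-halted : ∀ t {c} → step c ≡ nothing → iterate t c ≡ c
  iterate-halted zero        e = refl
  iterate-halted (suc t) {c} e rewrite e = iterate-halted t e

  halts⇒iterate : ∀ {t c d} T → t ≤ T → HaltsIn t c d → iterate T c ≡ d
  halts⇒iterate T       _         (halt e)   = iterate-halted T e
  halts⇒iterate (suc T) (s≤s t≤T) (next {c = c} e r) rewrite e = halts⇒iterate T t≤T r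

  conf-iterate : ∀ w t s → iterate t (conf w s) ≡ conf w (s + t)
  conf-iterate w zero    s = cong (conf w) (sym (+-identityʳ s))
  conf-iterate w (suc t) s = trans (conf-iterate w t (suc s)) (cong (conf w) (sym (+-suc s t)))

  abstract

    -- The number of possible cell contents: a state and one symbol per tape. It is independent of
    -- the input, so clauses can enumerate contents.
    D : ℕ
    D = states * (3 + workSymbols) ^ tapes

    enc : Cell → Fin D
    enc (q , hs) = combine q (funToFin (symEnc ∘ lookup hs))

    dec : Fin D → Cell
    dec o = let q , f = remQuot ((3 + workSymbols) ^ tapes) o in q , Vec.tabulate (symDec ∘ finToFun f)

    dec-enc : ∀ c → dec (enc c) ≡ c
    dec-enc (q , hs) = trans
      (cong (λ (q , f) → q , Vec.tabulate (symDec ∘ finToFun f)) (Fin.remQuot-combine q (funToFin (symEnc ∘ lookup hs))))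
      (cong (q ,_) (trans (Vec.tabulate-cong λ τ →
        trans (cong symDec (Fin.finToFun-funToFin (symEnc ∘ lookup hs) τ)) (symDec-enc (lookup hs τ)))
        (Vec.tabulate∘lookup hs)))

  empty-cells : ∀ W j → cellAt W (fromList {workSymbols} []) j ≡ blank
  empty-cells zero    zero    = refl
  empty-cells zero    (suc j) = refl
  empty-cells (suc W) zero    = refl
  empty-cells (suc W) (suc j) = empty-cells W j

  work-blank : ∀ W j τ → lookup (Vec.map (λ t → cellAt W t j) (Vec.replicate workTapes (fromList []))) τ ≡ blank
  work-blank W j τ = trans (Vec.lookup-map τ _ (Vec.replicate workTapes (fromList [])))
    (trans (cong (λ t → cellAt W t j) (Vec.lookup-replicate τ (fromList []))) (empty-cells W j))

  sym₀ : Cell → Sym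
  sym₀ (_ , s ∷ _) = s

  isBinary : Sym → Set
  isBinary s = s ≡ blank ⊎ ∃[ b ] s ≡ bit b

  module _ (x : Word) (W P : ℕ) where
    private ℓ = length x

    -- The layout of `pair x y` from column `W` on, for unknown `y`: the regions of `x` are fixed,
    -- while `P` cells are left free for `y`.
    data InitSym (j : ℕ) (s : Sym) : Set where
      outside   : j < W → s ≡ blank → InitSym j s
      header    : ∀ i → i < ℓ → j ≡ W + i → s ≡ bit true → InitSym j s
      separator : j ≡ W + ℓ → s ≡ bit false → InitSym j s
      first     : ∀ i → i < ℓ → j ≡ W + (suc ℓ + i) → s ≡ bit (nth x i) → InitSym j s
      second    : ∀ i → i < P → j ≡ W + (suc ℓ + (ℓ + i)) → isBinary s → InitSym j s
      beyond    : W + (suc ℓ + (ℓ + P)) ≤ j → s ≡ blank → InitSym j s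

    data InitCell (j : ℕ) : Cell → Set where
      init : ∀ {s hs} → InitSym j s → (∀ τ → lookup hs τ ≡ blank) → InitCell j (start , s ∷ hs)

    init-sym₀ : ∀ {j c} → InitCell j c → InitSym j (sym₀ c)
    init-sym₀ (init q _) = q

    record Valid (T J : ℕ) (R : ℕ → ℕ → Fin D) : Set where
      field
        v-init  : ∀ {j} → j < J → InitCell j (dec (R 0 j))
        -- No bit follows a blank here, so the free cells spell a single word padded with blanks.
        v-prop  : ∀ {j} → suc j < J → W + (suc ℓ + ℓ) ≤ j →
                  sym₀ (dec (R 0 j)) ≢ blank ⊎ sym₀ (dec (R 0 (suc j))) ≡ blank
        v-final : sym₀ (dec (R T W)) ≡ bit true
        v-trans : ∀ {t j} → t < T → suc (suc j) < J → R (suc t) (suc j) ≡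
                  enc (nextCell (place {workSymbols} W (suc j)) (dec (R t W)) (dec (R t j)) (dec (R t (suc j))) (dec (R t (suc (suc j)))))

    -- No rule governs the border columns, and arbitrary values there spread inwards by one column
    -- per row. `T<W` and `W+T<J` keep column `W` of row `T` out of their reach; `long` makes room
    -- for the whole input.
    module Sound (T J : ℕ) (R : ℕ → ℕ → Fin D) (T<W : T < W)
                 (W+T<J : W + T < J) (long : W + (suc ℓ + (ℓ + P)) < J) (valid : Valid T J R) where
      open Valid valid

      s : ℕ → Sym
      s i = sym₀ (dec (R 0 (W + (suc ℓ + (ℓ + i)))))

      readBits : (ℕ → Sym) → ℕ → Word
      readBits s zero    = []
      readBits s (suc n) with s 0
      ... | bit b = b ∷ readBits (s ∘ suc) n
      ... | _     = []

      readBits-length : ∀ s n → length (readBits s n) ≤ n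
      readBits-length s zero    = z≤n
      readBits-length s (suc n) with s 0
      ... | bit b  = s≤s (readBits-length (s ∘ suc) n)
      ... | blank  = z≤n
      ... | work _ = z≤n

      -- Reading stops at the first blank; by propagation all later cells are blank, so no bit is
      -- lost.
      readBits-ok : ∀ s n → (∀ i → i < n → isBinary (s i)) → (∀ i → i < n → s i ≢ blank ⊎ s (suc i) ≡ blank) →
                    s n ≡ blank → ∀ i → i ≤ n → nthS (map bit (readBits s n)) i ≡ s i
      readBits-ok s zero    _ _ z zero z≤n = sym z
      readBits-ok s (suc n) b p z i i≤n with s 0 in eq | b 0 (s≤s z≤n)
      readBits-ok s (suc n) b p z zero    i≤n       | bit c | _ = sym eq
      readBits-ok s (suc n) b p z (suc i) (s≤s i≤n) | bit c | _ =
        readBits-ok (s ∘ suc) n (λ i → b (suc i) ∘ s≤s) (λ i → p (suc i) ∘ s≤s) z i i≤n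
      ... | blank | _ = sym (all-blank i i≤n)
        where
        all-blank : ∀ i → i ≤ suc n → s i ≡ blank
        all-blank zero    _    = eq
        all-blank (suc i) i<n  with p i i<n
        ... | inj₁ ne = ⊥-elim (ne (all-blank i (<⇒≤ i<n)))
        ... | inj₂ e  = e
      readBits-ok s (suc n) b p z i i≤n | work _ | inj₂ (_ , ())

      y : Word
      y = readBits s P

      y-length : length y ≤ P
      y-length = readBits-length s P

      position : ∀ {i} → i ≤ P → W + (suc ℓ + (ℓ + i)) < J
      position i≤P = ≤-<-trans (+-monoʳ-≤ W (+-monoʳ-≤ (suc ℓ) (+-monoʳ-≤ ℓ i≤P))) long

      s-init : ∀ i → i ≤ P → InitSym (W + (suc ℓ + (ℓ + i))) (s i)
      s-init i i≤P = init-sym₀ (v-init (position i≤P))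

      s-binary : ∀ i → i < P → isBinary (s i)
      s-binary i i<P with s-init i (<⇒≤ i<P)
      ... | outside _ e      = inj₁ e
      ... | header _ _ _ e   = inj₂ (_ , e)
      ... | separator _ e    = inj₂ (_ , e)
      ... | first _ _ _ e    = inj₂ (_ , e)
      ... | second _ _ _ e   = e
      ... | beyond _ e       = inj₁ e

      s-end : s P ≡ blank
      s-end with s-init P ≤-refl
      ... | outside lt _     = ⊥-elim (m+n≮m W _ lt)
      ... | header i lt e _  = ⊥-elim (<-irrefl (sym (+-cancelˡ-≡ W _ _ e)) (<-≤-trans lt (≤-trans (n≤1+n ℓ) (m≤m+n (suc ℓ) _))))
      ... | separator e _    = ⊥-elim (<-irrefl (sym (+-cancelˡ-≡ W _ _ e)) (m≤m+n (suc ℓ) _))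
      ... | first i lt e _   = ⊥-elim (<-irrefl (sym (+-cancelˡ-≡ (suc ℓ) _ _ (+-cancelˡ-≡ W _ _ e))) (<-≤-trans lt (m≤m+n ℓ P)))
      ... | second i lt e _  = ⊥-elim (<-irrefl (sym (+-cancelˡ-≡ ℓ _ _ (+-cancelˡ-≡ (suc ℓ) _ _ (+-cancelˡ-≡ W _ _ e)))) lt)
      ... | beyond _ e       = e

      s-prop : ∀ i → i < P → s i ≢ blank ⊎ s (suc i) ≡ blank
      s-prop i i<P = subst (λ k → s i ≢ blank ⊎ sym₀ (dec (R 0 k)) ≡ blank) eq
        (v-prop (subst (_< J) (sym eq) (position i<P)) (+-monoʳ-≤ W (+-monoʳ-≤ (suc ℓ) (m≤m+n ℓ i))))
        where
        eq : suc (W + (suc ℓ + (ℓ + i))) ≡ W + (suc ℓ + (ℓ + suc i))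
        eq = trans (sym (+-suc W _)) (cong (W +_) (trans (sym (+-suc (suc ℓ) _)) (cong (suc ℓ +_) (sym (+-suc ℓ i)))))

      y-ok : ∀ i → i ≤ P → nthS (map bit y) i ≡ s i
      y-ok = readBits-ok s P s-binary s-prop s-end

      initial-sym : ∀ {j a} → InitSym j a → (∀ i → i < P → j ≡ W + (suc ℓ + (ℓ + i)) → a ≡ s i) →
                    cellAt W (fromList (map bit (pair x y))) j ≡ a
      initial-sym (outside lt refl)        h = cellAt-before W _ lt
      initial-sym (header i lt refl refl)  h = trans (cellAt-from W _ i) (pair-header x y lt)
      initial-sym (separator refl refl)    h = trans (cellAt-from W _ ℓ) (pair-separator x y)
      initial-sym (first i lt refl refl)   h = trans (cellAt-from W _ (suc ℓ + i)) (pair-first x y lt)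
      initial-sym (second i lt refl b)     h = trans (cellAt-from W _ _) (trans (pair-second x y i)
                                                 (trans (y-ok i (<⇒≤ lt)) (sym (h i lt refl))))
      initial-sym {j} (beyond le refl)     h = begin
        cellAt W (fromList (map bit w)) j             ≡⟨ cong (cellAt W (fromList (map bit w))) (m+[n∸m]≡n (≤-trans (m≤m+n W _) le)) ⟨
        cellAt W (fromList (map bit w)) (W + (j ∸ W)) ≡⟨ cellAt-from W _ (j ∸ W) ⟩
        nthS (map bit w) (j ∸ W)                      ≡⟨ nthS-end w short ⟩
        blank                                         ∎
        where
        open ≡-Reasoning
        w = pair x y
        short : length w ≤ j ∸ W
        short = ≤-trans (≤-reflexive (length-pair x y)) (≤-trans (+-monoʳ-≤ (suc ℓ) (+-monoʳ-≤ ℓ y-length))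
          (≤-trans (≤-reflexive (sym (m+n∸m≡n W _))) (∸-monoˡ-≤ W le)))

      first-row : ∀ {j} → j < J → dec (R 0 j) ≡ cell W (initial (pair x y)) j
      first-row {j} j<J with dec (R 0 j) in eq | v-init j<J
      ... | _ | init {s = a} {hs} q b = cong (start ,_) (cong₂ _∷_
        (sym (initial-sym q λ { i _ refl → cong sym₀ (sym eq) }))
        (trans (sym (Vec.tabulate∘lookup hs)) (trans (Vec.tabulate-cong λ τ → trans (b τ) (sym (work-blank W j τ))) (Vec.tabulate∘lookup _))))

      -- A cell at time t is determined if it is at distance at least t from the border.
      rows : ∀ t → t ≤ T → ∀ j → t ≤ j → j + t < J → dec (R t j) ≡ cell W (conf (pair x y) t) j
      rows zero    _    j       _         lt = first-row (subst (_< J) (+-identityʳ j) lt)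
      rows (suc t) t<T (suc j) (s≤s t≤j) lt = begin
        dec (R (suc t) (suc j))
          ≡⟨ cong dec (v-trans t<T (≤-trans (s≤s (≤-trans (s≤s (s≤s (m≤m+n j t))) (≤-reflexive (cong suc (sym (+-suc j t)))))) lt)) ⟩
        dec (enc (nextCell p (dec (R t W)) (dec (R t j)) (dec (R t (suc j))) (dec (R t (suc (suc j))))))
          ≡⟨ dec-enc _ ⟩
        nextCell p (dec (R t W)) (dec (R t j)) (dec (R t (suc j))) (dec (R t (suc (suc j))))
          ≡⟨ nextCell-cong p
               (rows t (<⇒≤ t<T) W (<⇒≤ (<-trans t<T T<W)) (≤-<-trans (+-monoʳ-≤ W (<⇒≤ t<T)) W+T<J))
               (rows t (<⇒≤ t<T) j t≤j (≤-trans (s≤s (≤-trans (+-monoʳ-≤ j (n≤1+n t)) (n≤1+n _))) lt))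
               (rows t (<⇒≤ t<T) (suc j) (m≤n⇒m≤1+n t≤j) (≤-trans (s≤s (s≤s (+-monoʳ-≤ j (n≤1+n t)))) lt))
               (rows t (<⇒≤ t<T) (suc (suc j)) (m≤n⇒m≤1+n (m≤n⇒m≤1+n t≤j)) (≤-trans (≤-reflexive (cong (2 +_) (sym (+-suc j t)))) lt)) ⟩
        nextCell p (cell W (conf (pair x y) t) W) (cell W (conf (pair x y) t) j)
                   (cell W (conf (pair x y) t) (suc j)) (cell W (conf (pair x y) t) (suc (suc j)))
          ≡⟨ cell-advance W (conf (pair x y) t) j ⟨
        cell W (conf (pair x y) (suc t)) (suc j) ∎
        where
        open ≡-Reasoning
        p = place {workSymbols} W (suc j)

      accepts : Tape.head (Vec.head (proj₂ (conf (pair x y) T))) ≡ bit true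
      accepts with conf (pair x y) T | rows T ≤-refl W (<⇒≤ T<W) W+T<J
      ... | q , t ∷ ts | e = trans (sym (cellAt-head W t)) (trans (sym (cong sym₀ e)) v-final)

    module Complete (T J : ℕ) (y : Word) (|y|≤P : length y ≤ P)
                    (accepted : Tape.head (Vec.head (proj₂ (conf (pair x y) T))) ≡ bit true) where

      R : ℕ → ℕ → Fin D
      R t j = enc (cell W (conf (pair x y) t) j)

      S : ℕ → Sym
      S = nthS (map bit (pair x y))

      second-sym : ∀ n → InitSym (W + (suc ℓ + (ℓ + n))) (S (suc ℓ + (ℓ + n)))
      second-sym n with n <? P | n <? length y
      ... | no n≥P  | _      = beyond (+-monoʳ-≤ W (+-monoʳ-≤ (suc ℓ) (+-monoʳ-≤ ℓ (≮⇒≥ n≥P))))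
                                 (trans (pair-second x y n) (nthS-end y (≤-trans |y|≤P (≮⇒≥ n≥P))))
      ... | yes n<P | yes lt = second n n<P refl (inj₂ (_ , trans (pair-second x y n) (nthS-in y lt)))
      ... | yes n<P | no ge  = second n n<P refl (inj₁ (trans (pair-second x y n) (nthS-end y (≮⇒≥ ge))))

      first-sym : ∀ k → InitSym (W + (suc ℓ + k)) (S (suc ℓ + k))
      first-sym k with k <? ℓ
      ... | yes k<ℓ = first k k<ℓ refl (pair-first x y k<ℓ)
      ... | no k≥ℓ  = let n , e = m≤n⇒∃[o]m+o≡n (≮⇒≥ k≥ℓ)
                      in subst (λ k → InitSym (W + (suc ℓ + k)) (S (suc ℓ + k))) e (second-sym n)

      input-sym : ∀ i → InitSym (W + i) (S i)
      input-sym i with <-cmp i ℓ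
      ... | tri< lt _ _   = header i lt refl (pair-header x y lt)
      ... | tri≈ _ refl _ = separator refl (pair-separator x y)
      ... | tri> _ _ gt   = let k , e = m≤n⇒∃[o]m+o≡n gt
                            in subst (λ i → InitSym (W + i) (S i)) e (first-sym k)

      init-sym : ∀ j → InitSym j (cellAt W (fromList (map bit (pair x y))) j)
      init-sym j with j <? W
      ... | yes lt = outside lt (cellAt-before W _ lt)
      ... | no ge  = let i , e = m≤n⇒∃[o]m+o≡n (≮⇒≥ ge)
                     in subst (λ j → InitSym j (cellAt W (fromList (map bit (pair x y))) j)) e
                          (subst (InitSym (W + i)) (sym (cellAt-from W _ i)) (input-sym i))

      valid : Valid T J R
      valid = record
        { v-init  = λ {j} _ → subst (InitCell j) (sym (dec-enc (cell W (initial (pair x y)) j)))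
            (init (init-sym j) (work-blank W j))
        ; v-prop  = λ {j} _ le → Sum.map
            (λ ne e → ne (trans (sym (cong sym₀ (dec-enc (cell W (initial (pair x y)) j)))) e))
            (λ e → trans (cong sym₀ (dec-enc (cell W (initial (pair x y)) (suc j)))) e)
            (prop j le)
        ; v-final = trans (cong sym₀ (dec-enc (cell W (conf (pair x y) T) W))) (centre (conf (pair x y) T) accepted)
        ; v-trans = λ {t} {j} _ _ → cong enc (trans (cell-advance W (conf (pair x y) t) j)
            (nextCell-cong (place {workSymbols} W (suc j))
              (sym (dec-enc (cell W (conf (pair x y) t) W))) (sym (dec-enc (cell W (conf (pair x y) t) j)))
              (sym (dec-enc (cell W (conf (pair x y) t) (suc j)))) (sym (dec-enc (cell W (conf (pair x y) t) (suc (suc j)))))))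
        }
        where
        centre : ∀ c → Tape.head (Vec.head (proj₂ c)) ≡ bit true → sym₀ (cell W c W) ≡ bit true
        centre (q , t ∷ ts) e = trans (cellAt-head W t) e
        C : ℕ → Sym
        C = cellAt W (fromList (map bit (pair x y)))
        prop : ∀ j → W + (suc ℓ + ℓ) ≤ j → C j ≢ blank ⊎ C (suc j) ≡ blank
        prop j le = let n , e = m≤n⇒∃[o]m+o≡n le in subst (λ j → C j ≢ blank ⊎ C (suc j) ≡ blank)
          (trans (cong (W +_) (sym (+-assoc (suc ℓ) ℓ n))) (trans (sym (+-assoc W (suc ℓ + ℓ) n)) e))
          (at n)
          where
          value : ∀ n → C (W + (suc ℓ + (ℓ + n))) ≡ nthS (map bit y) n
          value n = trans (cellAt-from W _ _) (pair-second x y n)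
          shift : ∀ n → W + (suc ℓ + (ℓ + suc n)) ≡ suc (W + (suc ℓ + (ℓ + n)))
          shift n = trans (cong (W +_) (trans (cong (suc ℓ +_) (+-suc ℓ n)) (+-suc (suc ℓ) (ℓ + n)))) (+-suc W _)
          nonblank : ∀ {s b} → s ≡ bit b → s ≢ blank
          nonblank refl ()
          at : ∀ n → C (W + (suc ℓ + (ℓ + n))) ≢ blank ⊎ C (suc (W + (suc ℓ + (ℓ + n)))) ≡ blank
          at n with n <? length y
          ... | yes lt = inj₁ (nonblank (trans (value n) (nthS-in y lt)))
          ... | no ge  = inj₂ (trans (cong C (sym (shift n))) (trans (value (suc n)) (nthS-end y (m≤n⇒m≤1+n (≮⇒≥ ge)))))

-- Encodings of graphs

Cat-cong : ∀ n {f g : ℕ → Word} → (∀ i → i < n → f i ≡ g i) → Cat n f ≡ Cat n g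
Cat-cong zero    h = refl
Cat-cong (suc n) h = cong₂ _++_ (Cat-cong n λ i i<n → h i (m≤n⇒m≤1+n i<n)) (h n ≤-refl)

Cat-suc : ∀ n f → Cat (suc n) f ≡ f 0 ++ Cat n (f ∘ suc)
Cat-suc zero    f = sym (++-identityʳ (f 0))
Cat-suc (suc n) f = trans (cong (_++ f (suc n)) (Cat-suc n f)) (++-assoc (f 0) (Cat n (f ∘ suc)) (f (suc n)))

Cat-length : ∀ n f {k} → (∀ i → i < n → length (f i) ≡ k) → length (Cat n f) ≡ n * k
Cat-length zero    f h = refl
Cat-length (suc n) f {k} h = trans (length-++ (Cat n f))
  (trans (cong₂ _+_ (Cat-length n f λ i i<n → h i (m≤n⇒m≤1+n i<n)) (h n ≤-refl)) (+-comm (n * k) k))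

Cat-replicate : ∀ n → Cat n (λ _ → [ true ]) ≡ replicate n true
Cat-replicate zero    = refl
Cat-replicate (suc n) = trans (Cat-suc n _) (cong (true ∷_) (Cat-replicate n))

concatMap-tabulate : ∀ n {A : Set} (g : A → Word) (f : ℕ → Word) (e : Fin n → A) → (∀ i → g (e i) ≡ f (toℕ i)) →
                     concatMap g (tabulate e) ≡ Cat n f
concatMap-tabulate zero    g f e h = refl
concatMap-tabulate (suc n) g f e h = trans
  (cong₂ _++_ (h zero) (concatMap-tabulate n g (f ∘ suc) (e ∘ suc) (h ∘ suc))) (sym (Cat-suc n f))

map-tabulate-Cat : ∀ n {A : Set} (g : A → Bool) (f : ℕ → Bool) (e : Fin n → A) → (∀ i → g (e i) ≡ f (toℕ i)) →
                   map g (tabulate e) ≡ Cat n (λ i → [ f i ])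
map-tabulate-Cat zero    g f e h = refl
map-tabulate-Cat (suc n) g f e h = trans
  (cong₂ _∷_ (h zero) (map-tabulate-Cat n g (f ∘ suc) (e ∘ suc) (h ∘ suc))) (sym (Cat-suc n _))

matrix-Cat : ∀ Γ (A : ℕ → ℕ → Bool) → (∀ u v → Graph.adj Γ u v ≡ A (toℕ u) (toℕ v)) →
             Graph.matrix Γ ≡ Cat (Graph.order Γ) (λ u → Cat (Graph.order Γ) (λ v → [ A u v ]))
matrix-Cat Γ A h = concatMap-tabulate order _ _ id λ u → map-tabulate-Cat order (adj u) (A (toℕ u)) id (h u)
  where open Graph Γ

nth-++ˡ : ∀ (u v : Word) {i} → i < length u → nth (u ++ v) i ≡ nth u i
nth-++ˡ (b ∷ u) v {zero}  _         = refl
nth-++ˡ (b ∷ u) v {suc i} (s≤s i<n) = nth-++ˡ u v i<n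

nth-++ʳ : ∀ (u v : Word) i → nth (u ++ v) (length u + i) ≡ nth v i
nth-++ʳ []      v i = refl
nth-++ʳ (b ∷ u) v i = nth-++ʳ u v i

nth-ext : ∀ {u v : Word} → length u ≡ length v → (∀ i → i < length u → nth u i ≡ nth v i) → u ≡ v
nth-ext {[]}    {[]}    _ h = refl
nth-ext {b ∷ u} {c ∷ v} e h = cong₂ _∷_ (h 0 (s≤s z≤n)) (nth-ext (suc-injective e) λ i i<n → h (suc i) (s≤s i<n))

nth-Cat : ∀ n f {k} → (∀ i → i < n → length (f i) ≡ k) → ∀ {u v} → u < n → v < k → nth (Cat n f) (k * u + v) ≡ nth (f u) v
nth-Cat (suc n) f {k} h {zero} {v} _ v<k =
  trans (cong₂ nth (Cat-suc n f) (cong (_+ v) (*-zeroʳ k)))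
        (nth-++ˡ (f 0) _ (subst (v <_) (sym (h 0 (s≤s z≤n))) v<k))
nth-Cat (suc n) f {k} h {suc u} {v} (s≤s u<n) v<k = begin
  nth (Cat (suc n) f) (k * suc u + v)                        ≡⟨ cong₂ nth (Cat-suc n f) position ⟩
  nth (f 0 ++ Cat n (f ∘ suc)) (length (f 0) + (k * u + v))  ≡⟨ nth-++ʳ (f 0) _ _ ⟩
  nth (Cat n (f ∘ suc)) (k * u + v)                          ≡⟨ nth-Cat n (f ∘ suc) (λ i i<n → h (suc i) (s≤s i<n)) u<n v<k ⟩
  nth (f (suc u)) v                                          ∎
  where
  open ≡-Reasoning
  position : k * suc u + v ≡ length (f 0) + (k * u + v)
  position = trans (cong (_+ v) (*-suc k u)) (trans (+-assoc k (k * u) v) (cong (_+ (k * u + v)) (sym (h 0 (s≤s z≤n)))))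

length-bits : ∀ n (f : ℕ → Bool) → length (Cat n (λ i → [ f i ])) ≡ n
length-bits n f = trans (Cat-length n _ λ _ _ → refl) (*-identityʳ n)

nth-bits : ∀ n (f : ℕ → Bool) {i} → i < n → nth (Cat n (λ i → [ f i ])) i ≡ f i
nth-bits n f {i} i<n = trans (cong (nth (Cat n (λ i → [ f i ]))) (sym (trans (+-identityʳ _) (*-identityˡ i))))
                             (nth-Cat n (λ i → [ f i ]) {1} (λ _ _ → refl) i<n (s≤s z≤n))

matrix-length : ∀ Γ → length (Graph.matrix Γ) ≡ Graph.order Γ * Graph.order Γ
matrix-length Γ = go order id
  where
  open Graph Γ
  go : ∀ n (e : Fin n → Vertex) → length (concatMap (λ u → map (adj u) (allFin order)) (tabulate e)) ≡ n * order
  go zero    e = refl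
  go (suc n) e = trans (length-++ (map (adj (e zero)) (allFin order)))
    (cong₂ _+_ (trans (length-map (adj (e zero)) (allFin order)) (length-tabulate id)) (go n (e ∘ suc)))

nth-row : ∀ n {A : Set} (g : A → Bool) (e : Fin n → A) i → nth (map g (tabulate e)) (toℕ i) ≡ g (e i)
nth-row (suc n) g e zero    = refl
nth-row (suc n) g e (suc i) = nth-row n g (e ∘ suc) i

matrix-nth : ∀ Γ u v → nth (Graph.matrix Γ) (Graph.order Γ * toℕ u + toℕ v) ≡ Graph.adj Γ u v
matrix-nth Γ u v = go order id u
  where
  open Graph Γ
  open ≡-Reasoning
  row : Vertex → Word
  row u = map (adj u) (allFin order)
  row-length : ∀ u → length (row u) ≡ order
  row-length u = trans (length-map (adj u) (allFin order)) (length-tabulate id)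
  go : ∀ n (e : Fin n → Vertex) u → nth (concatMap row (tabulate e)) (order * toℕ u + toℕ v) ≡ adj (e u) v
  go (suc n) e zero = begin
    nth (row (e zero) ++ _) (order * 0 + toℕ v) ≡⟨ cong (λ k → nth (row (e zero) ++ concatMap row (tabulate (e ∘ suc))) (k + toℕ v)) (*-zeroʳ order) ⟩
    nth (row (e zero) ++ _) (toℕ v)             ≡⟨ nth-++ˡ (row (e zero)) _ (subst (toℕ v <_) (sym (row-length (e zero))) (Fin.toℕ<n v)) ⟩
    nth (row (e zero)) (toℕ v)                  ≡⟨ nth-row order (adj (e zero)) id v ⟩
    adj (e zero) v                              ∎
  go (suc n) e (suc u) = begin
    nth (row (e zero) ++ rest) (order * suc (toℕ u) + toℕ v)                   ≡⟨ cong (nth (row (e zero) ++ rest)) position ⟩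
    nth (row (e zero) ++ rest) (length (row (e zero)) + (order * toℕ u + toℕ v)) ≡⟨ nth-++ʳ (row (e zero)) rest _ ⟩
    nth rest (order * toℕ u + toℕ v)                                           ≡⟨ go n (e ∘ suc) u ⟩
    adj (e (suc u)) v                                                          ∎
    where
    rest = concatMap row (tabulate (e ∘ suc))
    position : order * suc (toℕ u) + toℕ v ≡ length (row (e zero)) + (order * toℕ u + toℕ v)
    position = trans (cong (_+ toℕ v) (*-suc order (toℕ u))) (trans (+-assoc order _ _) (cong (_+ _) (sym (row-length (e zero)))))

unary-injective : ∀ m n {u v : Word} → unary m ++ u ≡ unary n ++ v → m ≡ n × u ≡ v
unary-injective zero    zero    e = refl , proj₂ (∷-injective e)
unary-injective (suc m) (suc n) e = let p , q = unary-injective m n (proj₂ (∷-injective e)) in cong suc p , q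
unary-injective zero    (suc n) e = case proj₁ (∷-injective e) of λ ()
unary-injective (suc m) zero    e = case proj₁ (∷-injective e) of λ ()

open DecisionProblem TRIPLE-ROM-DOM using (encode; Yes)

-- Equal words need not come from equal instances, as adjacency functions are recorded only by their
-- values. The word does fix the order, `k` and these values, and domination and weight depend on
-- nothing else.
Yes-transfer : ∀ i i′ → encode i ≡ encode i′ → Yes i → Yes i′
Yes-transfer i i′ e (h , r , w)
  with refl , e₁ ← unary-injective (Graph.order (RomanInstance.graph i)) (Graph.order (RomanInstance.graph i′)) e
  with refl , m ← unary-injective (RomanInstance.k i) (RomanInstance.k i′) e₁ =
  h , Equivalence.from (3rdf⇔dominates Γ′ h) (λ v lt → subst (λ n → 3 ≤ toℕ (h v) + n)
        (FSum-cong λ w → cong (λ b → b2n b * (toℕ (h w) ∸ 1))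
          (trans (sym (matrix-nth Γ v w)) (trans (cong (λ z → nth z (Graph.order Γ′ * toℕ v + toℕ w)) m) (matrix-nth Γ′ v w))))
        (Equivalence.to (3rdf⇔dominates Γ h) r v lt))
    , w
  where
  Γ  = RomanInstance.graph i
  Γ′ = RomanInstance.graph i′

-- The reduction

module Reduction (M : TM) (p q : Polynomial) where
  open TM M using (Sym; workSymbols; tapes; start)
  open Tableau M
  open Logic 15

  -- Positive literals cannot express an implication from the contents of four cells. So each
  -- quadruple of contents has its own clause: one of the four cells differs from it, or the new
  -- cell is as the machine prescribes.
  data ClauseType : Set where
    init prop final : ClauseType
    transition      : (c a b d : Fin D) → ClauseType

  E : ℕ
  E = 3 + D * (D * (D * D))

  split₁ : Fin D × Fin (D * (D * D)) → ClauseType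
  split₂ : Fin D → Fin D × Fin (D * D) → ClauseType
  split₃ : Fin D → Fin D → Fin D × Fin D → ClauseType
  split₁ (c , r)     = split₂ c (remQuot {D} (D * D) r)
  split₂ c (a , r)   = split₃ c a (remQuot {D} D r)
  split₃ c a (b , d) = transition c a b d

  toClause : Fin E → ClauseType
  toClause zero                = init
  toClause (suc zero)          = prop
  toClause (suc (suc zero))    = final
  toClause (suc (suc (suc r))) = split₁ (remQuot {D} (D * (D * D)) r)

  fromClause : ClauseType → Fin E
  fromClause init                 = zero
  fromClause prop                 = suc zero
  fromClause final                = suc (suc zero)
  fromClause (transition c a b d) = suc (suc (suc (combine c (combine a (combine b d)))))

  toClause-fromClause : ∀ e → toClause (fromClause e) ≡ e
  toClause-fromClause init                 = refl
  toClause-fromClause prop                 = refl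
  toClause-fromClause final                = refl
  toClause-fromClause (transition c a b d) =
    trans (cong split₁ (Fin.remQuot-combine c (combine a (combine b d))))
    (trans (cong (split₂ c) (Fin.remQuot-combine a (combine b d)))
           (cong (split₃ c a) (Fin.remQuot-combine b d)))

  open Tags D E

  ℓᵛ Pᵛ Tᵛ Wᵛ Jᵛ Nᵛ uᵛ vᵛ aᵛ bᵛ tᵛ jᵛ iᵛ : Fin V
  ℓᵛ = 0F
  Pᵛ = 1F
  Tᵛ = 2F
  Wᵛ = 3F
  Jᵛ = 4F
  Nᵛ = 5F
  uᵛ = 6F
  vᵛ = 7F
  aᵛ = 8F
  bᵛ = 9F
  tᵛ = suc 9F
  jᵛ = suc (suc 9F)
  iᵛ = suc (suc (suc 9F))

  ℓᵗ Pᵗ Tᵗ Wᵗ Jᵗ Nᵗ uᵗ vᵗ aᵗ bᵗ tᵗ jᵗ iᵗ : Tm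
  ℓᵗ = var ℓᵛ
  Pᵗ = var Pᵛ
  Tᵗ = var Tᵛ
  Wᵗ = var Wᵛ
  Jᵗ = var Jᵛ
  Nᵗ = var Nᵛ
  uᵗ = var uᵛ
  vᵗ = var vᵛ
  aᵗ = var aᵛ
  bᵗ = var bᵛ
  tᵗ = var tᵛ
  jᵗ = var jᵛ
  iᵗ = var iᵛ

  sucᵗ : Tm → Tm
  sucᵗ t = con 1 +ᵗ t

  isBlankᵇ : Sym → Bool
  isBlankᵇ blank = true
  isBlankᵇ _     = false

  isBitᵇ : Bool → Sym → Bool
  isBitᵇ true  (bit b) = b
  isBitᵇ false (bit b) = not b
  isBitᵇ _     _       = false

  isBinaryᵇ : Sym → Bool
  isBinaryᵇ (work _) = false
  isBinaryᵇ _        = true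

  allBlankᵇ : ∀ {n} → Vec Sym n → Bool
  allBlankᵇ []       = true
  allBlankᵇ (s ∷ hs) = isBlankᵇ s ∧ allBlankᵇ hs

  initSymᶠ : Sym → Fm
  initSymᶠ s =
      (sucᵗ jᵗ ≤ᶠ Wᵗ ∧ᶠ boolᶠ (isBlankᵇ s))
    ∨ᶠ exᶠ iᵛ ℓᵗ (jᵗ ≡ᶠ Wᵗ +ᵗ iᵗ ∧ᶠ boolᶠ (isBitᵇ true s))
    ∨ᶠ (jᵗ ≡ᶠ Wᵗ +ᵗ ℓᵗ ∧ᶠ boolᶠ (isBitᵇ false s))
    ∨ᶠ exᶠ iᵛ ℓᵗ (jᵗ ≡ᶠ Wᵗ +ᵗ (sucᵗ ℓᵗ +ᵗ iᵗ) ∧ᶠ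
         (bitᶠ iᵗ ∧ᶠ boolᶠ (isBitᵇ true s) ∨ᶠ (¬ᶠ bitᶠ iᵗ) ∧ᶠ boolᶠ (isBitᵇ false s)))
    ∨ᶠ exᶠ iᵛ Pᵗ (jᵗ ≡ᶠ Wᵗ +ᵗ (sucᵗ ℓᵗ +ᵗ (ℓᵗ +ᵗ iᵗ)) ∧ᶠ boolᶠ (isBinaryᵇ s))
    ∨ᶠ (Wᵗ +ᵗ (sucᵗ ℓᵗ +ᵗ (ℓᵗ +ᵗ Pᵗ)) ≤ᶠ jᵗ ∧ᶠ boolᶠ (isBlankᵇ s))

  initᶠ : Cell → Fm
  initᶠ (q , s ∷ hs) = boolᶠ (does (q Fin.≟ start)) ∧ᶠ boolᶠ (allBlankᵇ hs) ∧ᶠ initSymᶠ s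

  -- A transition clause is anchored at the leftmost of its three neighbouring upper cells, so the
  -- cell to be placed is in column `suc j`.
  placeᶠ : Fin 4 → Fm
  placeᶠ zero                   = (¬ᶠ sucᵗ jᵗ ≡ᶠ sucᵗ Wᵗ) ∧ᶠ (¬ᶠ sucᵗ jᵗ ≡ᶠ Wᵗ) ∧ᶠ (¬ᶠ sucᵗ (sucᵗ jᵗ) ≡ᶠ Wᵗ)
  placeᶠ (suc zero)             = sucᵗ jᵗ ≡ᶠ sucᵗ Wᵗ
  placeᶠ (suc (suc zero))       = (¬ᶠ sucᵗ jᵗ ≡ᶠ sucᵗ Wᵗ) ∧ᶠ sucᵗ jᵗ ≡ᶠ Wᵗ
  placeᶠ (suc (suc (suc zero))) = (¬ᶠ sucᵗ jᵗ ≡ᶠ sucᵗ Wᵗ) ∧ᶠ (¬ᶠ sucᵗ jᵗ ≡ᶠ Wᵗ) ∧ᶠ sucᵗ (sucᵗ jᵗ) ≡ᶠ Wᵗ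

  update : Fin 4 → (c a b d : Fin D) → Fin D
  update p c a b d = enc (nextCell p (dec c) (dec a) (dec b) (dec d))

  -- A clause of group a = J t + j speaks about cell j of row t.
  appᶠ : ClauseType → Fm
  appᶠ init            = tᵗ ≡ᶠ con 0
  appᶠ prop            = tᵗ ≡ᶠ con 0 ∧ᶠ Wᵗ +ᵗ (sucᵗ ℓᵗ +ᵗ ℓᵗ) ≤ᶠ jᵗ ∧ᶠ sucᵗ (sucᵗ jᵗ) ≤ᶠ Jᵗ
  appᶠ final           = tᵗ ≡ᶠ Tᵗ ∧ᶠ jᵗ ≡ᶠ Wᵗ
  appᶠ (transition c a b d) = sucᵗ tᵗ ≤ᶠ Tᵗ ∧ᶠ sucᵗ (sucᵗ (sucᵗ jᵗ)) ≤ᶠ Jᵗ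

  litᶠ : ClauseType → Fin D → Fm
  litᶠ init  o = bᵗ ≡ᶠ aᵗ ∧ᶠ initᶠ (dec o)
  litᶠ prop  o = bᵗ ≡ᶠ aᵗ ∧ᶠ boolᶠ (not (isBlankᵇ (sym₀ (dec o))))
               ∨ᶠ bᵗ ≡ᶠ sucᵗ aᵗ ∧ᶠ boolᶠ (isBlankᵇ (sym₀ (dec o)))
  litᶠ final o = bᵗ ≡ᶠ aᵗ ∧ᶠ boolᶠ (isBitᵇ true (sym₀ (dec o)))
  litᶠ (transition c a b d) o =
      bᵗ ≡ᶠ Jᵗ *ᵗ tᵗ +ᵗ Wᵗ ∧ᶠ boolᶠ (not (does (o Fin.≟ c)))
    ∨ᶠ bᵗ ≡ᶠ aᵗ ∧ᶠ boolᶠ (not (does (o Fin.≟ a)))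
    ∨ᶠ bᵗ ≡ᶠ sucᵗ aᵗ ∧ᶠ boolᶠ (not (does (o Fin.≟ b)))
    ∨ᶠ bᵗ ≡ᶠ sucᵗ (sucᵗ aᵗ) ∧ᶠ boolᶠ (not (does (o Fin.≟ d)))
    -- Adding `J` descends one row and adding 1 moves to column `suc j`. The required content
    -- depends on the place of that column, hence one alternative per place.
    ∨ᶠ bᵗ ≡ᶠ sucᵗ (aᵗ +ᵗ Jᵗ) ∧ᶠ (newᶠ 0F ∨ᶠ newᶠ 1F ∨ᶠ newᶠ 2F ∨ᶠ newᶠ 3F)
    where
    newᶠ : Fin 4 → Fm
    newᶠ p = placeᶠ p ∧ᶠ boolᶠ (does (o Fin.≟ update p c a b d))

  -- Every group has a vertex for every clause type. Where a type does not apply, its vertex is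
  -- joined to all options and thus holds trivially. The quantifiers over `t` and `j` perform the
  -- division of `a` by `J`.
  memᶠ : ClauseType → Fin D → Fm
  memᶠ e o = exᶠ tᵛ (sucᵗ Tᵗ) (exᶠ jᵛ Jᵗ (aᵗ ≡ᶠ Jᵗ *ᵗ tᵗ +ᵗ jᵗ ∧ᶠ ((¬ᶠ appᶠ e) ∨ᶠ litᶠ e o)))

  -- Decodes vertex numbers without division: the groups are found by search, the tags are constants
  -- because `K` depends on the machine alone.
  groupsᶠ : (uᵗ vᵗ : Tm) (ξ υ : Fin K) → Fm → Fm
  groupsᶠ uᵗ vᵗ ξ υ φ = exᶠ aᵛ Nᵗ (exᶠ bᵛ Nᵗ
    (uᵗ ≡ᶠ con K *ᵗ aᵗ +ᵗ con (toℕ ξ) ∧ᶠ vᵗ ≡ᶠ con K *ᵗ bᵗ +ᵗ con (toℕ υ) ∧ᶠ φ))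

  pairᶠ : (ξ υ : Fin K) → Tag → Tag → Fm
  pairᶠ ξ υ (opt o)    (opt p)    = groupsᶠ uᵗ vᵗ ξ υ (¬ᶠ (aᵗ ≡ᶠ bᵗ ∧ᶠ boolᶠ (does (o Fin.≟ p))))
  pairᶠ ξ υ (opt o)    (copy _)   = groupsᶠ uᵗ vᵗ ξ υ (aᵗ ≡ᶠ bᵗ)
  pairᶠ ξ υ (copy _)   (opt o)    = groupsᶠ uᵗ vᵗ ξ υ (bᵗ ≡ᶠ aᵗ)
  pairᶠ ξ υ (opt o)    (clause e) = groupsᶠ vᵗ uᵗ υ ξ (memᶠ (toClause e) o)
  pairᶠ ξ υ (clause e) (opt o)    = groupsᶠ uᵗ vᵗ ξ υ (memᶠ (toClause e) o)
  pairᶠ ξ υ _          _          = boolᶠ false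

  adjᶠ : Fm
  adjᶠ = ⋁ᶠ λ ξ → ⋁ᶠ λ υ → pairᶠ ξ υ (tag ξ) (tag υ)

  polyᵗ : Polynomial → Tm → Tm
  polyᵗ p t = foldr (λ a r → con a +ᵗ t *ᵗ r) (con 0) p

  polyᵗ-ok : ∀ w p t ρ → ⟦ w ⟧ (polyᵗ p t) ρ ≡ eval p (⟦ w ⟧ t ρ)
  polyᵗ-ok w []      t ρ = refl
  polyᵗ-ok w (a ∷ p) t ρ = cong (λ r → a + ⟦ w ⟧ t ρ * r) (polyᵗ-ok w p t ρ)

  unaryˢ : Tm → Stmt
  unaryˢ t = for iᵛ t (emitˢ (con 1)) ⨾ˢ emitˢ (con 0)

  abstract

    instanceˢ : Stmt
    instanceˢ = unaryˢ (Nᵗ *ᵗ con K) ⨾ˢ unaryˢ (Nᵗ *ᵗ con 4)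
              ⨾ˢ for uᵛ (Nᵗ *ᵗ con K) (for vᵛ (Nᵗ *ᵗ con K) (emitˢ (ind adjᶠ)))

    instanceˢ-unfold : instanceˢ ≡ (unaryˢ (Nᵗ *ᵗ con K) ⨾ˢ unaryˢ (Nᵗ *ᵗ con 4)
                                  ⨾ˢ for uᵛ (Nᵗ *ᵗ con K) (for vᵛ (Nᵗ *ᵗ con K) (emitˢ (ind adjᶠ))))
    instanceˢ-unfold = refl

  -- N groups, one for each cell of a table with T + 1 rows of J cells and the head in column W.
  withParametersˢ : Stmt → Stmt
  withParametersˢ S = letˢ Pᵛ (polyᵗ p ℓᵗ)
                    $ letˢ Tᵛ (polyᵗ q (sucᵗ ℓᵗ +ᵗ (ℓᵗ +ᵗ Pᵗ)))
                    $ letˢ Wᵛ (sucᵗ Tᵗ)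
                    $ letˢ Jᵛ (sucᵗ (Wᵗ +ᵗ (Tᵗ +ᵗ (sucᵗ ℓᵗ +ᵗ (ℓᵗ +ᵗ Pᵗ)))))
                    $ letˢ Nᵛ (sucᵗ Tᵗ *ᵗ Jᵗ) S

  reduceˢ : Stmt
  reduceˢ = withParametersˢ instanceˢ

  -- The formulas describe the gadget graph

  module At (x : Word) (P T′ W J N : ℕ) where

    ℓ : ℕ
    ℓ = length x

    env₀ : Env
    env₀ = ℓ ∷ P ∷ T′ ∷ W ∷ J ∷ N ∷ Vec.replicate 10 0

    env : ℕ → ℕ → Env
    env a b = env₀ [ aᵛ ]≔ a [ bᵛ ]≔ b

    cellEnv : (a b t j : ℕ) → Env
    cellEnv a b t j = env a b [ tᵛ ]≔ t [ jᵛ ]≔ j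

    Lit : ClauseType → Fin D → ℕ → ℕ → Set
    Lit e o a b = ⟦ memᶠ e o ⟧ᶠ x (env a b)

    mem : Fin N → Fin E → Fin N → Fin D → Bool
    mem i e g o = holds x (memᶠ (toClause e) o) (env (toℕ i) (toℕ g))

    module G = Gadget N D E mem

    bool-ext : ∀ {a b} → (a ≡ true → b ≡ true) → (b ≡ true → a ≡ true) → a ≡ b
    bool-ext {false} {false} f g = refl
    bool-ext {false} {true}  f g = g refl
    bool-ext {true}  {b}     f g = sym (f refl)

    -- `u` and `v` do not occur in the membership formula; the case split is there to let the
    -- formula compute.
    memEnv-irrelevant : ∀ u v a b e o → ⟦ memᶠ e o ⟧ᶠ x (env₀ [ uᵛ ]≔ u [ vᵛ ]≔ v [ aᵛ ]≔ a [ bᵛ ]≔ b) ≡ Lit e o a b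
    memEnv-irrelevant u v a b init o with dec o
    ... | q , s ∷ hs = refl
    memEnv-irrelevant u v a b prop o = refl
    memEnv-irrelevant u v a b final o = refl
    memEnv-irrelevant u v a b (transition c a′ b′ d) o = refl

    isBlank-sound : ∀ {s} → isBlankᵇ s ≡ true → s ≡ blank
    isBlank-sound {blank} _ = refl

    isBit-sound : ∀ b {s} → isBitᵇ b s ≡ true → s ≡ bit b
    isBit-sound true  {bit true}  _ = refl
    isBit-sound false {bit false} _ = refl

    isBinary-sound : ∀ {s} → isBinaryᵇ s ≡ true → isBinary s
    isBinary-sound {blank} _ = inj₁ refl
    isBinary-sound {bit b} _ = inj₂ (b , refl)

    isBinary-complete : ∀ {s} → isBinary s → isBinaryᵇ s ≡ true
    isBinary-complete (inj₁ refl)       = refl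
    isBinary-complete (inj₂ (_ , refl)) = refl

    nonblank-sound : ∀ {s} → not (isBlankᵇ s) ≡ true → s ≢ blank
    nonblank-sound {bit _}  _ ()
    nonblank-sound {work _} _ ()

    nonblank-complete : ∀ {s} → s ≢ blank → not (isBlankᵇ s) ≡ true
    nonblank-complete {blank}  h = ⊥-elim (h refl)
    nonblank-complete {bit _}  h = refl
    nonblank-complete {work _} h = refl

    allBlank-sound : ∀ {n} (hs : Vec Sym n) → allBlankᵇ hs ≡ true → ∀ τ → lookup hs τ ≡ blank
    allBlank-sound (blank ∷ hs) h zero    = refl
    allBlank-sound (blank ∷ hs) h (suc τ) = allBlank-sound hs h τ

    allBlank-complete : ∀ {n} (hs : Vec Sym n) → (∀ τ → lookup hs τ ≡ blank) → allBlankᵇ hs ≡ true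
    allBlank-complete []       h = refl
    allBlank-complete (s ∷ hs) h rewrite h zero = allBlank-complete hs (h ∘ suc)

    ≟-sound : ∀ {n} {o c : Fin n} → does (o Fin.≟ c) ≡ true → o ≡ c
    ≟-sound {o = o} {c} h with o Fin.≟ c
    ... | yes e = e

    ≟-refute : ∀ {n} {o c : Fin n} → not (does (o Fin.≟ c)) ≡ true → o ≢ c
    ≟-refute {o = o} h refl rewrite dec-true (o Fin.≟ o) refl = case h of λ ()

    ≢-complete : ∀ {n} {o c : Fin n} → o ≢ c → not (does (o Fin.≟ c)) ≡ true
    ≢-complete {o = o} {c} h rewrite dec-false (o Fin.≟ c) h = refl

    ≡ᵇ-true : ∀ {m n} → m ≡ n → (m ≡ᵇ n) ≡ true
    ≡ᵇ-true {m} {n} = dec-true (m ≟ n)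

    ≡ᵇ-false : ∀ {m n} → m ≢ n → (m ≡ᵇ n) ≡ false
    ≡ᵇ-false {m} {n} = dec-false (m ≟ n)

    module _ {a b t j : ℕ} where

      initSymᶠ-sound : ∀ s → ⟦ initSymᶠ s ⟧ᶠ x (cellEnv a b t j) → InitSym x W P j s
      initSymᶠ-sound s (inj₁ (lt , h))                                    = outside lt (isBlank-sound h)
      initSymᶠ-sound s (inj₂ (inj₁ (i , lt , e , h)))                     = header i lt e (isBit-sound true h)
      initSymᶠ-sound s (inj₂ (inj₂ (inj₁ (e , h))))                       = separator e (isBit-sound false h)
      initSymᶠ-sound s (inj₂ (inj₂ (inj₂ (inj₁ (i , lt , e , inj₁ (n , h)))))) =
        first i lt e (trans (isBit-sound true h) (cong bit (sym n)))
      initSymᶠ-sound s (inj₂ (inj₂ (inj₂ (inj₁ (i , lt , e , inj₂ (n , h)))))) =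
        first i lt e (trans (isBit-sound false h) (cong bit (sym (¬true (nth x i) n))))
        where
        ¬true : ∀ b → ¬ b ≡ true → b ≡ false
        ¬true false _ = refl
        ¬true true  h = ⊥-elim (h refl)
      initSymᶠ-sound s (inj₂ (inj₂ (inj₂ (inj₂ (inj₁ (i , lt , e , h)))))) = second i lt e (isBinary-sound h)
      initSymᶠ-sound s (inj₂ (inj₂ (inj₂ (inj₂ (inj₂ (le , h))))))         = beyond le (isBlank-sound h)

      initSymᶠ-complete : ∀ {s} → InitSym x W P j s → ⟦ initSymᶠ s ⟧ᶠ x (cellEnv a b t j)
      initSymᶠ-complete (outside lt refl)       = inj₁ (lt , refl)
      initSymᶠ-complete (header i lt e refl)    = inj₂ (inj₁ (i , lt , e , refl))
      initSymᶠ-complete (separator e refl)      = inj₂ (inj₂ (inj₁ (e , refl)))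
      initSymᶠ-complete (first i lt e refl) with nth x i in n
      ... | true  = inj₂ (inj₂ (inj₂ (inj₁ (i , lt , e , inj₁ (n , refl)))))
      ... | false = inj₂ (inj₂ (inj₂ (inj₁ (i , lt , e , inj₂ ((λ h → case trans (sym n) h of λ ()) , refl)))))
      initSymᶠ-complete (second i lt e h)       = inj₂ (inj₂ (inj₂ (inj₂ (inj₁ (i , lt , e , isBinary-complete h)))))
      initSymᶠ-complete (beyond le refl)        = inj₂ (inj₂ (inj₂ (inj₂ (inj₂ (le , refl)))))

      initᶠ-sound : ∀ c → ⟦ initᶠ c ⟧ᶠ x (cellEnv a b t j) → InitCell x W P j c
      initᶠ-sound (q , s ∷ hs) (e , h , i) with refl ← ≟-sound {o = q} e =
        init (initSymᶠ-sound s i) (allBlank-sound hs h)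

      initᶠ-complete : ∀ {c} → InitCell x W P j c → ⟦ initᶠ c ⟧ᶠ x (cellEnv a b t j)
      initᶠ-complete (init {hs = hs} i h) = dec-true (start Fin.≟ start) refl , allBlank-complete hs h , initSymᶠ-complete i

      placeᶠ-sound : ∀ p → ⟦ placeᶠ p ⟧ᶠ x (cellEnv a b t j) → p ≡ place {workSymbols} W (suc j)
      placeᶠ-sound 0F (n , n′ , n″) rewrite ≡ᵇ-false n | ≡ᵇ-false n′ | ≡ᵇ-false n″ = refl
      placeᶠ-sound 1F e             rewrite ≡ᵇ-true e = refl
      placeᶠ-sound 2F (n , e)       rewrite ≡ᵇ-false n | ≡ᵇ-true e = refl
      placeᶠ-sound 3F (n , n′ , e)  rewrite ≡ᵇ-false n | ≡ᵇ-false n′ | ≡ᵇ-true e = refl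

      -- The four formulas are exhaustive, so one of them holds, and soundness tells which.
      placeᶠ-complete : ⟦ placeᶠ (place {workSymbols} W (suc j)) ⟧ᶠ x (cellEnv a b t j)
      placeᶠ-complete = let k , h = some in subst (λ p → ⟦ placeᶠ p ⟧ᶠ x (cellEnv a b t j)) (placeᶠ-sound k h) h
        where
        some : ∃[ k ] ⟦ placeᶠ k ⟧ᶠ x (cellEnv a b t j)
        some with suc j ≟ suc W | suc j ≟ W | suc (suc j) ≟ W
        ... | yes e | _      | _      = 1F , e
        ... | no n  | yes e  | _      = 2F , n , e
        ... | no n  | no n′  | yes e  = 3F , n , n′ , e
        ... | no n  | no n′  | no n″  = 0F , n , n′ , n″

    env′ : ℕ → ℕ → Env
    env′ u v = env₀ [ uᵛ ]≔ u [ vᵛ ]≔ v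

    mem-sound : ∀ u v (i : Fin N) e (g : Fin N) o →
                ⟦ memᶠ (toClause e) o ⟧ᶠ x (env′ u v [ aᵛ ]≔ toℕ i [ bᵛ ]≔ toℕ g) → mem i e g o ≡ true
    mem-sound u v i e g o h = Equivalence.to (holds-⇔ x (memᶠ (toClause e) o) (env (toℕ i) (toℕ g)))
      (subst id (memEnv-irrelevant u v (toℕ i) (toℕ g) (toClause e) o) h)

    mem-complete : ∀ u v (i : Fin N) e (g : Fin N) o → mem i e g o ≡ true →
                   ⟦ memᶠ (toClause e) o ⟧ᶠ x (env′ u v [ aᵛ ]≔ toℕ i [ bᵛ ]≔ toℕ g)
    mem-complete u v i e g o h = subst id (sym (memEnv-irrelevant u v (toℕ i) (toℕ g) (toClause e) o))
      (Equivalence.from (holds-⇔ x (memᶠ (toClause e) o) (env (toℕ i) (toℕ g))) h)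

    digits : ∀ {i : Fin N} {ξ ξ′ : Fin K} {a} → a < N → toℕ (combine i ξ) ≡ K * a + toℕ ξ′ → a ≡ toℕ i × ξ ≡ ξ′
    digits {i} {ξ} {ξ′} {a} a<N e =
      let p , q = Fin.combine-injective i ξ (fromℕ< a<N) ξ′ (Fin.toℕ-injective (trans e
                    (sym (trans (Fin.toℕ-combine (fromℕ< a<N) ξ′) (cong (λ n → K * n + toℕ ξ′) (Fin.toℕ-fromℕ< a<N))))))
      in sym (trans (cong toℕ p) (Fin.toℕ-fromℕ< a<N)) , q

    module _ (i j : Fin N) (ξ υ : Fin K) where

      private
        u v : ℕ
        u = toℕ (combine i ξ)
        v = toℕ (combine j υ)

        both : ∀ φ → ⟦ φ ⟧ᶠ x (env′ u v [ aᵛ ]≔ toℕ i [ bᵛ ]≔ toℕ j) → ⟦ groupsᶠ uᵗ vᵗ ξ υ φ ⟧ᶠ x (env′ u v)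
        both φ h = toℕ i , Fin.toℕ<n i , toℕ j , Fin.toℕ<n j , Fin.toℕ-combine i ξ , Fin.toℕ-combine j υ , h

        both-swap : ∀ φ → ⟦ φ ⟧ᶠ x (env′ u v [ aᵛ ]≔ toℕ j [ bᵛ ]≔ toℕ i) → ⟦ groupsᶠ vᵗ uᵗ υ ξ φ ⟧ᶠ x (env′ u v)
        both-swap φ h = toℕ j , Fin.toℕ<n j , toℕ i , Fin.toℕ<n i , Fin.toℕ-combine j υ , Fin.toℕ-combine i ξ , h

        only : ∀ {ξ′ υ′} φ → ⟦ groupsᶠ uᵗ vᵗ ξ′ υ′ φ ⟧ᶠ x (env′ u v) →
               ξ ≡ ξ′ × υ ≡ υ′ × ⟦ φ ⟧ᶠ x (env′ u v [ aᵛ ]≔ toℕ i [ bᵛ ]≔ toℕ j)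
        only φ (a , a<N , b , b<N , e , e′ , h) with digits {i} {ξ} a<N e | digits {j} {υ} b<N e′
        ... | refl , p | refl , q = p , q , h

        only-swap : ∀ {ξ′ υ′} φ → ⟦ groupsᶠ vᵗ uᵗ υ′ ξ′ φ ⟧ᶠ x (env′ u v) →
                    ξ ≡ ξ′ × υ ≡ υ′ × ⟦ φ ⟧ᶠ x (env′ u v [ aᵛ ]≔ toℕ j [ bᵛ ]≔ toℕ i)
        only-swap φ (a , a<N , b , b<N , e , e′ , h) with digits {j} {υ} a<N e | digits {i} {ξ} b<N e′
        ... | refl , p | refl , q = q , p , h

        distinctᶠ : Fin D → Fin D → Fm
        distinctᶠ o p = ¬ᶠ (aᵗ ≡ᶠ bᵗ ∧ᶠ boolᶠ (does (o Fin.≟ p)))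

      pair-complete : ∀ s t → G.A (i , s) (j , t) ≡ true → ⟦ pairᶠ ξ υ s t ⟧ᶠ x (env′ u v)
      pair-complete (opt o)    (opt p)    h = both (distinctᶠ o p) λ (e , e′) → case
        subst₂ (λ a b → not (a ∧ b) ≡ true) (dec-true (i Fin.≟ j) (Fin.toℕ-injective e)) e′ h of λ ()
      pair-complete (opt o)    (copy _)   h = both (aᵗ ≡ᶠ bᵗ) (cong toℕ (≟-sound {o = i} {j} h))
      pair-complete (copy _)   (opt o)    h = both (bᵗ ≡ᶠ aᵗ) (cong toℕ (≟-sound {o = j} {i} h))
      pair-complete (opt o)    (clause e) h = both-swap (memᶠ (toClause e) o) (mem-complete u v j e i o h)
      pair-complete (clause e) (opt o)    h = both (memᶠ (toClause e) o) (mem-complete u v i e j o h)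

      pair-sound : ∀ {ξ′ υ′} s t → ⟦ pairᶠ ξ′ υ′ s t ⟧ᶠ x (env′ u v) → ξ ≡ ξ′ × υ ≡ υ′ × G.A (i , s) (j , t) ≡ true
      pair-sound (opt o)    (opt p)    h = let e , e′ , k = only (distinctᶠ o p) h in e , e′ , distinct k
        where
        distinct : ¬ (toℕ i ≡ toℕ j × does (o Fin.≟ p) ≡ true) → not (does (i Fin.≟ j) ∧ does (o Fin.≟ p)) ≡ true
        distinct k with i Fin.≟ j | o Fin.≟ p
        ... | no _    | _     = refl
        ... | yes _   | no _  = refl
        ... | yes e   | yes _ = ⊥-elim (k (cong toℕ e , refl))
      pair-sound (opt o)    (copy _)   h =
        let e , e′ , k = only (aᵗ ≡ᶠ bᵗ) h in e , e′ , dec-true (i Fin.≟ j) (Fin.toℕ-injective k)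
      pair-sound (copy _)   (opt o)    h =
        let e , e′ , k = only (bᵗ ≡ᶠ aᵗ) h in e , e′ , dec-true (j Fin.≟ i) (Fin.toℕ-injective k)
      pair-sound (opt o)    (clause e) h =
        let p , p′ , k = only-swap (memᶠ (toClause e) o) h in p , p′ , mem-sound u v j e i o k
      pair-sound (clause e) (opt o)    h =
        let p , p′ , k = only (memᶠ (toClause e) o) h in p , p′ , mem-sound u v i e j o k

      adj-combine : G.A (i , tag ξ) (j , tag υ) ≡ holds x adjᶠ (env′ u v)
      adj-combine = bool-ext
        (λ h → Equivalence.to (holds-⇔ x adjᶠ (env′ u v)) (ξ , υ , pair-complete (tag ξ) (tag υ) h))
        (λ h → let ξ′ , υ′ , k = Equivalence.from (holds-⇔ x adjᶠ (env′ u v)) h in found ξ′ υ′ k)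
        where
        found : ∀ ξ′ υ′ → ⟦ pairᶠ ξ′ υ′ (tag ξ′) (tag υ′) ⟧ᶠ x (env′ u v) → G.A (i , tag ξ) (j , tag υ) ≡ true
        found ξ′ υ′ k with pair-sound (tag ξ′) (tag υ′) k
        ... | refl , refl , r = r

    adj-holds : ∀ u v → Graph.adj G.graph u v ≡ holds x adjᶠ (env′ (toℕ u) (toℕ v))
    adj-holds u v = trans (adj-combine (proj₁ (remQuot K u)) (proj₁ (remQuot K v)) (proj₂ (remQuot {N} K u)) (proj₂ (remQuot {N} K v)))
      (cong₂ (λ u v → holds x adjᶠ (env′ (toℕ u) (toℕ v))) (Fin.combine-remQuot {N} K u) (Fin.combine-remQuot {N} K v))

-- Satisfying assignments are valid tables

module Correct (M : TM) (p q : Polynomial) (x : Word) (P T′ W J N : ℕ) .{{_ : NonZero J}}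
               (W<J : W < J) (N≡ : N ≡ suc T′ * J) where
  open TM M using (workSymbols)
  open Tableau M
  open Logic 15
  open Reduction M p q
  open At x P T′ W J N

  index-unique : ∀ {t j t′ j′} → j < J → j′ < J → J * t + j ≡ J * t′ + j′ → t ≡ t′ × j ≡ j′
  index-unique {t} {j} {t′} {j′} j<J j′<J e = *-cancelˡ-≡ t t′ J (+-cancelʳ-≡ j _ _ (trans e (cong (J * t′ +_) (sym j≡j′)))) , j≡j′
    where
    rem : ∀ t {j} → j < J → (J * t + j) % J ≡ j
    rem t {j} j<J = trans (cong (_% J) (trans (+-comm (J * t) j) (cong (j +_) (*-comm J t))))
                          (trans ([m+kn]%n≡m%n j t J) (m<n⇒m%n≡m j<J))
    j≡j′ : j ≡ j′
    j≡j′ = trans (sym (rem t j<J)) (trans (cong (_% J) e) (rem t′ j′<J))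

  index<N : ∀ {t j} → t ≤ T′ → j < J → J * t + j < N
  index<N {t} {j} t≤T j<J = ≤-trans (+-monoʳ-< (J * t) j<J) (≤-trans (≤-reflexive (trans (+-comm (J * t) J) (cong (J +_) (*-comm J t))))
    (≤-trans (*-monoˡ-≤ J (s≤s t≤T)) (≤-reflexive (sym N≡))))

  index-below : ∀ t j → J * suc t + suc j ≡ suc (J * t + j + J)
  index-below t j = trans (+-suc (J * suc t) j) (cong suc (trans (cong (_+ j) (trans (*-suc J t) (+-comm J (J * t))))
    (trans (+-assoc (J * t) J j) (trans (cong (J * t +_) (+-comm J j)) (sym (+-assoc (J * t) j J))))))

  index-suc² : ∀ t j → J * t + suc (suc j) ≡ suc (suc (J * t + j))
  index-suc² t j = trans (+-suc (J * t) (suc j)) (cong suc (+-suc (J * t) j))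

  -- Satisfaction with natural numbers for groups, so that cells can be addressed as `J * t + j`.
  Satᴺ : (ℕ → Fin D) → Set
  Satᴺ S = ∀ {a} → a < N → ∀ e → ∃[ b ] b < N × Lit e (S b) a b

  module _ (S : ℕ → Fin D) (sat : Satᴺ S) where

    private
      R : ℕ → ℕ → Fin D
      R t j = S (J * t + j)

      -- Quotient and remainder are unique, so the row and column found by the quantifiers of `memᶠ`
      -- are the given ones. `indep` transports applicability to the group `b` of the literal.
      clause-at : ∀ {t j} → t ≤ T′ → j < J → ∀ e → ⟦ appᶠ e ⟧ᶠ x (cellEnv (J * t + j) 0 t j) →
                  (∀ b → ⟦ appᶠ e ⟧ᶠ x (cellEnv (J * t + j) 0 t j) → ⟦ appᶠ e ⟧ᶠ x (cellEnv (J * t + j) b t j)) →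
                  ∃[ b ] ⟦ litᶠ e (S b) ⟧ᶠ x (cellEnv (J * t + j) b t j)
      clause-at {t} {j} t≤T j<J e app indep with sat (index<N t≤T j<J) e
      ... | b , b<N , t′ , _ , j′ , j′<J , i , c with index-unique {t} {j} {t′} {j′} j<J j′<J i
      ...   | refl , refl with c
      ...     | inj₁ n = ⊥-elim (n (indep b app))
      ...     | inj₂ l = b , l

    sat⇒valid : Valid x W P T′ J R
    sat⇒valid = record
      { v-init  = λ {j} j<J → init-ok j<J
      ; v-prop  = prop-ok
      ; v-final = final-ok
      ; v-trans = trans-ok
      }
      where
      init-ok : ∀ {j} → j < J → InitCell x W P j (dec (R 0 j))
      init-ok {j} j<J with clause-at {0} z≤n j<J init refl (λ _ → id)
      ... | b , refl , h = initᶠ-sound {a = J * 0 + j} {b} {0} {j} (dec (S b)) h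

      prop-ok : ∀ {j} → suc j < J → W + (suc ℓ + ℓ) ≤ j → sym₀ (dec (R 0 j)) ≢ blank ⊎ sym₀ (dec (R 0 (suc j))) ≡ blank
      prop-ok {j} lt le with clause-at {0} z≤n (<-trans ≤-refl lt) prop (refl , le , lt) (λ _ → id)
      ... | b , inj₁ (refl , h) = inj₁ (nonblank-sound h)
      ... | b , inj₂ (refl , h) = inj₂ (trans (cong (sym₀ ∘ dec ∘ S) (+-suc (J * 0) j)) (isBlank-sound h))

      final-ok : sym₀ (dec (R T′ W)) ≡ bit true
      final-ok with clause-at {T′} {W} ≤-refl W<J final (refl , refl) (λ _ → id)
      ... | b , refl , h = isBit-sound true h

      -- The clause for the actual contents of the four cells is used: its first four alternatives
      -- claim that a cell differs from itself, so the last one must hold.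
      trans-ok : ∀ {t j} → t < T′ → suc (suc j) < J → R (suc t) (suc j) ≡
                 update (place {workSymbols} W (suc j)) (R t W) (R t j) (R t (suc j)) (R t (suc (suc j)))
      trans-ok {t} {j} t<T lt
        with clause-at {t} {j} (<⇒≤ t<T) (<-trans ≤-refl (<-trans ≤-refl lt))
               (transition (R t W) (R t j) (R t (suc j)) (R t (suc (suc j)))) (t<T , lt) (λ _ → id)
      ... | b , inj₁ (refl , h) = ⊥-elim (≟-refute {o = R t W} h refl)
      ... | b , inj₂ (inj₁ (refl , h)) = ⊥-elim (≟-refute {o = R t j} h refl)
      ... | b , inj₂ (inj₂ (inj₁ (refl , h))) = ⊥-elim (≟-refute h (cong S (sym (+-suc (J * t) j))))
      ... | b , inj₂ (inj₂ (inj₂ (inj₁ (refl , h)))) =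
        ⊥-elim (≟-refute h (cong S (sym (index-suc² t j))))
      ... | b , inj₂ (inj₂ (inj₂ (inj₂ (refl , h)))) = trans (cong S (index-below t j)) (new h)
        where
        at : ∀ p → ⟦ placeᶠ p ⟧ᶠ x (cellEnv (J * t + j) b t j) →
             does (S b Fin.≟ update p (R t W) (R t j) (R t (suc j)) (R t (suc (suc j)))) ≡ true →
             S b ≡ update (place {workSymbols} W (suc j)) (R t W) (R t j) (R t (suc j)) (R t (suc (suc j)))
        at p h e = trans (≟-sound e) (cong (λ p → update p _ _ _ _) (placeᶠ-sound {J * t + j} {b} {t} {j} p h))
        new : _ → S b ≡ update (place {workSymbols} W (suc j)) (R t W) (R t j) (R t (suc j)) (R t (suc (suc j)))
        new (inj₁ (h , e))               = at 0F h e
        new (inj₂ (inj₁ (h , e)))        = at 1F h e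
        new (inj₂ (inj₂ (inj₁ (h , e)))) = at 2F h e
        new (inj₂ (inj₂ (inj₂ (h , e)))) = at 3F h e

  module _ (R : ℕ → ℕ → Fin D) (valid : Valid x W P T′ J R) where
    open Valid valid

    flatten : ℕ → Fin D
    flatten n = R (n / J) (n % J)

    flatten-index : ∀ t {j} → j < J → flatten (J * t + j) ≡ R t j
    flatten-index t {j} j<J = let e , e′ = index-unique {(J * t + j) / J} {(J * t + j) % J} {t} {j} (m%n<n (J * t + j) J) j<J
                                       (sym (trans (m≡m%n+[m/n]*n (J * t + j) J) (trans (+-comm _ ((J * t + j) / J * J)) (cong (_+ (J * t + j) % J) (*-comm _ J)))))
                        in cong₂ R e e′

    valid⇒sat : Satᴺ flatten
    valid⇒sat {a} a<N e = subst (λ a → ∃[ b ] b < N × Lit e (flatten b) a b) (sym a≡) (satisfy e)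
      where
      t j : ℕ
      t = a / J
      j = a % J
      a≡ : a ≡ J * t + j
      a≡ = trans (m≡m%n+[m/n]*n a J) (trans (+-comm j (t * J)) (cong (_+ j) (*-comm t J)))
      j<J : j < J
      j<J = m%n<n a J
      t≤T : t ≤ T′
      t≤T = ≤-pred (m<n*o⇒m/o<n {a} {suc T′} {J} (subst (a <_) N≡ a<N))

      vacuous : ∀ e → ¬ ⟦ appᶠ e ⟧ᶠ x (cellEnv (J * t + j) (J * t + j) t j) → ∃[ b ] b < N × Lit e (flatten b) (J * t + j) b
      vacuous e n = J * t + j , index<N t≤T j<J , t , s≤s t≤T , j , j<J , refl , inj₁ n

      literal : ∀ e b → b < N → ⟦ litᶠ e (flatten b) ⟧ᶠ x (cellEnv (J * t + j) b t j) → ∃[ b ] b < N × Lit e (flatten b) (J * t + j) b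
      literal e b b<N l = b , b<N , t , s≤s t≤T , j , j<J , refl , inj₂ l

      satisfy : ∀ e → ∃[ b ] b < N × Lit e (flatten b) (J * t + j) b
      satisfy init with t ≟ 0
      ... | no n  = vacuous init n
      ... | yes z = literal init (J * t + j) (index<N t≤T j<J) (refl ,
                      initᶠ-complete {J * t + j} {J * t + j} {t} {j} (subst (InitCell x W P j ∘ dec) (sym (trans (flatten-index t j<J) (cong (λ t → R t j) z))) (v-init j<J)))
      satisfy prop with t ≟ 0 | W + (suc ℓ + ℓ) ≤? j | suc (suc j) ≤? J
      ... | no n  | _      | _      = vacuous prop (n ∘ proj₁)
      ... | yes _ | no n   | _      = vacuous prop (n ∘ proj₁ ∘ proj₂)
      ... | yes _ | yes _  | no n   = vacuous prop (n ∘ proj₂ ∘ proj₂)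
      ... | yes z | yes le | yes lt with v-prop lt le
      ...   | inj₁ ne = literal prop (J * t + j) (index<N t≤T j<J) (inj₁ (refl , nonblank-complete
                          (subst (λ o → sym₀ (dec o) ≢ blank) (sym (trans (flatten-index t j<J) (cong (λ t → R t j) z))) ne)))
      ...   | inj₂ e  = literal prop (suc (J * t + j)) (subst (_< N) (+-suc (J * t) j) (index<N t≤T lt)) (inj₂ (refl , cong isBlankᵇ
                          (trans (cong (sym₀ ∘ dec) (trans (cong flatten (sym (+-suc (J * t) j))) (trans (flatten-index t lt) (cong (λ t → R t (suc j)) z)))) e)))
      satisfy final with t ≟ T′ | j ≟ W
      ... | no n  | _     = vacuous final (n ∘ proj₁)
      ... | yes _ | no n  = vacuous final (n ∘ proj₂)
      ... | yes z | yes w = literal final (J * t + j) (index<N t≤T j<J) (refl , cong (isBitᵇ true)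
                              (trans (cong (sym₀ ∘ dec) (trans (flatten-index t j<J) (cong₂ R z w))) v-final))
      satisfy e@(transition c a b d) with suc t ≤? T′ | suc (suc (suc j)) ≤? J
      ... | no n    | _      = vacuous e (n ∘ proj₁)
      ... | yes _   | no n   = vacuous e (n ∘ proj₂)
      -- The first cell that deviates from the quadruple supplies the literal; if none deviates,
      -- `v-trans` supplies it in the next row.
      ... | yes t<T | yes lt with flatten (J * t + W) Fin.≟ c
      ...   | no n = literal e (J * t + W) (index<N t≤T W<J) (inj₁ (refl , ≢-complete n))
      ...   | yes pc with flatten (J * t + j) Fin.≟ a
      ...     | no n = literal e (J * t + j) (index<N t≤T j<J) (inj₂ (inj₁ (refl , ≢-complete n)))
      ...     | yes pa with flatten (suc (J * t + j)) Fin.≟ b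
      ...       | no n = literal e (suc (J * t + j)) (subst (_< N) (+-suc (J * t) j) (index<N t≤T (<-trans ≤-refl lt))) (inj₂ (inj₂ (inj₁ (refl , ≢-complete n))))
      ...       | yes pb with flatten (suc (suc (J * t + j))) Fin.≟ d
      ...         | no n = literal e (suc (suc (J * t + j))) (subst (_< N) (index-suc² t j) (index<N t≤T lt))
                             (inj₂ (inj₂ (inj₂ (inj₁ (refl , ≢-complete n)))))
      ...         | yes pd = literal e (suc (J * t + j + J)) (subst (_< N) (index-below t j) (index<N t<T (<-trans ≤-refl lt)))
                               (inj₂ (inj₂ (inj₂ (inj₂ (refl , new (place {workSymbols} W (suc j)) placeᶠ-complete (dec-true (_ Fin.≟ _) value))))))
        where
        value : flatten (suc (J * t + j + J)) ≡ update (place {workSymbols} W (suc j)) c a b d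
        value = trans (cong flatten (sym (index-below t j))) (trans (flatten-index (suc t) (<-trans ≤-refl lt)) (trans (v-trans t<T lt)
          (cong enc (nextCell-cong (place {workSymbols} W (suc j))
            (cong dec (trans (sym (flatten-index t W<J)) pc))
            (cong dec (trans (sym (flatten-index t j<J)) pa))
            (cong dec (trans (sym (flatten-index t (<-trans ≤-refl lt))) (trans (cong flatten (+-suc (J * t) j)) pb)))
            (cong dec (trans (sym (flatten-index t lt)) (trans (cong flatten (index-suc² t j)) pd)))))))
        o : Fin D
        o = flatten (suc (J * t + j + J))
        P′ : Fin 4 → Set
        P′ p = ⟦ placeᶠ p ∧ᶠ boolᶠ (does (o Fin.≟ update p c a b d)) ⟧ᶠ x (cellEnv (J * t + j) (suc (J * t + j + J)) t j)
        new : ∀ p → ⟦ placeᶠ p ⟧ᶠ x (cellEnv (J * t + j) (suc (J * t + j + J)) t j) →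
              does (o Fin.≟ update p c a b d) ≡ true → P′ 0F ⊎ P′ 1F ⊎ P′ 2F ⊎ P′ 3F
        new 0F h e = inj₁ (h , e)
        new 1F h e = inj₂ (inj₁ (h , e))
        new 2F h e = inj₂ (inj₂ (inj₁ (h , e)))
        new 3F h e = inj₂ (inj₂ (inj₂ (h , e)))

eval-mono : ∀ p {m n} → m ≤ n → eval p m ≤ eval p n
eval-mono []      m≤n = z≤n
eval-mono (a ∷ p) m≤n = +-monoʳ-≤ a (*-mono-≤ m≤n (eval-mono p m≤n))

readOff-head : ∀ {m} (t : Tape m) {b} → readOff t ≡ [ b ] → Tape.head t ≡ bit b
readOff-head (tape l (bit c) r)  e = cong bit (proj₁ (∷-injective e))
readOff-head (tape l blank r)    ()
readOff-head (tape l (work _) r) ()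

head-readOff : ∀ {m} (t : Tape m) {b c} → Tape.head t ≡ bit b → readOff t ≡ [ c ] → c ≡ b
head-readOff (tape l (bit b) r) refl e = sym (proj₁ (∷-injective e))

-- From verifiers to instances

module Hardness (M : TM) (p q : Polynomial) (f : Word → Bool)
                (run : ∀ w → ∃[ t ] ∃[ c ] t ≤ eval q (length w) × TM.HaltsIn M t (TM.initial M w) c × TM.output M c ≡ [ f w ]) where
  open TM M using (workSymbols; HaltsIn; Config; output)
  open Tableau M
  open Logic 15
  open Reduction M p q

  module Instance (x : Word) (P T′ W J N : ℕ) .{{_ : NonZero J}} .{{_ : NonZero N}}
                  (W≡ : W ≡ suc T′) (J≡ : J ≡ suc (W + (T′ + (suc (length x) + (length x + P)))))
                  (N≡ : N ≡ suc T′ * J) (P≡ : P ≡ eval p (length x))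
                  (T≡ : T′ ≡ eval q (suc (length x) + (length x + P))) where
    open At x P T′ W J N

    W<J : W < J
    W<J = ≤-trans (s≤s (m≤m+n W _)) (≤-reflexive (sym J≡))

    open Correct M p q x P T′ W J N W<J N≡

    -- `T′` is `q` at the length of `pair x y` for a longest admissible `y`, and `eval q` is
    -- monotone.
    time-ok : ∀ y → length y ≤ P → eval q (length (pair x y)) ≤ T′
    time-ok y le = ≤-trans (eval-mono q (≤-trans (≤-reflexive (length-pair x y)) (+-monoʳ-≤ (suc ℓ) (+-monoʳ-≤ ℓ le))))
                           (≤-reflexive (sym T≡))

    -- The machine halts no later than row `T′` and repeats its last configuration from then on.
    final-conf : ∀ y → length y ≤ P → output (conf (pair x y) T′) ≡ [ f (pair x y) ]
    final-conf y le with run (pair x y)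
    ... | t , c , t≤ , halts , out = trans (cong output (trans (sym (conf-iterate (pair x y) T′ 0))
                                       (halts⇒iterate T′ (≤-trans t≤ (time-ok y le)) halts))) out

    Accepts : Set
    Accepts = ∃[ y ] length y ≤ P × f (pair x y) ≡ true

    sound : ∀ S → Satᴺ S → Accepts
    sound S sat = y , y-length , head-readOff (Vec.head (proj₂ (conf (pair x y) T′))) accepts (final-conf y y-length)
      where
      open Sound x W P T′ J (λ t j → S (J * t + j)) (≤-reflexive (sym W≡))
             (≤-trans (s≤s (+-monoʳ-≤ W (m≤m+n T′ _))) (≤-reflexive (sym J≡)))
             (≤-trans (s≤s (+-monoʳ-≤ W (m≤n+m _ T′))) (≤-reflexive (sym J≡)))
             (sat⇒valid S sat)

    complete : Accepts → ∃[ S ] Satᴺ S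
    complete (y , le , e) = _ , valid⇒sat _ (Complete.valid x W P T′ J y le
      (readOff-head (Vec.head (proj₂ (conf (pair x y) T′))) (trans (final-conf y le) (cong [_] e))))

    satisfies⇒satᴺ : ∀ σ → G.Satisfies σ → ∃[ S ] Satᴺ S
    satisfies⇒satᴺ σ sat = S , λ {a} a<N e →
      let i = fromℕ< a<N
          j , h = sat i (fromClause e)
      in toℕ j , Fin.toℕ<n j , subst₂ (λ e o → Lit e o a (toℕ j)) (toClause-fromClause e) (sym (S-toℕ j))
           (subst (λ a → Lit (toClause (fromClause e)) (σ j) a (toℕ j)) (Fin.toℕ-fromℕ< a<N)
             (Equivalence.from (holds-⇔ x (memᶠ (toClause (fromClause e)) (σ j)) (env (toℕ i) (toℕ j))) h))
      where
      S : ℕ → Fin D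
      -- The remainder extends `σ` to all numbers and fixes those below `N`.
      S n = σ (fromℕ< (m%n<n n N))
      S-toℕ : ∀ j → S (toℕ j) ≡ σ j
      S-toℕ j = cong σ (Fin.toℕ-injective (trans (Fin.toℕ-fromℕ< _) (m<n⇒m%n≡m (Fin.toℕ<n j))))

    satᴺ⇒satisfies : ∀ S → Satᴺ S → G.Satisfies (S ∘ toℕ)
    satᴺ⇒satisfies S sat i e =
      let b , b<N , l = sat (Fin.toℕ<n i) (toClause e)
          b≡ = Fin.toℕ-fromℕ< b<N
      in fromℕ< b<N , Equivalence.to (holds-⇔ x (memᶠ (toClause e) (S (toℕ (fromℕ< b<N)))) (env (toℕ i) (toℕ (fromℕ< b<N))))
           (subst (λ b → Lit (toClause e) (S b) (toℕ i) b) (sym b≡) l)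

    inst : RomanInstance
    inst = record
      { graph   = G.graph
      ; k       = N * 4
      ; k-pos   = *-mono-≤ (>-nonZero⁻¹ N) (s≤s {n = 3} z≤n)
      -- The copies also keep `k` within the number of vertices: a group has at least five vertices
      -- for its weight 4.
      ; k-bound = *-monoʳ-≤ N (≤-trans (m≤m+n 4 (suc E)) (m≤n+m (5 + E) D))
      }

    unary-word : ∀ t ρ → ⟦ x ⟧ˢ (unaryˢ t) ρ ≡ unary (⟦ x ⟧ t ρ)
    unary-word t ρ = cong (_++ [ false ]) (Cat-replicate (⟦ x ⟧ t ρ))

    instance-word : ⟦ x ⟧ˢ instanceˢ env₀ ≡ encode inst
    instance-word = trans (cong (λ S → ⟦ x ⟧ˢ S env₀) instanceˢ-unfold) $ cong₂ _++_ (unary-word (Nᵗ *ᵗ con G.K) env₀) (cong₂ _++_ (unary-word (Nᵗ *ᵗ con 4) env₀)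
      (sym (matrix-Cat G.graph (λ u v → holds x adjᶠ (env′ u v)) adj-holds)))

    correct : Accepts ⇔ Yes inst
    correct = mk⇔
      (λ accepted →
        let S , sat = complete accepted
            sat′ = satᴺ⇒satisfies S sat
        in G.h (S ∘ toℕ) sat′ , G.h-3rdf (S ∘ toℕ) sat′ , ≤-reflexive (G.h-weight (S ∘ toℕ) sat′))
      (λ (h , rdf , light) → let S , sat = satisfies⇒satᴺ (G.assignment h rdf light) (G.assignment-satisfies h rdf light)
                             in sound S sat)

    instance-spec : ∃[ i ] Chordal (RomanInstance.graph i) × ⟦ x ⟧ˢ instanceˢ env₀ ≡ encode i × (Accepts ⇔ Yes i)
    instance-spec = inst , G.graph-chordal , instance-word , correct

  reduction-word : ∀ x → Word
  reduction-word x = ⟦ x ⟧ˢ reduceˢ (input-env x)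

  reduction-polytime : PolyTime reduction-word
  reduction-polytime = stmt-polytime reduceˢ

  abstract

    reduction-spec : ∀ x → ∃[ i ] Chordal (RomanInstance.graph i) × reduction-word x ≡ encode i
                           × ((∃[ y ] length y ≤ eval p (length x) × f (pair x y) ≡ true) ⇔ Yes i)
    reduction-spec x =
      let i , c , e , accepted = Instance.instance-spec x P T′ W J (suc T′ * J) refl refl refl P-value
                              (polyᵗ-ok x q (sucᵗ ℓᵗ +ᵗ (ℓᵗ +ᵗ Pᵗ)) (input-env x [ Pᵛ ]≔ P))
      in i , c , e , subst (λ P → (∃[ y ] length y ≤ P × f (pair x y) ≡ true) ⇔ Yes i) P-value accepted
      where
      ℓ P T′ W J : ℕ
      ℓ  = length x
      P  = ⟦ x ⟧ (polyᵗ p ℓᵗ) (input-env x)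
      T′ = ⟦ x ⟧ (polyᵗ q (sucᵗ ℓᵗ +ᵗ (ℓᵗ +ᵗ Pᵗ))) (input-env x [ Pᵛ ]≔ P)
      W  = suc T′
      J  = suc (W + (T′ + (suc ℓ + (ℓ + P))))

      P-value : P ≡ eval p ℓ
      P-value = polyᵗ-ok x p ℓᵗ (input-env x)

Problem : DecisionProblem
Problem = TRIPLE-ROM-DOM restrictedTo (λ i → Chordal (RomanInstance.graph i))

np-hard : ∀ (L : Language) → InNP L → L ≤ₚ DecisionProblem.language Problem
np-hard L (R , p , (f , (M , q , run) , R⇔) , L⇔) = reduction-word , reduction-polytime , λ x →
  let i , chordal , word , spec = reduction-spec x in mk⇔
  (λ l → let y , le , r = Equivalence.to (L⇔ x) l
         in (i , chordal) , sym word , Equivalence.to spec (y , le , Equivalence.to (R⇔ (pair x y)) r))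
  (λ ((i′ , _) , e , h) →
    let y , le , r = Equivalence.from spec (Yes-transfer i′ i (trans e word) h)
    in Equivalence.from (L⇔ x) (y , le , Equivalence.from (R⇔ (pair x y)) r))
  where
  open Hardness M p q f run

-- A certificate for chordality

module _ {n : ℕ} (_⟶_ : Fin n → Fin n → Set) (_⟶?_ : ∀ a b → Dec (a ⟶ b)) (P : Fin n → Set)
         (extend : ∀ {a b} → P a → a ⟶ b → P b) where

  Closed : (Fin n → Bool) → Set
  Closed S = ∀ a b → S a ≡ true → a ⟶ b → S b ≡ true

  -- Vertices are added one at a time. In `go`, `k` is at least the number of vertices still
  -- missing, so `n` rounds suffice.
  closure : ∀ u → P u → ∃[ S ] S u ≡ true × Closed S × (∀ a → S a ≡ true → P a)
  closure u p = go n (λ a → does (a Fin.≟ u)) (m≤m+n n _) (dec-true (u Fin.≟ u) refl) start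
    where
    start : ∀ a → does (a Fin.≟ u) ≡ true → P a
    start a e with yes refl ← a Fin.≟ u = p
    go : ∀ k S → n ≤ k + FSum (b2n ∘ S) → S u ≡ true → (∀ a → S a ≡ true → P a) →
         ∃[ S ] S u ≡ true × Closed S × (∀ a → S a ≡ true → P a)
    go k S enough Su SP
      with Fin.any? (λ a → Fin.any? (λ b → (S a Bool.≟ true) ×-dec (a ⟶? b) ×-dec (S b Bool.≟ false)))
    ... | no none = S , Su , closed , SP
      where
      closed : Closed S
      closed a b Sa r with S b in e
      ... | true  = refl
      ... | false = ⊥-elim (none (a , b , Sa , r , e))
    ... | yes (a , b , Sa , r , Sb) = grow k enough
      where
      S′ : Fin n → Bool
      S′ c = if does (c Fin.≟ b) then true else S c
      S′-b : S′ b ≡ true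
      S′-b rewrite dec-true (b Fin.≟ b) refl = refl
      S′-other : ∀ c → c ≢ b → S′ c ≡ S c
      S′-other c ne rewrite dec-false (c Fin.≟ b) ne = refl
      count : FSum (b2n ∘ S′) ≡ suc (FSum (b2n ∘ S))
      count = trans (FSum-point (b2n ∘ S′) (b2n ∘ S) b (λ c ne → cong b2n (S′-other c ne)) (cong b2n Sb))
                    (cong (λ b → b2n b + FSum (b2n ∘ S)) S′-b)
      b2n≤1 : ∀ b → b2n b ≤ 1
      b2n≤1 true  = s≤s z≤n
      b2n≤1 false = z≤n
      count≤n : suc (FSum (b2n ∘ S)) ≤ n
      count≤n = subst₂ _≤_ count (trans (FSum-const n 1) (*-identityʳ n)) (FSum-mono (b2n≤1 ∘ S′))
      S′P : ∀ c → S′ c ≡ true → P c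
      S′P c e with c Fin.≟ b
      ... | yes refl = extend (SP a Sa) r
      ... | no _     = SP c e
      S′u : S′ u ≡ true
      S′u with u Fin.≟ b
      ... | yes _ = refl
      ... | no _  = Su
      grow : ∀ k → n ≤ k + FSum (b2n ∘ S) → ∃[ S ] S u ≡ true × Closed S × (∀ a → S a ≡ true → P a)
      grow zero    le = ⊥-elim (<-irrefl refl (≤-trans count≤n le))
      grow (suc k) le = go k S′ (≤-trans le (≤-reflexive (sym (trans (cong (k +_) count) (+-suc k _))))) S′u S′P

module _ (Γ : Graph) where
  open Graph Γ

  ~-sym : ∀ {u v} → u ~ v → v ~ u
  ~-sym {u} {v} = subst T (adj-sym u v)

  ~-irrefl : ∀ {v} → ¬ v ~ v
  ~-irrefl {v} = subst T (adj-irrefl v)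

  -- S v u is closed under steps avoiding the closed neighbourhood of v and,
  -- whenever u is adjacent to v, meets a neighbour of v only if that is adjacent to u.
  Separators : (Vertex → Vertex → Vertex → Bool) → Set
  Separators S = ∀ v u → v ~ u → S v u u ≡ true × (∀ a b → S v u a ≡ true → a ~ b →
    (b ≡ v ⊎ v ~ b ⊎ S v u b ≡ true) × (¬ v ~ b ⊎ b ≡ u ⊎ b ~ u))

  module _ (S : Vertex → Vertex → Vertex → Bool) (sep : Separators S) where

    -- Let `v` and `u` be the first two vertices of a chordless cycle. Between `u` and the last
    -- vertex the cycle avoids the closed neighbourhood of `v`, so it stays in the separator. The
    -- last vertex is then met by a step from the separator and is a neighbour of `v`, yet it is
    -- neither `u` nor adjacent to `u`.
    separators⇒chordal : Chordal Γ
    separators⇒chordal ℓ@(suc (suc (suc (suc m)))) (s≤s (s≤s (s≤s (s≤s _)))) c (inj , cyc)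
      with Fin.any? (λ i → Fin.any? (λ j → ¬? (toℕ j ≟ suc (toℕ i) % ℓ) ×-dec ¬? (toℕ i ≟ suc (toℕ j) % ℓ) ×-dec T? (adj (c i) (c j))))
    ... | yes chord = chord
    ... | no none   = ⊥-elim contradiction
      where
      at : ∀ k → k < ℓ → Fin ℓ
      at k p = fromℕ< p
      to : ∀ {k} (p : k < ℓ) → toℕ (at k p) ≡ k
      to p = Fin.toℕ-fromℕ< p
      edge : ∀ {k} (p : k < ℓ) (q : suc k < ℓ) → c (at k p) ~ c (at (suc k) q)
      edge p q = cyc _ _ (trans (to q) (sym (trans (cong (λ k → suc k % ℓ) (to p)) (m<n⇒m%n≡m q))))
      no-edge : ∀ {i j} (p : i < ℓ) (q : j < ℓ) → j ≢ suc i % ℓ → i ≢ suc j % ℓ → ¬ c (at i p) ~ c (at j q)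
      no-edge p q n n′ e = none (_ , _ , (λ h → n (trans (sym (to q)) (trans h (cong (λ k → suc k % ℓ) (to p)))))
                                       , (λ h → n′ (trans (sym (to p)) (trans h (cong (λ k → suc k % ℓ) (to q))))) , e)
      distinct : ∀ {i j} (p : i < ℓ) (q : j < ℓ) → i ≢ j → c (at i p) ≢ c (at j q)
      distinct p q n e = n (trans (sym (to p)) (trans (cong toℕ (inj e)) (to q)))
      0<ℓ : 0 < ℓ
      0<ℓ = s≤s z≤n
      1<ℓ : 1 < ℓ
      1<ℓ = s≤s (s≤s z≤n)
      2<ℓ : 2 < ℓ
      2<ℓ = s≤s (s≤s (s≤s z≤n))
      v u : Vertex
      v = c (at 0 0<ℓ)
      u = c (at 1 1<ℓ)
      v~u : v ~ u
      v~u = edge 0<ℓ 1<ℓ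
      inside : ∀ k (p : suc k < ℓ) → suc (suc k) < ℓ → S v u (c (at (suc k) p)) ≡ true
      inside zero    p q = subst (λ i → S v u (c i) ≡ true) (Fin.toℕ-injective (trans (to 1<ℓ) (sym (to p)))) (proj₁ (sep v u v~u))
      inside (suc k) p q with proj₁ (proj₂ (sep v u v~u) _ _ (inside k (<-trans ≤-refl p) p) (edge (<-trans ≤-refl p) p))
      ... | inj₁ e         = ⊥-elim (distinct p 0<ℓ (λ ()) e)
      ... | inj₂ (inj₁ e)  = ⊥-elim (no-edge 0<ℓ p (λ h → case trans h (m<n⇒m%n≡m 1<ℓ) of λ ())
                                                   (λ h → case trans h (m<n⇒m%n≡m q) of λ ()) e)
      ... | inj₂ (inj₂ e)  = e
      last<ℓ : suc (suc (suc m)) < ℓ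
      last<ℓ = ≤-refl
      v~last : v ~ c (at _ last<ℓ)
      v~last = ~-sym (cyc _ _ (trans (to 0<ℓ) (sym (trans (cong (λ k → suc k % ℓ) (to last<ℓ)) (n%n≡0 ℓ)))))
      contradiction : ⊥
      contradiction with proj₂ (proj₂ (sep v u v~u) _ _ (inside (suc m) (<-trans ≤-refl last<ℓ) last<ℓ) (edge (<-trans ≤-refl last<ℓ) last<ℓ))
      ... | inj₁ n        = n v~last
      ... | inj₂ (inj₁ e) = distinct last<ℓ 1<ℓ (λ ()) e
      ... | inj₂ (inj₂ e) = no-edge last<ℓ 1<ℓ (λ h → case trans h (n%n≡0 ℓ) of λ ())
                              (λ h → case trans h (m<n⇒m%n≡m 2<ℓ) of λ ()) e

  module _ (chordal : Chordal Γ) where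

    module _ (v u : Vertex) (v~u : v ~ u) where

      -- Walks suffice: repeated vertices are removed by the same shortening that removes chords.
      -- Only the start `u` may be adjacent to `v`.
      record Path (m : ℕ) (p : ℕ → Vertex) : Set where
        field
          starts : p 0 ≡ u
          steps  : ∀ i → i < m → p i ~ p (suc i)
          avoids : ∀ i → 0 < i → i ≤ m → p i ≢ v × ¬ v ~ p i
      open Path

      truncate : ∀ {m p i} → i ≤ m → Path m p → Path i p
      truncate i≤m π = record
        { starts = starts π
        ; steps  = λ k k<i → steps π k (<-≤-trans k<i i≤m)
        ; avoids = λ k 0<k k≤i → avoids π k 0<k (≤-trans k≤i i≤m) }

      skipTo : (ℕ → Vertex) → ℕ → ℕ → ℕ → Vertex
      skipTo p i d k = if k ≤ᵇ i then p k else p (k + d)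

      skip-low : ∀ p {i} d {k} → k ≤ i → skipTo p i d k ≡ p k
      skip-low p {i} d {k} h rewrite dec-true (k ≤? i) h = refl

      skip-high : ∀ p {i} d {k} → i < k → skipTo p i d k ≡ p (k + d)
      skip-high p {i} d {k} h rewrite dec-false (k ≤? i) (<⇒≱ h) = refl

      shortcut : ∀ {m p} i d → Path (suc i + (d + m)) p → p i ~ p (suc i + d) →
                 Path (suc i + m) (skipTo p i d)
      shortcut {m} {p} i d π e = record
        { starts = trans (skip-low p {i} d z≤n) (starts π)
        ; steps  = step
        ; avoids = avoid }
        where
        bound : ∀ {k} → k ≤ suc i + m → k + d ≤ suc i + (d + m)
        bound {k} h = ≤-trans (+-monoˡ-≤ d h) (≤-reflexive (trans (+-assoc (suc i) m d) (cong (suc i +_) (+-comm m d))))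
        step : ∀ k → k < suc i + m → skipTo p i d k ~ skipTo p i d (suc k)
        step k k< with <-cmp k i
        ... | tri< k<i _ _  = subst₂ _~_ (sym (skip-low p d (<⇒≤ k<i))) (sym (skip-low p d k<i))
                                (steps π k (≤-trans k<i (≤-trans (n≤1+n i) (m≤m+n (suc i) _))))
        ... | tri≈ _ refl _ = subst₂ _~_ (sym (skip-low p d ≤-refl)) (sym (skip-high p d ≤-refl)) e
        ... | tri> _ _ i<k  = subst₂ _~_ (sym (skip-high p d i<k)) (sym (skip-high p d (m≤n⇒m≤1+n i<k)))
                                (steps π (k + d) (bound k<))
        avoid : ∀ k → 0 < k → k ≤ suc i + m → skipTo p i d k ≢ v × ¬ v ~ skipTo p i d k
        avoid k 0<k k≤ with k ≤? i
        ... | yes k≤i = subst (λ a → a ≢ v × ¬ v ~ a) (sym (skip-low p d k≤i))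
                          (avoids π k 0<k (≤-trans k≤i (≤-trans (n≤1+n i) (m≤m+n (suc i) _))))
        ... | no k≰i  = subst (λ a → a ≢ v × ¬ v ~ a) (sym (skip-high p d (≰⇒> k≰i)))
                          (avoids π (k + d) (≤-trans 0<k (m≤m+n k d)) (bound k≤))

      module _ (w : Vertex) (v~w : v ~ w) (w≢u : w ≢ u) where

        Shorter : ℕ → Set
        Shorter m = ∃[ k ] k < m × ∃[ p ] Path k p × p k ~ w

        cut : ∀ {m p i} → i < m → Path m p → p i ~ w → Shorter m
        cut {i = i} i<m π e = i , i<m , _ , truncate (<⇒≤ i<m) π , e

        jump : ∀ {m p i j} → suc i < j → j ≤ m → Path m p → p i ~ p j → p m ~ w → Shorter m
        jump {m} {p} {i} {j} i+1<j j≤m π e f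
          with d , refl ← m≤n⇒∃[o]m+o≡n (<⇒≤ i+1<j)
          with r , refl ← m≤n⇒∃[o]m+o≡n j≤m =
          suc i + r , shorter , skipTo p i d , shortcut i d (subst (λ m → Path m p) (+-assoc (suc i) d r) π) e
          , subst (_~ w) (sym (trans (skip-high p d (m≤m+n (suc i) r)) (cong p reorder))) f
          where
          reorder : suc i + r + d ≡ suc i + d + r
          reorder = trans (+-assoc (suc i) r d) (trans (cong (suc i +_) (+-comm r d)) (sym (+-assoc (suc i) d r)))
          0<d : 0 < d
          0<d = +-cancelˡ-< (suc i) 0 d (subst (_< suc i + d) (sym (+-identityʳ (suc i))) i+1<j)
          shorter : suc i + r < suc i + d + r
          shorter = +-monoˡ-< r (subst (_< suc i + d) (+-identityʳ (suc i)) (+-monoʳ-< (suc i) 0<d))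

        ring : ℕ → (ℕ → Vertex) → ℕ → Vertex
        ring m p zero    = v
        ring m p (suc k) = if k ≤ᵇ m then p k else w

        ring-path : ∀ m p {k} → k ≤ m → ring m p (suc k) ≡ p k
        ring-path m p {k} h rewrite dec-true (k ≤? m) h = refl

        ring-last : ∀ m p → ring m p (suc (suc m)) ≡ w
        ring-last m p rewrite dec-false (suc m ≤? m) 1+n≰n = refl

        data Position (m : ℕ) (p : ℕ → Vertex) : ℕ → Vertex → Set where
          centre : Position m p 0 v
          onPath : ∀ {i} → i ≤ m → Position m p (suc i) (p i)
          end    : Position m p (suc (suc m)) w

        position : ∀ m p {k} → k < suc (suc (suc m)) → Position m p k (ring m p k)
        position m p {zero}  _ = centre
        position m p {suc k} (s≤s k<) with m≤n⇒m<n∨m≡n (≤-pred k<)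
        ... | inj₁ k<1+m = subst (Position m p (suc k)) (sym (ring-path m p (≤-pred k<1+m))) (onPath (≤-pred k<1+m))
        ... | inj₂ refl  = subst (Position m p (suc k)) (sym (ring-last m p)) end

        position< : ∀ {m p a x} → Position m p a x → a < suc (suc (suc m))
        position< centre       = s≤s z≤n
        position< (onPath i≤m) = s≤s (s≤s (m≤n⇒m≤1+n i≤m))
        position< end          = ≤-refl

        -- If two path vertices coincide, the first may continue to the successor of the second, or
        -- to `w` if the second ends the path. Any other coincidence contradicts avoidance,
        -- irreflexivity or `w ≢ u`.
        repeated : ∀ {m p a b x y} → Path m p → p m ~ w → a < b → Position m p a x → Position m p b y → x ≡ y → Shorter m
        repeated π f a<b end b _ = ⊥-elim (<-irrefl refl (≤-trans (s≤s a<b) (position< b)))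
        repeated π f a<b centre (onPath {zero} j≤m)  e = ⊥-elim (~-irrefl (subst (v ~_) (sym (trans e (starts π))) v~u))
        repeated π f a<b centre (onPath {suc j} j≤m) e = ⊥-elim (proj₁ (avoids π (suc j) (s≤s z≤n) j≤m) (sym e))
        repeated π f a<b centre end                  e = ⊥-elim (~-irrefl (subst (v ~_) (sym e) v~w))
        repeated {p = p} π f (s≤s i<j) (onPath i≤m) (onPath {j} j≤m) e with m≤n⇒m<n∨m≡n j≤m
        ... | inj₁ j<m  = jump (s≤s i<j) j<m π (subst (_~ p (suc j)) (sym e) (steps π j j<m)) f
        ... | inj₂ refl = cut i<j π (subst (_~ w) (sym e) f)
        repeated π f a<b (onPath {zero} i≤m)  end e = ⊥-elim (w≢u (trans (sym e) (starts π)))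
        repeated π f a<b (onPath {suc i} i≤m) end e = ⊥-elim (proj₂ (avoids π (suc i) (s≤s z≤n) i≤m) (subst (v ~_) (sym e) v~w))

        -- On the ring `v` is adjacent to `u` and `w` only, so a chord joins two path vertices, or a
        -- path vertex to `w`; both cases skip part of the path.
        chord : ∀ {m p a b x y} → Path m p → p m ~ w → a < b → b ≢ suc a → (a ≡ 0 → b ≢ suc (suc m)) →
                Position m p a x → Position m p b y → x ~ y → Shorter m
        chord π f a<b n n′ end b _ = ⊥-elim (<-irrefl refl (≤-trans (s≤s a<b) (position< b)))
        chord π f a<b n n′ centre (onPath {zero} j≤m)  e = ⊥-elim (n refl)
        chord π f a<b n n′ centre (onPath {suc j} j≤m) e = ⊥-elim (proj₂ (avoids π (suc j) (s≤s z≤n) j≤m) e)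
        chord π f a<b n n′ centre end                  e = ⊥-elim (n′ refl refl)
        chord π f (s≤s i<j) n n′ (onPath i≤m) (onPath j≤m) e = jump (≤∧≢⇒< i<j (λ h → n (cong suc (sym h)))) j≤m π e f
        chord π f a<b n n′ (onPath i≤m) end e = cut (≤∧≢⇒< i≤m (λ { refl → n refl })) π e

        -- A chord or a repetition on the cycle v, p 0, …, p m, w yields a shorter path
        -- of the same kind, as v is adjacent to no p i with 0 < i.
        shorten : ∀ m p → 0 < m → Path m p → p m ~ w → Shorter m
        shorten m@(suc m′) p _ π f with Fin.any? (λ i → Fin.any? (λ j → toℕ i <? toℕ j ×-dec (ring m p (toℕ i) Fin.≟ ring m p (toℕ j))))
        ... | yes (i , j , i<j , e) = repeated π f i<j (position m p (Fin.toℕ<n i)) (position m p (Fin.toℕ<n j)) e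
        ... | no none = found (chordal ℓ (s≤s (s≤s (s≤s (s≤s z≤n)))) c (inj , cyc))
          where
          ℓ : ℕ
          ℓ = suc (suc (suc m))
          c : Fin ℓ → Vertex
          c i = ring m p (toℕ i)
          inj : ∀ {i j} → c i ≡ c j → i ≡ j
          inj {i} {j} e with <-cmp (toℕ i) (toℕ j)
          ... | tri< lt _ _ = ⊥-elim (none (i , j , lt , e))
          ... | tri≈ _ eq _ = Fin.toℕ-injective eq
          ... | tri> _ _ gt = ⊥-elim (none (j , i , gt , sym e))
          edge : ∀ {a} → suc a < ℓ → ring m p a ~ ring m p (suc a)
          edge {zero}  _ = subst (v ~_) (sym (trans (ring-path m p z≤n) (starts π))) v~u
          edge {suc a} (s≤s (s≤s a<)) with m≤n⇒m<n∨m≡n (≤-pred a<)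
          ... | inj₁ a<m  = subst₂ _~_ (sym (ring-path m p (<⇒≤ a<m))) (sym (ring-path m p a<m)) (steps π a a<m)
          ... | inj₂ refl = subst₂ _~_ (sym (ring-path m p ≤-refl)) (sym (ring-last m p)) f
          cyc : ∀ i j → CyclicSuc Γ i j → c i ~ c j
          cyc i j s with m≤n⇒m<n∨m≡n (Fin.toℕ<n i)
          ... | inj₁ lt = subst (λ k → c i ~ ring m p k) (sym (trans s (m<n⇒m%n≡m lt))) (edge lt)
          ... | inj₂ e  = subst₂ (λ a b → ring m p a ~ ring m p b) (sym (suc-injective e)) (sym (trans s (trans (cong (_% ℓ) e) (n%n≡0 ℓ))))
                            (subst (_~ v) (sym (ring-last m p)) (~-sym v~w))
          consecutive : ∀ i j → toℕ j ≡ suc (toℕ i) → CyclicSuc Γ i j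
          consecutive i j e = trans e (sym (m<n⇒m%n≡m (subst (_< ℓ) e (Fin.toℕ<n j))))
          wraps : ∀ i j → toℕ i ≡ 0 → toℕ j ≡ suc (suc m) → CyclicSuc Γ j i
          wraps i j e e′ = trans e (sym (trans (cong (λ k → suc k % ℓ) e′) (n%n≡0 ℓ)))
          found : HasChord Γ c → Shorter m
          found (i , j , n , n′ , e) with <-cmp (toℕ i) (toℕ j)
          ... | tri< lt _ _ = chord π f lt (n ∘ consecutive i j) (λ z l → n′ (wraps i j z l))
                                (position m p (Fin.toℕ<n i)) (position m p (Fin.toℕ<n j)) e
          ... | tri≈ _ eq _ = ⊥-elim (~-irrefl (subst (λ k → c i ~ ring m p k) (sym eq) e))
          ... | tri> _ _ gt = chord π f gt (n′ ∘ consecutive j i) (λ z l → n (wraps j i z l))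
                                (position m p (Fin.toℕ<n j)) (position m p (Fin.toℕ<n i)) (~-sym e)

        -- Descent on the length ends at length 0, where the path is `u` alone and its step to `w`
        -- is the desired edge.
        path-end : ∀ m → Acc _<_ m → ∀ p → Path m p → p m ~ w → w ~ u
        path-end zero    _         p π f = ~-sym (subst (_~ w) (starts π) f)
        path-end (suc m) (acc rec) p π f =
          let k , k<m , p′ , π′ , f′ = shorten (suc m) p (s≤s z≤n) π f in path-end k (rec k<m) p′ π′ f′

      Reached : Vertex → Set
      Reached a = ∃[ m ] ∃[ p ] Path m p × p m ≡ a

      _⟶_ : Vertex → Vertex → Set
      a ⟶ b = a ~ b × b ≢ v × ¬ v ~ b

      reached-extend : ∀ {a b} → Reached a → a ⟶ b → Reached b
      reached-extend {a} {b} (m , p , π , refl) (e , b≢v , v≁b) = suc m , p′ , record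
        { starts = trans (low z≤n) (starts π)
        ; steps  = step
        ; avoids = avoid } , high
        where
        p′ : ℕ → Vertex
        p′ k = if k ≤ᵇ m then p k else b
        low : ∀ {k} → k ≤ m → p′ k ≡ p k
        low {k} h rewrite dec-true (k ≤? m) h = refl
        high : p′ (suc m) ≡ b
        high rewrite dec-false (suc m ≤? m) 1+n≰n = refl
        step : ∀ k → k < suc m → p′ k ~ p′ (suc k)
        step k k< with m≤n⇒m<n∨m≡n (≤-pred k<)
        ... | inj₁ k<m  = subst₂ _~_ (sym (low (<⇒≤ k<m))) (sym (low k<m)) (steps π k k<m)
        ... | inj₂ refl = subst₂ _~_ (sym (low ≤-refl)) (sym high) e
        avoid : ∀ k → 0 < k → k ≤ suc m → p′ k ≢ v × ¬ v ~ p′ k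
        avoid k 0<k k≤ with m≤n⇒m<n∨m≡n k≤
        ... | inj₁ k<   = subst (λ a → a ≢ v × ¬ v ~ a) (sym (low (≤-pred k<))) (avoids π k 0<k (≤-pred k<))
        ... | inj₂ refl = subst (λ a → a ≢ v × ¬ v ~ a) (sym high) (b≢v , v≁b)

      separator : ∃[ S ] S u ≡ true × (∀ a b → S a ≡ true → a ~ b →
                  (b ≡ v ⊎ v ~ b ⊎ S b ≡ true) × (¬ v ~ b ⊎ b ≡ u ⊎ b ~ u))
      separator =
        let S , Su , closed , reached = closure _⟶_ (λ a b → T? (adj a b) ×-dec ¬? (b Fin.≟ v) ×-dec ¬? (T? (adj v b)))
              Reached reached-extend u (0 , (λ _ → u) , record { starts = refl ; steps = λ _ () ; avoids = λ { _ (s≤s _) () } } , refl)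
        in S , Su , λ a b Sa e → step S closed a b Sa e , boundary S reached a b Sa e
        where
        step : ∀ S → (∀ a b → S a ≡ true → a ⟶ b → S b ≡ true) → ∀ a b → S a ≡ true → a ~ b → b ≡ v ⊎ v ~ b ⊎ S b ≡ true
        step S closed a b Sa e with b Fin.≟ v | T? (adj v b)
        ... | yes p | _     = inj₁ p
        ... | no _  | yes q = inj₂ (inj₁ q)
        ... | no ¬p | no ¬q = inj₂ (inj₂ (closed a b Sa (e , ¬p , ¬q)))
        boundary : ∀ S → (∀ a → S a ≡ true → Reached a) → ∀ a b → S a ≡ true → a ~ b → ¬ v ~ b ⊎ b ≡ u ⊎ b ~ u
        boundary S reached a b Sa e with T? (adj v b) | b Fin.≟ u
        ... | no ¬q | _     = inj₁ ¬q
        ... | yes _ | yes p = inj₂ (inj₁ p)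
        ... | yes q | no ¬p with m , p , π , refl ← reached a Sa = inj₂ (inj₂ (path-end b q ¬p m (<-wellFounded m) p π e))

    chordal⇒separators : ∃[ S ] Separators S
    chordal⇒separators = S , λ v u v~u → ok v u v~u
      where
      S : Vertex → Vertex → Vertex → Bool
      S v u a with T? (adj v u)
      ... | yes v~u = proj₁ (separator v u v~u) a
      ... | no _    = false
      ok : Separators S
      ok v u v~u with T? (adj v u)
      ... | yes p = proj₂ (separator v u p)
      ... | no ¬p = ⊥-elim (¬p v~u)

-- Membership in NP

T⇒≡ : ∀ {b} → T b → b ≡ true
T⇒≡ = Equivalence.to T-≡

≡⇒T : ∀ {b} → b ≡ true → T b
≡⇒T = Equivalence.from T-≡

FSum-Sum : ∀ n f → FSum {n} (f ∘ toℕ) ≡ Sum n f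
FSum-Sum n f = go n f
  where
  shift : ∀ n f → f 0 + Sum n (f ∘ suc) ≡ Sum (suc n) f
  shift zero    f = refl
  shift (suc n) f = trans (sym (+-assoc (f 0) (f (suc n)) _)) (trans (cong (_+ Sum n (f ∘ suc)) (+-comm (f 0) (f (suc n))))
                      (trans (+-assoc (f (suc n)) (f 0) _) (cong (f (suc n) +_) (shift n f))))
  go : ∀ n f → FSum {n} (f ∘ toℕ) ≡ Sum n f
  go zero    f = refl
  go (suc n) f = trans (cong (f 0 +_) (go n (f ∘ suc))) (shift n f)

∀< : ∀ {n} {P : ℕ → Set} → (∀ (i : Fin n) → P (toℕ i)) → ∀ i → i < n → P i
∀< {P = P} h i i<n = subst P (Fin.toℕ-fromℕ< i<n) (h (fromℕ< i<n))

-- Implications are written as disjunctions and vertices as bounded numbers, so that this is the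
-- meaning of `goodᶠ` by definition.
Good : (n k : ℕ) → (ℕ → ℕ → Bool) → (ℕ → ℕ) → (ℕ → ℕ → ℕ → Bool) → Set
Good n k A h S =
    (∀ u → u < n → ¬ A u u ≡ true)
  × (∀ u → u < n → ∀ v → v < n → (¬ A u v ≡ true) ⊎ A v u ≡ true)
  × (∀ v → v < n → 3 ≤ h v ⊎ 3 ≤ h v + Sum n (λ w → b2n (A v w) * (h w ∸ 1)))
  × Sum n h ≤ k
  × (∀ v → v < n → ∀ u → u < n → (¬ A v u ≡ true) ⊎
      (S v u u ≡ true × (∀ a → a < n → ∀ b → b < n → (¬ (S v u a ≡ true × A a b ≡ true)) ⊎
        ((b ≡ v ⊎ A v b ≡ true ⊎ S v u b ≡ true) × ((¬ A v b ≡ true) ⊎ b ≡ u ⊎ A b u ≡ true)))))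

module FromGood (n k : ℕ) (A : ℕ → ℕ → Bool) (h : ℕ → ℕ) (S : ℕ → ℕ → ℕ → Bool) (h≤4 : ∀ v → h v ≤ 4)
                (good : Good n k A h S) where

  Γ : Graph
  Γ = record
    { order      = n
    ; adj        = λ u v → A (toℕ u) (toℕ v)
    ; adj-sym    = λ u v → symmetric (toℕ u) (toℕ v) (Fin.toℕ<n u) (Fin.toℕ<n v)
    ; adj-irrefl = λ v → not-true (proj₁ good (toℕ v) (Fin.toℕ<n v)) }
    where
    not-true : ∀ {b} → ¬ b ≡ true → b ≡ false
    not-true {false} _ = refl
    not-true {true}  n = ⊥-elim (n refl)
    symmetric : ∀ u v → u < n → v < n → A u v ≡ A v u
    symmetric u v u<n v<n with A u v | A v u | proj₁ (proj₂ good) u u<n v v<n | proj₁ (proj₂ good) v v<n u u<n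
    ... | false | false | _      | _      = refl
    ... | true  | true  | _      | _      = refl
    ... | true  | false | inj₁ m | _      = ⊥-elim (m refl)
    ... | true  | false | inj₂ () | _
    ... | false | true  | _      | inj₁ m = ⊥-elim (m refl)
    ... | false | true  | _      | inj₂ ()

  Γ-chordal : Chordal Γ
  Γ-chordal = separators⇒chordal Γ (λ v u a → S (toℕ v) (toℕ u) (toℕ a)) λ v u e →
    case proj₂ (proj₂ (proj₂ (proj₂ good))) (toℕ v) (Fin.toℕ<n v) (toℕ u) (Fin.toℕ<n u) of λ where
      (inj₁ m) → ⊥-elim (m (T⇒≡ e))
      (inj₂ (s , t)) → s , λ a b Sa ab → case t (toℕ a) (Fin.toℕ<n a) (toℕ b) (Fin.toℕ<n b) of λ where
        (inj₁ m)       → ⊥-elim (m (Sa , T⇒≡ ab))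
        (inj₂ (p , q)) → Sum.map Fin.toℕ-injective (Sum.map ≡⇒T id) p
                       , Sum.map (λ m e → m (T⇒≡ e)) (Sum.map Fin.toℕ-injective ≡⇒T) q

  labels : Fin n → Fin 5
  labels v = fromℕ< (s≤s (h≤4 (toℕ v)))

  labels-toℕ : ∀ v → toℕ (labels v) ≡ h (toℕ v)
  labels-toℕ v = Fin.toℕ-fromℕ< (s≤s (h≤4 (toℕ v)))

  labels-3rdf : Is3RDF Γ labels
  labels-3rdf = Equivalence.from (3rdf⇔dominates Γ labels) λ v lt →
    case proj₁ (proj₂ (proj₂ good)) (toℕ v) (Fin.toℕ<n v) of λ where
      (inj₁ le) → ⊥-elim (<⇒≱ lt (≤-trans le (≤-reflexive (sym (labels-toℕ v)))))
      (inj₂ le) → ≤-trans le (≤-reflexive (cong₂ _+_ (sym (labels-toℕ v))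
        (trans (sym (FSum-Sum n (λ w → b2n (A (toℕ v) w) * (h w ∸ 1))))
               (FSum-cong λ w → cong (λ m → b2n (A (toℕ v) (toℕ w)) * (m ∸ 1)) (sym (labels-toℕ w))))))

  labels-weight : weight Γ labels ≤ k
  labels-weight = ≤-trans (≤-reflexive (trans (weight-FSum Γ labels) (trans (FSum-cong labels-toℕ) (FSum-Sum n h))))
                          (proj₁ (proj₂ (proj₂ (proj₂ good))))

module _ (Γ : Graph) (k : ℕ) (f : Graph.Vertex Γ → Fin 5) (F : (v u a : Graph.Vertex Γ) → Bool)
         (A : ℕ → ℕ → Bool) (h : ℕ → ℕ) (S : ℕ → ℕ → ℕ → Bool)
         (A≡ : ∀ u v → A (toℕ u) (toℕ v) ≡ Graph.adj Γ u v) (h≡ : ∀ v → h (toℕ v) ≡ toℕ (f v))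
         (S≡ : ∀ v u a → S (toℕ v) (toℕ u) (toℕ a) ≡ F v u a)
         (rdf : Is3RDF Γ f) (light : weight Γ f ≤ k) (sep : Separators Γ F) where
  open Graph Γ

  good : Good order k A h S
  good = ∀< (λ u e → case trans (sym (trans (A≡ u u) (adj-irrefl u))) e of λ ())
       , ∀< (λ u → ∀< λ v → symmetric u v)
       , ∀< dominated
       , ≤-trans (≤-reflexive (trans (sym (FSum-Sum order h)) (trans (FSum-cong h≡) (sym (weight-FSum Γ f))))) light
       , ∀< (λ v → ∀< λ u → separated v u)
    where
    symmetric : ∀ u v → (¬ A (toℕ u) (toℕ v) ≡ true) ⊎ A (toℕ v) (toℕ u) ≡ true
    symmetric u v with adj u v in e
    ... | true  = inj₂ (trans (A≡ v u) (trans (adj-sym v u) e))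
    ... | false = inj₁ λ p → case trans (sym (trans (A≡ u v) e)) p of λ ()
    dominated : ∀ v → 3 ≤ h (toℕ v) ⊎ 3 ≤ h (toℕ v) + Sum order (λ w → b2n (A (toℕ v) w) * (h w ∸ 1))
    dominated v with toℕ (f v) <? 3
    ... | no ≥3  = inj₁ (≤-trans (≮⇒≥ ≥3) (≤-reflexive (sym (h≡ v))))
    ... | yes <3 = inj₂ (≤-trans (Equivalence.to (3rdf⇔dominates Γ f) rdf v <3) (≤-reflexive (cong₂ _+_ (sym (h≡ v))
                     (trans (FSum-cong λ w → cong₂ (λ b m → b2n b * (m ∸ 1)) (sym (A≡ v w)) (sym (h≡ w)))
                            (FSum-Sum order (λ w → b2n (A (toℕ v) w) * (h w ∸ 1)))))))
    separated : ∀ v u → (¬ A (toℕ v) (toℕ u) ≡ true) ⊎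
      (S (toℕ v) (toℕ u) (toℕ u) ≡ true × (∀ a → a < order → ∀ b → b < order → (¬ (S (toℕ v) (toℕ u) a ≡ true × A a b ≡ true)) ⊎
        ((b ≡ toℕ v ⊎ A (toℕ v) b ≡ true ⊎ S (toℕ v) (toℕ u) b ≡ true) × ((¬ A (toℕ v) b ≡ true) ⊎ b ≡ toℕ u ⊎ A b (toℕ u) ≡ true))))
    separated v u with T? (adj v u)
    ... | no m  = inj₁ λ p → m (≡⇒T (trans (sym (A≡ v u)) p))
    ... | yes e = inj₂ (trans (S≡ v u u) (proj₁ (sep v u e)) , ∀< (λ a → ∀< λ b → step a b))
      where
      step : ∀ a b → (¬ (S (toℕ v) (toℕ u) (toℕ a) ≡ true × A (toℕ a) (toℕ b) ≡ true)) ⊎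
        ((toℕ b ≡ toℕ v ⊎ A (toℕ v) (toℕ b) ≡ true ⊎ S (toℕ v) (toℕ u) (toℕ b) ≡ true)
         × ((¬ A (toℕ v) (toℕ b) ≡ true) ⊎ toℕ b ≡ toℕ u ⊎ A (toℕ b) (toℕ u) ≡ true))
      step a b with F v u a in p | adj a b in q
      ... | false | _     = inj₁ λ (r , _) → case trans (sym (trans (S≡ v u a) p)) r of λ ()
      ... | true  | false = inj₁ λ (_ , r) → case trans (sym (trans (A≡ a b) q)) r of λ ()
      ... | true  | true  = let r , s = proj₂ (sep v u e) a b p (≡⇒T q) in inj₂
        ( Sum.map (cong toℕ) (Sum.map (λ t → trans (A≡ v b) (T⇒≡ t)) (trans (S≡ v u b))) r
        , Sum.map (λ m t → m (≡⇒T (trans (sym (A≡ v b)) t))) (Sum.map (cong toℕ) (λ t → trans (A≡ b u) (T⇒≡ t))) s)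

open Logic 15

ℓᵛ nᵛ kᵛ vᵛ uᵛ aᵛ bᵛ cᵛ iᵛ : Fin V
ℓᵛ = 1F
nᵛ = 2F
kᵛ = 3F
vᵛ = 4F
uᵛ = 5F
aᵛ = 6F
bᵛ = 7F
cᵛ = 8F
iᵛ = 9F

ℓᵗ nᵗ kᵗ vᵗ uᵗ aᵗ bᵗ cᵗ iᵗ : Tm
ℓᵗ = var ℓᵛ
nᵗ = var nᵛ
kᵗ = var kᵛ
vᵗ = var vᵛ
uᵗ = var uᵛ
aᵗ = var aᵛ
bᵗ = var bᵛ
cᵗ = var cᵛ
iᵗ = var iᵛ

-- The word is unary ℓ ++ x ++ y with |x| = ℓ; x is to be the instance with n vertices
-- and bound k, and y starts with four bits per vertex that add up to its label.
sucᵗ instanceBit certificateBit labelᵗ : Tm → Tm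
sucᵗ t           = con 1 +ᵗ t
instanceBit t    = sucᵗ ℓᵗ +ᵗ t
certificateBit t = sucᵗ ℓᵗ +ᵗ (ℓᵗ +ᵗ t)
labelᵗ v         = sumᵗ cᵛ (con 4) (bitᵗ (certificateBit (con 4 *ᵗ v +ᵗ cᵗ)))

adjBit : Tm → Tm → Tm
adjBit u v = instanceBit (sucᵗ nᵗ +ᵗ (sucᵗ kᵗ +ᵗ (nᵗ *ᵗ u +ᵗ v)))

sepBit : Tm → Tm → Tm → Tm
sepBit v u a = certificateBit (nᵗ *ᵗ con 4 +ᵗ (nᵗ *ᵗ nᵗ *ᵗ v +ᵗ (nᵗ *ᵗ u +ᵗ a)))

goodᶠ headerᶠ verifyᶠ : Fm
goodᶠ =
     allᶠ uᵛ nᵗ (¬ᶠ bitᶠ (adjBit uᵗ uᵗ))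
  ∧ᶠ allᶠ uᵛ nᵗ (allᶠ vᵛ nᵗ ((¬ᶠ bitᶠ (adjBit uᵗ vᵗ)) ∨ᶠ bitᶠ (adjBit vᵗ uᵗ)))
  ∧ᶠ allᶠ vᵛ nᵗ (con 3 ≤ᶠ labelᵗ vᵗ ∨ᶠ con 3 ≤ᶠ labelᵗ vᵗ +ᵗ sumᵗ uᵛ nᵗ (bitᵗ (adjBit vᵗ uᵗ) *ᵗ (labelᵗ uᵗ ∸ᵗ con 1)))
  ∧ᶠ sumᵗ vᵛ nᵗ (labelᵗ vᵗ) ≤ᶠ kᵗ
  ∧ᶠ allᶠ vᵛ nᵗ (allᶠ uᵛ nᵗ ((¬ᶠ bitᶠ (adjBit vᵗ uᵗ)) ∨ᶠ
       (bitᶠ (sepBit vᵗ uᵗ uᵗ) ∧ᶠ allᶠ aᵛ nᵗ (allᶠ bᵛ nᵗ ((¬ᶠ (bitᶠ (sepBit vᵗ uᵗ aᵗ) ∧ᶠ bitᶠ (adjBit aᵗ bᵗ))) ∨ᶠ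
         ((bᵗ ≡ᶠ vᵗ ∨ᶠ bitᶠ (adjBit vᵗ bᵗ) ∨ᶠ bitᶠ (sepBit vᵗ uᵗ bᵗ))
          ∧ᶠ ((¬ᶠ bitᶠ (adjBit vᵗ bᵗ)) ∨ᶠ bᵗ ≡ᶠ uᵗ ∨ᶠ bitᶠ (adjBit bᵗ uᵗ))))))))
headerᶠ =
     allᶠ iᵛ nᵗ (bitᶠ (instanceBit iᵗ)) ∧ᶠ (¬ᶠ bitᶠ (instanceBit nᵗ))
  ∧ᶠ allᶠ iᵛ kᵗ (bitᶠ (instanceBit (sucᵗ nᵗ +ᵗ iᵗ))) ∧ᶠ (¬ᶠ bitᶠ (instanceBit (sucᵗ nᵗ +ᵗ kᵗ)))
  -- The exact length leaves room for the matrix and no further bits; without it the word would not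
  -- have to be an encoding.
  ∧ᶠ ℓᵗ ≡ᶠ sucᵗ nᵗ +ᵗ (sucᵗ kᵗ +ᵗ nᵗ *ᵗ nᵗ) ∧ᶠ con 1 ≤ᶠ kᵗ ∧ᶠ kᵗ ≤ᶠ nᵗ
-- The numbers ℓ, n and k are searched for instead of parsed: none exceeds the length of the word,
-- which is the value of variable 0.
verifyᶠ = exᶠ ℓᵛ (var 0F) (allᶠ iᵛ ℓᵗ (bitᶠ iᵗ) ∧ᶠ (¬ᶠ bitᶠ ℓᵗ)
  ∧ᶠ exᶠ nᵛ (sucᵗ ℓᵗ) (exᶠ kᵛ (sucᵗ ℓᵗ) (headerᶠ ∧ᶠ goodᶠ)))

module Bits (w : Word) (ℓ n k : ℕ) where

  X : ℕ → Bool
  X i = nth w (suc ℓ + i)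

  Y : ℕ → Bool
  Y i = nth w (suc ℓ + (ℓ + i))

  A : ℕ → ℕ → Bool
  A u v = X (suc n + (suc k + (n * u + v)))

  label : ℕ → ℕ
  label v = Sum 4 (λ c → b2n (Y (4 * v + c)))

  S : ℕ → ℕ → ℕ → Bool
  S v u a = Y (n * 4 + (n * n * v + (n * u + a)))

  Header : Set
  Header = (∀ i → i < n → X i ≡ true) × (¬ X n ≡ true)
         × (∀ i → i < k → X (suc n + i) ≡ true) × (¬ X (suc n + k) ≡ true)
         × ℓ ≡ suc n + (suc k + n * n) × 1 ≤ k × k ≤ n

  label≤4 : ∀ v → label v ≤ 4
  label≤4 v = +-mono-≤ (b2n≤1 (Y (4 * v + 3))) (+-mono-≤ (b2n≤1 (Y (4 * v + 2)))
                (+-mono-≤ (b2n≤1 (Y (4 * v + 1))) (+-mono-≤ (b2n≤1 (Y (4 * v + 0))) z≤n)))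
    where
    b2n≤1 : ∀ b → b2n b ≤ 1
    b2n≤1 true  = s≤s z≤n
    b2n≤1 false = z≤n

nth-unary : ∀ n (r : Word) {i} → i < n → nth (unary n ++ r) i ≡ true
nth-unary (suc n) r {zero}  _         = refl
nth-unary (suc n) r {suc i} (s≤s i<n) = nth-unary n r i<n

nth-unary-end : ∀ n (r : Word) → nth (unary n ++ r) n ≡ false
nth-unary-end zero    r = refl
nth-unary-end (suc n) r = nth-unary-end n r

nth-unary-rest : ∀ n (r : Word) i → nth (unary n ++ r) (suc n + i) ≡ nth r i
nth-unary-rest n r i = trans (cong (λ m → nth (unary n ++ r) (m + i)) (sym (length-unary n))) (nth-++ʳ (unary n) r i)

unary-split : ∀ n {r} (x : Word) → length x ≡ suc n + r → (∀ i → i < n → nth x i ≡ true) → ¬ nth x n ≡ true →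
              ∃[ x′ ] x ≡ unary n ++ x′ × length x′ ≡ r
unary-split zero    (true  ∷ x) e h n = ⊥-elim (n refl)
unary-split zero    (false ∷ x) e h n = x , refl , suc-injective e
unary-split (suc k) (b ∷ x)     e h n with refl ← h 0 (s≤s z≤n) =
  let x′ , p , q = unary-split k x (suc-injective e) (λ i i<k → h (suc i) (s≤s i<k)) n in x′ , cong (true ∷_) p , q

module _ (x y : Word) where
  private
    ℓ = length x
    w = pair x y

  bit-header : ∀ {i} → i < ℓ → nth w i ≡ true
  bit-header = nth-unary ℓ (x ++ y)

  bit-separator : nth w ℓ ≡ false
  bit-separator = nth-unary-end ℓ (x ++ y)

  bit-first : ∀ {i} → i < ℓ → nth w (suc ℓ + i) ≡ nth x i
  bit-first {i} i<ℓ = trans (nth-unary-rest ℓ (x ++ y) i) (nth-++ˡ x y i<ℓ)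

  bit-second : ∀ i → nth w (suc ℓ + (ℓ + i)) ≡ nth y i
  bit-second i = trans (nth-unary-rest ℓ (x ++ y) (ℓ + i)) (nth-++ʳ x y i)

  header-length : ∀ {m} → (∀ i → i < m → nth w i ≡ true) → ¬ nth w m ≡ true → m ≡ ℓ
  header-length {m} h n with <-cmp m ℓ
  ... | tri< lt _ _ = ⊥-elim (n (bit-header lt))
  ... | tri≈ _ e _  = e
  ... | tri> _ _ gt = case trans (sym bit-separator) (h ℓ gt) of λ ()

verify-sound : ∀ x y → ⟦ verifyᶠ ⟧ᶠ (pair x y) (input-env (pair x y)) → DecisionProblem.language Problem x
verify-sound x y (m , _ , h , s , n , _ , k , _ , header , goodness) with refl ← header-length x y h s =
  (inst , Γ-chordal) , word , labels , labels-3rdf , labels-weight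
  where
  open Bits (pair x y) (length x) n k
  open FromGood n k A label S label≤4 goodness
  inst : RomanInstance
  inst = let _ , _ , _ , _ , _ , 1≤k , k≤n = header in record { graph = Γ ; k = k ; k-pos = 1≤k ; k-bound = k≤n }
  word : encode inst ≡ x
  word = let _ , _ , _ , _ , e , _ = header
             x₁ , p₁ , q₁ = unary-split n x e (λ i i<n → trans (sym (first (≤-trans i<n (n≤1+n n)))) (h₁ i i<n))
                              (λ t → s₁ (trans (first ≤-refl) t))
             x₂ , p₂ , q₂ = unary-split k x₁ q₁
                              (λ i i<k → trans (sym (second p₁ (≤-trans i<k (n≤1+n k)))) (h₂ i i<k))
                              (λ t → s₂ (trans (second p₁ ≤-refl) t))
         in sym (trans p₁ (cong (unary n ++_) (trans p₂ (cong (unary k ++_) (nth-ext (trans q₂ (sym (matrix-length Γ)))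
              λ r r< → entry p₁ p₂ (subst (r <_) q₂ r<))))))
    where
    h₁ = proj₁ header
    s₁ = proj₁ (proj₂ header)
    h₂ = proj₁ (proj₂ (proj₂ header))
    s₂ = proj₁ (proj₂ (proj₂ (proj₂ header)))
    size : length x ≡ suc n + (suc k + n * n)
    size = proj₁ (proj₂ (proj₂ (proj₂ (proj₂ header))))
    inside : ∀ {i} → i < suc n + (suc k + n * n) → X i ≡ nth x i
    inside lt = bit-first x y (≤-trans lt (≤-reflexive (sym size)))
    first : ∀ {i} → i < suc n → X i ≡ nth x i
    first lt = inside (≤-trans lt (m≤m+n (suc n) _))
    second : ∀ {x₁ i} → x ≡ unary n ++ x₁ → i < suc k → X (suc n + i) ≡ nth x₁ i
    second {x₁} {i} p lt = trans (inside (+-monoʳ-< (suc n) (≤-trans lt (m≤m+n (suc k) _))))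
      (trans (cong (λ z → nth z (suc n + i)) p) (nth-unary-rest n x₁ i))
    entry : ∀ {x₁ x₂ r} → x ≡ unary n ++ x₁ → x₁ ≡ unary k ++ x₂ → r < n * n → nth x₂ r ≡ nth (Graph.matrix Γ) r
    entry {x₁} {x₂} {r} p₁ p₂ r< = begin
      nth x₂ r                                  ≡⟨ nth-unary-rest k x₂ r ⟨
      nth (unary k ++ x₂) (suc k + r)           ≡⟨ cong (λ z → nth z (suc k + r)) p₂ ⟨
      nth x₁ (suc k + r)                        ≡⟨ nth-unary-rest n x₁ (suc k + r) ⟨
      nth (unary n ++ x₁) (suc n + (suc k + r)) ≡⟨ cong (λ z → nth z (suc n + (suc k + r))) p₁ ⟨
      nth x (suc n + (suc k + r))               ≡⟨ inside (+-monoʳ-< (suc n) (+-monoʳ-< (suc k) r<)) ⟨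
      X (suc n + (suc k + r))                   ≡⟨ cong (λ r → X (suc n + (suc k + r))) digits ⟩
      A (toℕ u) (toℕ v)                         ≡⟨ matrix-nth Γ u v ⟨
      nth (Graph.matrix Γ) (n * toℕ u + toℕ v)  ≡⟨ cong (nth (Graph.matrix Γ)) digits ⟨
      nth (Graph.matrix Γ) r                    ∎
      where
      open ≡-Reasoning
      positive : 0 < n
      positive = n≢0⇒n>0 λ { refl → case r< of λ () }
      instance
        n≢0 : NonZero n
        n≢0 = >-nonZero positive
      u v : Fin n
      u = fromℕ< (m<n*o⇒m/o<n {r} {n} {n} r<)
      v = fromℕ< (m%n<n r n)
      digits : r ≡ n * toℕ u + toℕ v
      digits = trans (m≡m%n+[m/n]*n r n) (trans (+-comm (r % n) _) (cong₂ _+_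
        (trans (*-comm (r / n) n) (cong (n *_) (sym (Fin.toℕ-fromℕ< (m<n*o⇒m/o<n {r} {n} {n} r<)))))
        (sym (Fin.toℕ-fromℕ< (m%n<n r n)))))

extendFin : ∀ {n} {B : Set} → B → (Fin n → B) → ℕ → B
extendFin {n} d f i with i <? n
... | yes i<n = f (fromℕ< i<n)
... | no _    = d

extendFin-toℕ : ∀ {n} {B : Set} (d : B) (f : Fin n → B) i → extendFin d f (toℕ i) ≡ f i
extendFin-toℕ {n} d f i with toℕ i <? n
... | yes i<n = cong f (Fin.fromℕ<-toℕ i i<n)
... | no ≮    = ⊥-elim (≮ (Fin.toℕ<n i))

Sum-cong : ∀ n {f g : ℕ → ℕ} → (∀ i → i < n → f i ≡ g i) → Sum n f ≡ Sum n g
Sum-cong zero    h = refl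
Sum-cong (suc n) h = cong₂ _+_ (h n ≤-refl) (Sum-cong n λ i i<n → h i (m≤n⇒m≤1+n i<n))

-- Labels are written in unary as the number of ones among four bits, so every certificate decodes
-- to labels at most 4.
Sum-thermometer : ∀ (m : Fin 5) → Sum 4 (λ c → b2n (c <ᵇ toℕ m)) ≡ toℕ m
Sum-thermometer 0F = refl
Sum-thermometer 1F = refl
Sum-thermometer 2F = refl
Sum-thermometer 3F = refl
Sum-thermometer 4F = refl

-- The polynomial 4z + z³: four label bits per vertex and one bit per triple of vertices for the
-- separators.
certificateBound : Polynomial
certificateBound = 0 ∷ 4 ∷ 0 ∷ 1 ∷ []

-- The certificate of a yes-instance

module Certificate (i : RomanInstance) (chordal : Chordal (RomanInstance.graph i)) (yes-i : Yes i) where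
  open RomanInstance i
  open Graph graph renaming (order to n)

  f : Vertex → Fin 5
  f = proj₁ yes-i

  F : Vertex → Vertex → Vertex → Bool
  F = proj₁ (chordal⇒separators graph chordal)

  fᴺ : ℕ → ℕ
  fᴺ = extendFin 0 (toℕ ∘ f)

  Fᴺ : ℕ → ℕ → ℕ → Bool
  Fᴺ = extendFin (λ _ _ → false) λ v → extendFin (λ _ → false) λ u → extendFin false (F v u)

  labelWord sepWord y x : Word
  labelWord = Cat n (λ v → Cat 4 (λ c → [ c <ᵇ fᴺ v ]))
  sepWord   = Cat n (λ v → Cat n (λ u → Cat n (λ a → [ Fᴺ v u a ])))
  y         = labelWord ++ sepWord
  x         = encode i

  labelWord-length : length labelWord ≡ n * 4
  labelWord-length = Cat-length n _ λ v _ → length-bits 4 (λ c → c <ᵇ fᴺ v)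

  sepWord-length : length sepWord ≡ n * (n * n)
  sepWord-length = Cat-length n _ λ v _ → Cat-length n _ λ u _ → length-bits n (Fᴺ v u)

  x-length : length x ≡ suc n + (suc k + n * n)
  x-length = trans (length-++ (unary n)) (cong₂ _+_ (length-unary n)
    (trans (length-++ (unary k)) (cong₂ _+_ (length-unary k) (matrix-length graph))))

  open Bits (pair x y) (length x) n k

  inside : ∀ {j} → j < suc n + (suc k + n * n) → X j ≡ nth x j
  inside lt = bit-first x y (≤-trans lt (≤-reflexive (sym x-length)))

  header : Header
  header = (λ j j<n → trans (inside (≤-trans j<n (≤-trans (n≤1+n n) (m≤m+n (suc n) _)))) (nth-unary n _ j<n))
    , (λ t → case trans (sym t) (trans (inside (m≤m+n (suc n) _)) (nth-unary-end n _)) of λ ())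
    , (λ j j<k → trans (inside (+-monoʳ-< (suc n) (≤-trans j<k (≤-trans (n≤1+n k) (m≤m+n (suc k) _)))))
                   (trans (nth-unary-rest n _ j) (nth-unary k _ j<k)))
    , (λ t → case trans (sym t) (trans (inside (+-monoʳ-< (suc n) (m≤m+n (suc k) _)))
                   (trans (nth-unary-rest n _ k) (nth-unary-end k _))) of λ ())
    , x-length , k-pos , k-bound

  entry< : ∀ {m r u v} → u < m → v < r → r * u + v < m * r
  entry< {m} {r} {u} {v} u<m v<r = ≤-trans (+-monoʳ-< (r * u) v<r)
    (≤-trans (≤-reflexive (trans (+-comm (r * u) r) (cong (r +_) (*-comm r u)))) (*-monoˡ-≤ r u<m))

  A≡ : ∀ u v → A (toℕ u) (toℕ v) ≡ adj u v
  A≡ u v = trans (inside (+-monoʳ-< (suc n) (+-monoʳ-< (suc k) (entry< (Fin.toℕ<n u) (Fin.toℕ<n v)))))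
    (trans (nth-unary-rest n _ _) (trans (nth-unary-rest k _ _) (matrix-nth graph u v)))

  label≡ : ∀ v → label (toℕ v) ≡ toℕ (f v)
  label≡ v = trans (Sum-cong 4 λ c c<4 → cong b2n (begin
      Y (4 * toℕ v + c)                          ≡⟨ bit-second x y (4 * toℕ v + c) ⟩
      nth y (4 * toℕ v + c)                      ≡⟨ nth-++ˡ labelWord sepWord (≤-trans (entry< (Fin.toℕ<n v) c<4) (≤-reflexive (sym labelWord-length))) ⟩
      nth labelWord (4 * toℕ v + c)              ≡⟨ nth-Cat n _ (λ v _ → length-bits 4 (λ c → c <ᵇ fᴺ v)) (Fin.toℕ<n v) c<4 ⟩
      nth (Cat 4 (λ c → [ c <ᵇ fᴺ (toℕ v) ])) c  ≡⟨ nth-bits 4 (λ c → c <ᵇ fᴺ (toℕ v)) c<4 ⟩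
      (c <ᵇ fᴺ (toℕ v))                          ≡⟨ cong (c <ᵇ_) (extendFin-toℕ 0 (toℕ ∘ f) v) ⟩
      (c <ᵇ toℕ (f v))                           ∎))
    (Sum-thermometer (f v))
    where open ≡-Reasoning

  S≡ : ∀ v u a → S (toℕ v) (toℕ u) (toℕ a) ≡ F v u a
  S≡ v u a = begin
    Y (n * 4 + r)
      ≡⟨ bit-second x y (n * 4 + r) ⟩
    nth y (n * 4 + r)
      ≡⟨ cong (λ m → nth y (m + r)) labelWord-length ⟨
    nth y (length labelWord + r)
      ≡⟨ nth-++ʳ labelWord sepWord r ⟩
    nth sepWord r
      ≡⟨ nth-Cat n _ (λ v _ → Cat-length n _ λ u _ → length-bits n (Fᴺ v u)) (Fin.toℕ<n v) (entry< (Fin.toℕ<n u) (Fin.toℕ<n a)) ⟩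
    nth (Cat n (λ u → Cat n (λ a → [ Fᴺ (toℕ v) u a ]))) (n * toℕ u + toℕ a)
      ≡⟨ nth-Cat n _ (λ u _ → length-bits n (Fᴺ (toℕ v) u)) (Fin.toℕ<n u) (Fin.toℕ<n a) ⟩
    nth (Cat n (λ a → [ Fᴺ (toℕ v) (toℕ u) a ])) (toℕ a)
      ≡⟨ nth-bits n (Fᴺ (toℕ v) (toℕ u)) (Fin.toℕ<n a) ⟩
    Fᴺ (toℕ v) (toℕ u) (toℕ a)
      ≡⟨ cong (λ g → g (toℕ u) (toℕ a)) (extendFin-toℕ (λ _ _ → false) (λ v → extendFin (λ _ → false) λ u → extendFin false (F v u)) v) ⟩
    extendFin (λ _ → false) (λ u → extendFin false (F v u)) (toℕ u) (toℕ a)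
      ≡⟨ cong (λ g → g (toℕ a)) (extendFin-toℕ (λ _ → false) (λ u → extendFin false (F v u)) u) ⟩
    extendFin false (F v u) (toℕ a)
      ≡⟨ extendFin-toℕ false (F v u) a ⟩
    F v u a ∎
    where
    open ≡-Reasoning
    r : ℕ
    r = n * n * toℕ v + (n * toℕ u + toℕ a)

  verified : ⟦ verifyᶠ ⟧ᶠ (pair x y) (input-env (pair x y))
  verified = length x , ≤-trans (m≤m+n (suc (length x)) _) (≤-reflexive (sym (length-pair x y)))
    , (λ j → bit-header x y) , (λ t → case trans (sym t) (bit-separator x y) of λ ())
    , n , s≤s (≤-trans (≤-trans (n≤1+n n) (m≤m+n (suc n) _)) (≤-reflexive (sym x-length)))
    , k , s≤s (≤-trans (≤-trans k-bound (≤-trans (n≤1+n n) (m≤m+n (suc n) _))) (≤-reflexive (sym x-length)))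
    , header
    , good graph k f F A label S A≡ label≡ S≡ (proj₁ (proj₂ yes-i)) (proj₂ (proj₂ yes-i)) (proj₂ (chordal⇒separators graph chordal))

  y-length : length y ≤ eval certificateBound (length x)
  y-length = ≤-trans (≤-reflexive (trans (length-++ labelWord) (trans (cong₂ _+_ labelWord-length sepWord-length) (value n))))
    (eval-mono certificateBound (≤-trans (≤-trans (n≤1+n n) (m≤m+n (suc n) _)) (≤-reflexive (sym x-length))))
    where
    value : ∀ n → n * 4 + n * (n * n) ≡ 0 + n * (4 + n * (0 + n * (1 + n * 0)))
    value = solve-∀

in-np : InNP (DecisionProblem.language Problem)
in-np = (λ w → ⟦ verifyᶠ ⟧ᶠ w (input-env w)) , certificateBound , formula-InP verifyᶠ , λ x → mk⇔
  (λ { ((i , chordal) , refl , h) →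
       Certificate.y i chordal h , Certificate.y-length i chordal h , Certificate.verified i chordal h })
  (λ (y , _ , v) → verify-sound x y v)

theorem2 : NPComplete (TRIPLE-ROM-DOM restrictedTo (λ i → Chordal (RomanInstance.graph i)))
theorem2 = in-np , np-hard
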